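{- Let $G$ be a $2$-connected outerplanar graph, embedded in the plane with all vertices on the boundary of the infinite face, such that every finite face of $G$ is odd and $|F(G)|\ge 3$. Then $c_e(G)>0$ and $$\frac{|F(G)|-1}{2c_e(G)}+1\ \le\ \frac{c_o(G)}{c_e(G)}\ \le\ \frac{|F(G)|-2}{c_e(G)}+1 .$$ In particular, $1\le c_o(G)/c_e(G)\le 2$.
   Context: All graphs are finite, simple and undirected. $F(G)$ is the set of faces of the embedded graph $G$, including the unique infinite face. A finite face is odd (resp. even) if the length of its boundary walk is odd (resp. even). $c_o(G)$ (resp. $c_e(G)$) denotes the number of distinct cycles of odd (resp. even) length in $G$ (two subgraphs are distinct if their vertex sets or edge sets differ). -}

module Defs where

open import Data.Nat using (ℕ; zero; suc; _+_; _*_; _<_; _≤_)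
open import Data.Nat.Properties using ()
open import Data.Bool using (Bool; true; false; if_then_else_; _∧_)
open import Data.Nat using (_<ᵇ_)
open import Data.Fin using (Fin; toℕ)
open import Data.Vec using (Vec; lookup; tabulate; toList)
open import Data.List using (List; length; map; allFin)
open import Data.Nat.ListAction using (sum)
open import Data.Unit using (⊤)
open import Data.List.Relation.Unary.Unique.Propositional using (Unique)
open import Data.List.Membership.Propositional using (_∈_)
open import Data.Product using (Σ; ∃; _×_; _,_; proj₁; proj₂)
open import Data.Sum using (_⊎_)
open import Relation.Binary.PropositionalEquality using (_≡_; _≢_)
open import Relation.Nullary using (¬_)
open import Function using (_∘_)
open import Function.Bundles using (_⇔_)

record Graph (n : ℕ) : Set where
  field
    adj       : Fin n → Fin n → Bool
    symmetric : ∀ u v → adj u v ≡ adj v u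
    irrefl    : ∀ u → adj u u ≡ false

open Graph public

b2n : Bool → ℕ
b2n true  = 1
b2n false = 0

countB : ∀ {n} → (Fin n → Bool) → ℕ
countB {n} p = sum (map (b2n ∘ p) (allFin n))

countB₂ : ∀ {n} → (Fin n → Fin n → Bool) → ℕ
countB₂ {n} r = sum (map (λ u → countB (r u)) (allFin n))

twiceEdges : ∀ {n} → Graph n → ℕ
twiceEdges G = countB₂ (adj G)

edgeCount : ∀ {n} → Graph n → ℕ
edgeCount G = countB₂ (λ u v → adj G u v ∧ (toℕ u <ᵇ toℕ v))

record HasCount {A : Set} (P : A → Set) (k : ℕ) : Set where
  field
    elems    : List A
    unique   : Unique elems
    size     : length elems ≡ k
    sound    : ∀ x → x ∈ elems → P x
    complete : ∀ x → P x → x ∈ elems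

data Walk {n : ℕ} (R : Fin n → Fin n → Bool) (A : Fin n → Set)
          : Fin n → Fin n → Set where
  here : ∀ {u} → A u → Walk R A u u
  step : ∀ {u v w} → A u → R u v ≡ true → Walk R A v w → Walk R A u w

Connected : ∀ {n} → Graph n → Set
Connected {n} G = ∀ (u v : Fin n) → Walk (adj G) (λ _ → ⊤) u v

TwoConnected : ∀ {n} → Graph n → Set
TwoConnected {n} G =
  (3 ≤ n) × Connected G ×
  (∀ (x u v : Fin n) → u ≢ x → v ≢ x → Walk (adj G) (λ w → w ≢ x) u v)

-- Cycles (as subgraphs, identified by their edge set)

Rel : ℕ → Set
Rel n = Vec (Vec Bool n) n

_∋⟨_,_⟩ : ∀ {n} → Rel n → Fin n → Fin n → Bool
S ∋⟨ u , v ⟩ = lookup (lookup S u) v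

degIn : ∀ {n} → Rel n → Fin n → ℕ
degIn S u = countB (lookup (lookup S u))

IsCycle : ∀ {n} → Graph n → Rel n → Set
IsCycle {n} G S =
  (∀ u v → S ∋⟨ u , v ⟩ ≡ true → adj G u v ≡ true) ×
  (∀ u v → S ∋⟨ u , v ⟩ ≡ S ∋⟨ v , u ⟩) ×
  (∃ λ u → ∃ λ v → S ∋⟨ u , v ⟩ ≡ true) ×
  (∀ u → degIn S u ≡ 0 ⊎ degIn S u ≡ 2) ×
  (∀ u v → degIn S u ≡ 2 → degIn S v ≡ 2 →
     Walk (S ∋⟨_,_⟩) (λ _ → ⊤) u v)

cycleLength : ∀ {n} → Rel n → ℕ
cycleLength S = countB (λ u → isTwo (degIn S u))
  where
    isTwo : ℕ → Bool
    isTwo 2 = true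
    isTwo _ = false

data Even : ℕ → Set where
  e0  : Even 0
  e2+ : ∀ {k} → Even k → Even (suc (suc k))

Odd : ℕ → Set
Odd k = ¬ Even k

OddCycle EvenCycle : ∀ {n} → Graph n → Rel n → Set
OddCycle  G S = IsCycle G S × Odd  (cycleLength S)
EvenCycle G S = IsCycle G S × Even (cycleLength S)

-- Plane embeddings as rotation systems (combinatorial maps)

-- σ u v = the neighbour following v in the cyclic order around u
IsRotationSystem : ∀ {n} → Graph n → (Fin n → Fin n → Fin n) → Set
IsRotationSystem {n} G σ =
  (∀ u v → adj G u v ≡ true → adj G u (σ u v) ≡ true) ×
  (∀ u v w → adj G u v ≡ true → adj G u w ≡ true → σ u v ≡ σ u w → v ≡ w) ×
  (∀ u v w → adj G u v ≡ true → adj G u w ≡ true →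
     ∃ λ k → iter (σ u) k v ≡ w)
  where
    iter : (Fin n → Fin n) → ℕ → Fin n → Fin n
    iter f zero    x = x
    iter f (suc k) x = f (iter f k x)

Dart : ℕ → Set
Dart n = Fin n × Fin n

faceStep : ∀ {n} → (Fin n → Fin n → Fin n) → Dart n → Dart n
faceStep σ (u , v) = v , σ v u

iterD : ∀ {n} → (Dart n → Dart n) → ℕ → Dart n → Dart n
iterD f zero    x = x
iterD f (suc k) x = f (iterD f k x)

IsFace : ∀ {n} → Graph n → (Fin n → Fin n → Fin n) → Rel n → Set
IsFace {n} G σ D =
  Σ (Dart n) λ d → (adj G (proj₁ d) (proj₂ d) ≡ true) ×
    (∀ (e : Dart n) →
       (D ∋⟨ proj₁ e , proj₂ e ⟩ ≡ true) ⇔ (∃ λ k → iterD (faceStep σ) k d ≡ e))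

faceLength : ∀ {n} → Rel n → ℕ
faceLength D = countB₂ (D ∋⟨_,_⟩)

AllVerticesOn : ∀ {n} → Rel n → Set
AllVerticesOn {n} D = ∀ (v : Fin n) → ∃ λ w → D ∋⟨ v , w ⟩ ≡ true

-- By Euler's formula, a spanning tree of the dual together with a spanning tree of G avoiding it exhausts the
-- edges, whence every even edge set bounds a set of faces. This discrete Jordan theorem shows that the outer
-- face is a Hamiltonian cycle, that no two chords cross in its vertex order, and that an edge ab spanning more
-- than one outer step lies above a face whose other edges form an increasing path from a to b.
-- A cycle with extreme vertices a < b consists of the edge ab and an increasing path from a to b with at
-- least two edges, so cycles can be counted by recursion over the faces, weighting a path with r edges by
-- (-1)^r. The weight p of all increasing paths from a to b, including ab itself, is multiplicative along the
-- lower side of the face below ab, which has evenly many edges; hence p is -1 or 0, and it is 0 iff p = -1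
-- on every lower edge. Thus c_o - c_e is the number s of the N = f - 1 finite faces with p = 0. Every face
-- with p = -1 has a child with p = 0, which gives N/2 ≤ s, and not all faces have p = 0 if N ≥ 2.
-- Pairs of adjacent faces already provide N - 1 even cycles.
module Submission where

open import Defs
open import Data.Bool using (Bool; true; false; _∧_; _∨_; _xor_; not; T; if_then_else_)
open import Data.Bool.Properties using (∨-comm; xor-comm; xor-assoc; xor-identityʳ; ¬-not; T-≡) renaming (_≟_ to _≟ᵇ_)
open import Data.Bool.Solver using (module xor-∧-Solver)
open import Data.Empty using (⊥; ⊥-elim)
open import Data.Fin as Fin using (Fin; toℕ; fromℕ<)
open import Data.Fin.Properties as Finᵖ using (toℕ-injective; toℕ-fromℕ<; pigeonhole; combine-injective)
open import Data.List using (List; []; _∷_; _++_; length; map; filter; allFin; cartesianProduct)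
open import Data.List.Properties using (length-map; length-++; length-++-sucʳ; filter-++; length-tabulate)
open import Data.List.Membership.Propositional using (_∈_; _∉_)
open import Data.List.Membership.Propositional.Properties
  using (∈-++⁺ˡ; ∈-++⁺ʳ; ∈-++⁻; ∈-map⁺; ∈-map⁻; ∈-filter⁺; ∈-filter⁻; ∈-cartesianProduct⁺; ∈-cartesianProduct⁻; ∈-allFin; ∈-∃++)
open import Data.List.Relation.Unary.All as All using (All; []; _∷_)
open import Data.List.Relation.Unary.AllPairs using ([]; _∷_)
open import Data.List.Relation.Unary.Any using (here; there)
open import Data.List.Relation.Unary.Unique.Propositional using (Unique)
import Data.List.Relation.Unary.Unique.Propositional.Properties as Uniqueᵖ
open import Data.Nat using (ℕ; zero; suc; _+_; _*_; _∸_; _≤_; _<_; z≤n; s≤s; s≤s⁻¹; _<ᵇ_; _≤?_; _<?_)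
open import Data.Nat.ListAction using (sum)
open import Data.Nat.Properties as ℕᵖ using (≤-refl; ≤-trans; ≤-reflexive; ≤-antisym; <-trans; <-irrefl; <-cmp; +-suc; +-comm; <⇒≤; ≤-<-trans; <-≤-trans)
open import Data.Product using (Σ; ∃; _×_; _,_; proj₁; proj₂; swap; uncurry)
open import Data.Product.Properties using (≡-dec)
open import Data.Sum using (_⊎_; inj₁; inj₂; [_,_]′)
open import Data.Unit using (⊤; tt)
open import Data.Vec as Vec using (lookup; tabulate)
import Data.Vec.Properties as Vecᵖ
open import Function using (_∘_; id)
open import Function.Bundles using (mk⇔; Equivalence)
open import Relation.Binary using (tri<; tri≈; tri>)
open import Relation.Binary.Definitions using (DecidableEquality)
open import Relation.Binary.PropositionalEquality using (_≡_; _≢_; refl; sym; trans; cong; cong₂; subst; subst₂; ≢-sym; module ≡-Reasoning)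
open import Relation.Nullary using (¬_; Dec; yes; no; ⌊_⌋; contradiction; ¬?; _×-dec_; _⊎-dec_)
open xor-∧-Solver using (solve; _:+_; _:=_)
open import Induction.WellFounded using (Acc; acc)
open import Data.Nat.Induction using (<-wellFounded)
open import Data.Nat.Solver using (module +-*-Solver)
open +-*-Solver using () renaming (solve to solveℕ; con to conℕ; _:+_ to _⊕_; _:*_ to _⊗_; _:=_ to _⊜_)

-- Closing a path by its extreme edge ab adds one edge, so the cycles with extreme edge ab
-- contribute to c_o - c_e exactly the weight of the paths with at least two edges. This is the
-- product of the lower weights, 1 if all of them are -1 and 0 otherwise; adding -1 for ab itself
-- gives p. To stay in the natural numbers, the two parities are counted separately. For N/2 ≤ s,
-- each face with p = -1 chooses a child with p = 0. The choice is injective and misses a top face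
-- with p = 0, so the induction carries a weak and a strict form of the bound. The topological input
-- is cohomology modulo 2. A function on darts whose change along a face agrees on the two sides of
-- every edge defines an edge function that sums to zero around each face; on the sphere it is the
-- difference of a vertex function. The functions fed into this are indicators of arcs of a rotation
-- or of a face. Inside and outside of a closed curve thus become Boolean values of darts, constant
-- on faces, and geometric contradictions arise from two values for one dart or one face.

module _ where

  -- Counting with duplicate-free lists

  open HasCount

  private variable
    A B C : Set
    P Q : A → Set
    k l : ℕ

  unique-⊆⇒length-≤ : ∀ {xs ys : List A} → Unique xs → (∀ {x} → x ∈ xs → x ∈ ys) → length xs ≤ length ys
  unique-⊆⇒length-≤ {xs = []} _ _ = z≤n
  unique-⊆⇒length-≤ {xs = x ∷ xs} {ys} (x∉xs ∷ uxs) xs⊆ys with ∈-∃++ (xs⊆ys (here refl))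
  ... | as , bs , refl = ≤-trans (s≤s (unique-⊆⇒length-≤ uxs keep)) (≤-reflexive (sym (length-++-sucʳ as x bs)))
    where
    keep : ∀ {z} → z ∈ xs → z ∈ as ++ bs
    keep z∈xs with ∈-++⁻ as (xs⊆ys (there z∈xs))
    ... | inj₁ z∈as = ∈-++⁺ˡ z∈as
    ... | inj₂ (here refl) = contradiction refl (All.lookup x∉xs z∈xs)
    ... | inj₂ (there z∈bs) = ∈-++⁺ʳ as z∈bs

  -- A missing `y` could be put in front of `xs`, giving a duplicate-free list inside `ys` that is
  -- too long. This is how Euler's formula yields that two spanning trees use up all edges.
  unique-⊆-full : ∀ {xs ys : List A} → DecidableEquality A → Unique xs → (∀ {x} → x ∈ xs → x ∈ ys) →
    length ys ≤ length xs → ∀ {y} → y ∈ ys → y ∈ xs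
  unique-⊆-full {xs = xs} {ys} _≟_ uxs xs⊆ys le {y} y∈ys with y ∈? xs
    where open import Data.List.Membership.DecPropositional _≟_ using (_∈?_)
  ... | yes y∈xs = y∈xs
  ... | no y∉xs = contradiction
      (≤-trans (unique-⊆⇒length-≤ (All.tabulate (λ {x∈xs refl → y∉xs x∈xs}) ∷ uxs)
        (λ { (here refl) → y∈ys ; (there x∈xs) → xs⊆ys x∈xs })) le)
      (<-irrefl refl)

  hasCount-mono : HasCount P k → HasCount Q l → (∀ {x} → P x → Q x) → k ≤ l
  hasCount-mono p q P⊆Q = subst₂ _≤_ (size p) (size q)
    (unique-⊆⇒length-≤ (unique p) (λ {x} x∈ → complete q x (P⊆Q (sound p x x∈))))

  hasCount-unique : HasCount P k → HasCount P l → k ≡ l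
  hasCount-unique p q = ≤-antisym (hasCount-mono p q id) (hasCount-mono q p id)

  hasCount-⇔ : HasCount P k → (∀ {x} → P x → Q x) → (∀ {x} → Q x → P x) → HasCount Q k
  hasCount-⇔ p f g = record
    { elems = elems p ; unique = unique p ; size = size p
    ; sound = λ x → f ∘ sound p x ; complete = λ x → complete p x ∘ g }

  hasCount-empty : (∀ {x} → ¬ P x) → HasCount P 0
  hasCount-empty ¬P = record
    { elems = [] ; unique = [] ; size = refl ; sound = λ _ () ; complete = λ _ p → contradiction p ¬P }

  hasCount-singleton : (a : A) → HasCount (_≡ a) 1
  hasCount-singleton a = record
    { elems = a ∷ [] ; unique = [] ∷ [] ; size = refl
    ; sound = λ { _ (here refl) → refl } ; complete = λ { _ refl → here refl } }

  hasCount-⊎ : HasCount P k → HasCount Q l → (∀ {x} → P x → ¬ Q x) → HasCount (λ x → P x ⊎ Q x) (k + l)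
  hasCount-⊎ p q disj = record
    { elems = elems p ++ elems q
    ; unique = Uniqueᵖ.++⁺ (unique p) (unique q) (λ (a , b) → disj (sound p _ a) (sound q _ b))
    ; size = trans (length-++ (elems p)) (cong₂ _+_ (size p) (size q))
    ; sound = λ x x∈ → [ inj₁ ∘ sound p x , inj₂ ∘ sound q x ]′ (∈-++⁻ (elems p) x∈)
    ; complete = λ x → [ ∈-++⁺ˡ ∘ complete p x , ∈-++⁺ʳ (elems p) ∘ complete q x ]′ }

  map-unique : ∀ (f : A → B) {xs} → (∀ {x y} → x ∈ xs → y ∈ xs → f x ≡ f y → x ≡ y) → Unique xs → Unique (map f xs)
  map-unique f _ [] = []
  map-unique f inj (x∉ ∷ u) = All.tabulate fresh ∷ map-unique f (λ a b → inj (there a) (there b)) u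
    where
    fresh : ∀ {y} → y ∈ map f _ → f _ ≢ y
    fresh y∈ eq with ∈-map⁻ f y∈
    ... | z , z∈ , refl = All.lookup x∉ z∈ (inj (here refl) (there z∈) eq)

  hasCount-map : (f : A → B) → HasCount P k → (∀ {x y} → P x → P y → f x ≡ f y → x ≡ y) →
    HasCount (λ y → ∃ λ x → P x × f x ≡ y) k
  hasCount-map f p inj = record
    { elems = map f (elems p)
    ; unique = map-unique f (λ a b → inj (sound p _ a) (sound p _ b)) (unique p)
    ; size = trans (length-map f (elems p)) (size p)
    ; sound = λ y y∈ → let (x , x∈ , eq) = ∈-map⁻ f y∈ in x , sound p x x∈ , sym eq
    ; complete = λ { _ (x , Px , refl) → ∈-map⁺ f (complete p x Px) } }

  length-cartesianProduct : ∀ (xs : List A) (ys : List B) → length (cartesianProduct xs ys) ≡ length xs * length ys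
  length-cartesianProduct [] ys = refl
  length-cartesianProduct (x ∷ xs) ys = trans (length-++ (map (x ,_) ys))
    (cong₂ _+_ (length-map (x ,_) ys) (length-cartesianProduct xs ys))

  hasCount-× : HasCount P k → HasCount Q l → HasCount (λ (x , y) → P x × Q y) (k * l)
  hasCount-× p q = record
    { elems = cartesianProduct (elems p) (elems q)
    ; unique = Uniqueᵖ.cartesianProduct⁺ (unique p) (unique q)
    ; size = trans (length-cartesianProduct (elems p) (elems q)) (cong₂ _*_ (size p) (size q))
    ; sound = λ (x , y) xy∈ → let (a , b) = ∈-cartesianProduct⁻ (elems p) (elems q) xy∈ in sound p x a , sound q y b
    ; complete = λ (x , y) (a , b) → ∈-cartesianProduct⁺ (complete p x a) (complete q y b) }

  hasCount-filter : HasCount P k → (∀ x → Dec (Q x)) → ∃ λ l → HasCount (λ x → P x × Q x) l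
  hasCount-filter p Q? = _ , record
    { elems = filter Q? (elems p) ; unique = Uniqueᵖ.filter⁺ Q? (unique p) ; size = refl
    ; sound = λ x x∈ → let (a , b) = ∈-filter⁻ Q? x∈ in sound p x a , b
    ; complete = λ x (a , b) → ∈-filter⁺ Q? (complete p x a) b }

  hasCount-Fin : ∀ n → HasCount {Fin n} (λ _ → ⊤) n
  hasCount-Fin n = record
    { elems = allFin n ; unique = Uniqueᵖ.allFin⁺ n ; size = length-tabulate id
    ; sound = λ _ _ → tt ; complete = λ x _ → ∈-allFin x }


  sum-b2n≡length-filter : ∀ (p : A → Bool) xs → sum (map (b2n ∘ p) xs) ≡ length (filter (λ x → p x ≟ᵇ true) xs)
  sum-b2n≡length-filter p [] = refl
  sum-b2n≡length-filter p (x ∷ xs) with p x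
  ... | true = cong suc (sum-b2n≡length-filter p xs)
  ... | false = sum-b2n≡length-filter p xs

  hasCount-countB : ∀ {n} (p : Fin n → Bool) → HasCount (λ x → p x ≡ true) (countB p)
  hasCount-countB {n} p = record
    { elems = filter (λ x → p x ≟ᵇ true) (allFin n)
    ; unique = Uniqueᵖ.filter⁺ _ (Uniqueᵖ.allFin⁺ n)
    ; size = sym (sum-b2n≡length-filter p (allFin n))
    ; sound = λ x x∈ → proj₂ (∈-filter⁻ (λ x → p x ≟ᵇ true) {xs = allFin n} x∈)
    ; complete = λ x px → ∈-filter⁺ (λ x → p x ≟ᵇ true) (∈-allFin x) px }

  hasCount-countB₂ : ∀ {n} (r : Fin n → Fin n → Bool) → HasCount (λ (u , v) → r u v ≡ true) (countB₂ r)
  hasCount-countB₂ {n} r = record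
    { elems = filter r? (cartesianProduct (allFin n) (allFin n))
    ; unique = Uniqueᵖ.filter⁺ r? (Uniqueᵖ.cartesianProduct⁺ (Uniqueᵖ.allFin⁺ n) (Uniqueᵖ.allFin⁺ n))
    ; size = sym (rows (allFin n))
    ; sound = λ x x∈ → proj₂ (∈-filter⁻ r? {xs = cartesianProduct (allFin n) (allFin n)} x∈)
    ; complete = λ (u , v) rx → ∈-filter⁺ r? (∈-cartesianProduct⁺ (∈-allFin u) (∈-allFin v)) rx }
    where
    r? : ∀ (d : Fin n × Fin n) → Dec (r (proj₁ d) (proj₂ d) ≡ true)
    r? (u , v) = r u v ≟ᵇ true
    row : ∀ u (vs : List (Fin n)) → sum (map (b2n ∘ r u) vs) ≡ length (filter r? (map (u ,_) vs))
    row u [] = refl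
    row u (v ∷ vs) with r u v
    ... | true = cong suc (row u vs)
    ... | false = row u vs
    rows : ∀ us → sum (map (λ u → countB (r u)) us) ≡ length (filter r? (cartesianProduct us (allFin n)))
    rows [] = refl
    rows (u ∷ us) = trans (cong₂ _+_ (row u (allFin n)) (rows us)) (sym (trans
      (cong length (filter-++ r? (map (u ,_) (allFin n)) (cartesianProduct us (allFin n))))
      (length-++ (filter r? (map (u ,_) (allFin n))))))

  least : ∀ {P : ℕ → Set} → (∀ i → Dec (P i)) → ∃ P → ∃ λ i → P i × ∀ j → P j → i ≤ j
  least {P} P? (k , pk) = search k pk (<-wellFounded k)
    where
    search : ∀ k → P k → Acc _<_ k → ∃ λ i → P i × ∀ j → P j → i ≤ j
    search k pk (acc smaller) with ℕᵖ.anyUpTo? P? k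
    ... | yes (j , j<k , pj) = search j pj (smaller j<k)
    ... | no none = k , pk , λ j pj → ℕᵖ.≮⇒≥ λ j<k → none (j , j<k , pj)

-- Relations as matrices and Boolean arithmetic

relExt : ∀ {n} {S S′ : Rel n} → (∀ u v → S ∋⟨ u , v ⟩ ≡ S′ ∋⟨ u , v ⟩) → S ≡ S′
relExt {S = S} {S′} eq = vecExt (λ u → vecExt (eq u))
  where
  vecExt : ∀ {A : Set} {m} {xs ys : Vec.Vec A m} → (∀ i → lookup xs i ≡ lookup ys i) → xs ≡ ys
  vecExt {xs = xs} {ys} h = trans (sym (Vecᵖ.tabulate∘lookup xs)) (trans (Vecᵖ.tabulate-cong h) (Vecᵖ.tabulate∘lookup ys))

mkRel : ∀ {n} → (Fin n → Fin n → Bool) → Rel n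
mkRel r = tabulate (λ u → tabulate (r u))

mkRel-∋ : ∀ {n} (r : Fin n → Fin n → Bool) u v → mkRel r ∋⟨ u , v ⟩ ≡ r u v
mkRel-∋ r u v = trans (cong (λ xs → lookup xs v) (Vecᵖ.lookup∘tabulate (λ u → tabulate (r u)) u)) (Vecᵖ.lookup∘tabulate (r u) v)

_≟ᴿ_ : ∀ {n} → DecidableEquality (Rel n)
_≟ᴿ_ = Vecᵖ.≡-dec (Vecᵖ.≡-dec _≟ᵇ_)

_≟ᴰ_ : ∀ {n} → DecidableEquality (Dart n)
_≟ᴰ_ = ≡-dec Finᵖ._≟_ Finᵖ._≟_

⇔true : ∀ {a b : Bool} → (a ≡ true → b ≡ true) → (b ≡ true → a ≡ true) → a ≡ b
⇔true {true} {true} _ _ = refl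
⇔true {true} {false} f _ with f refl
... | ()
⇔true {false} {true} _ g with g refl
... | ()
⇔true {false} {false} _ _ = refl

⌊⌋-true : ∀ {P : Set} (P? : Dec P) → P → ⌊ P? ⌋ ≡ true
⌊⌋-true (yes _) _ = refl
⌊⌋-true (no ¬p) p = contradiction p ¬p

⌊⌋-false : ∀ {P : Set} (P? : Dec P) → ¬ P → ⌊ P? ⌋ ≡ false
⌊⌋-false (yes p) ¬p = contradiction p ¬p
⌊⌋-false (no _) _ = refl

⌊⌋-true⁻ : ∀ {P : Set} (P? : Dec P) → ⌊ P? ⌋ ≡ true → P
⌊⌋-true⁻ (yes p) _ = p

⌊⌋-cong : ∀ {P Q : Set} (P? : Dec P) (Q? : Dec Q) → (P → Q) → (Q → P) → ⌊ P? ⌋ ≡ ⌊ Q? ⌋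
⌊⌋-cong P? Q? f g = ⇔true (⌊⌋-true Q? ∘ f ∘ ⌊⌋-true⁻ P?) (⌊⌋-true P? ∘ g ∘ ⌊⌋-true⁻ Q?)

xor-false⇒≡ : ∀ {a b} → a xor b ≡ false → a ≡ b
xor-false⇒≡ {true} {true} _ = refl
xor-false⇒≡ {false} {false} _ = refl

≡⇒xor-false : ∀ {a b} → a ≡ b → a xor b ≡ false
≡⇒xor-false {true} refl = refl
≡⇒xor-false {false} refl = refl

∧-falseˡ : ∀ {a} b → a ≡ false → a ∧ b ≡ false
∧-falseˡ b refl = refl

∧-trueˡ : ∀ {a} b → a ≡ true → a ∧ b ≡ b
∧-trueˡ b refl = refl

xor-cong : ∀ a b c d → a ≡ c → b ≡ d → a xor b ≡ c xor d
xor-cong a b c d refl refl = refl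

xor-interchange : ∀ a b c d → (a xor b) xor (c xor d) ≡ (a xor c) xor (b xor d)
xor-interchange = solve 4 (λ a b c d → (a :+ b) :+ (c :+ d) := (a :+ c) :+ (b :+ d)) refl

xor-cancelˡ : ∀ a b → a xor (a xor b) ≡ b
xor-cancelˡ = solve 2 (λ a b → a :+ (a :+ b) := b) refl

-- Orbits and potentials on them

data Reach {X : Set} (s : X → X) (x : X) : X → Set where
  start : Reach s x x
  next  : ∀ {y} → Reach s x y → Reach s x (s y)

reach-trans : ∀ {X : Set} {s : X → X} {x y z} → Reach s x y → Reach s y z → Reach s x z
reach-trans p start = p
reach-trans p (next q) = next (reach-trans p q)

orbit⇒Reach : ∀ {X : Set} {s : X → X} {y} (h : ℕ → X) → (∀ k → h (suc k) ≡ s (h k)) → (∃ λ k → h k ≡ y) → Reach s (h 0) y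
orbit⇒Reach {s = s} h hs (k , refl) = go k
  where
  go : ∀ k → Reach s (h 0) (h k)
  go zero = start
  go (suc k) = subst (Reach s (h 0)) (sym (hs k)) (next (go k))

reach-closed : ∀ {X : Set} {s : X → X} {x y} (P : X → Set) → (∀ {z} → P z → P (s z)) → P x → Reach s x y → P y
reach-closed P cl px start = px
reach-closed P cl px (next r) = cl (reach-closed P cl px r)

-- Extending an orbit segment by q ↦ s q changes the potential by the indicator of s q.
arcPotential : ∀ {X : Set} (_≟_ : DecidableEquality X) (s : X → X) (A : X → Set) → (∀ {x} → A x → A (s x)) →
  (∀ {x y} → A x → A y → s x ≡ s y → x ≡ y) → ∀ {p q} → A p → Reach s p q →
  ∃ λ (μ : X → Bool) → ∀ x → A x → μ (s x) xor μ x ≡ ⌊ x ≟ p ⌋ xor ⌊ x ≟ q ⌋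
arcPotential _≟_ s A closed inj {p} Ap start = (λ _ → false) , λ x _ → sym (≡⇒xor-false {⌊ x ≟ p ⌋} refl)
arcPotential _≟_ s A closed inj {p} Ap (next {q} r) with arcPotential _≟_ s A closed inj Ap r
... | μ , hμ = (λ x → μ x xor ⌊ x ≟ s q ⌋) , λ x Ax →
    lem (μ (s x)) (μ x) ⌊ x ≟ p ⌋ ⌊ x ≟ s q ⌋ (hμ x Ax)
      (⌊⌋-cong (s x ≟ s q) (x ≟ q) (inj Ax (reach-closed A closed Ap r)) (cong s))
  where
  open ≡-Reasoning
  lem : ∀ a b c {d e} h → a xor b ≡ c xor d → e ≡ d → (a xor e) xor (b xor h) ≡ c xor h
  lem a b c {d} h eq refl = begin
    (a xor d) xor (b xor h) ≡⟨ xor-interchange a d b h ⟩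
    (a xor b) xor (d xor h) ≡⟨ cong (_xor (d xor h)) eq ⟩
    (c xor d) xor (d xor h) ≡⟨ xor-assoc c d (d xor h) ⟩
    c xor (d xor (d xor h)) ≡⟨ cong (c xor_) (xor-cancelˡ d h) ⟩
    c xor h ∎

-- Faces of a rotation system

module RotationSystem {n : ℕ} (G : Graph n) (σ : Fin n → Fin n → Fin n) (rotation : IsRotationSystem G σ) where

  V : Set
  V = Fin n

  E : V → V → Set
  E u v = adj G u v ≡ true

  E-sym : ∀ {u v} → E u v → E v u
  E-sym {u} {v} = trans (symmetric G v u)

  E⇒≢ : ∀ {u v} → E u v → u ≢ v
  E⇒≢ {u} e refl with trans (sym e) (irrefl G u)
  ... | ()

  AdjDart : Dart n → Set
  AdjDart (u , v) = E u v

  next-dart : Dart n → Dart n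
  next-dart = faceStep σ

  rotate-adj : ∀ {u v} → E u v → E u (σ u v)
  rotate-adj = proj₁ rotation _ _

  rotate-injective : ∀ {u v w} → E u v → E u w → σ u v ≡ σ u w → v ≡ w
  rotate-injective = proj₁ (proj₂ rotation) _ _ _

  rotate-reach : ∀ {u v w} → E u v → E u w → Reach (σ u) v w
  rotate-reach {u} {v} e e′ = orbit⇒Reach _ (λ _ → refl) (proj₂ (proj₂ rotation) _ _ _ e e′)

  next-adj : ∀ {d} → AdjDart d → AdjDart (next-dart d)
  next-adj = rotate-adj ∘ E-sym

  next-injective : ∀ {d e} → AdjDart d → AdjDart e → next-dart d ≡ next-dart e → d ≡ e
  next-injective {u , v} {u′ , v′} ad ae eq with cong proj₁ eq
  ... | refl = cong (_, v) (rotate-injective (E-sym ad) (E-sym ae) (cong proj₂ eq))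

  orbit : ℕ → Dart n → Dart n
  orbit = iterD next-dart

  orbit-adj : ∀ {d} k → AdjDart d → AdjDart (orbit k d)
  orbit-adj zero ad = ad
  orbit-adj (suc k) ad = next-adj (orbit-adj k ad)

  orbit-cancel : ∀ {d} i j → AdjDart d → i < j → orbit i d ≡ orbit j d → ∃ λ k → suc k ≤ j × orbit (suc k) d ≡ d
  orbit-cancel zero (suc j) ad _ eq = j , ≤-refl , sym eq
  orbit-cancel (suc i) (suc j) ad (s≤s i<j) eq with orbit-cancel i j ad i<j (next-injective (orbit-adj i ad) (orbit-adj j ad) eq)
  ... | k , k<j , eq′ = k , ℕᵖ.m≤n⇒m≤1+n k<j , eq′

  -- Two of the first `n * n + 1` darts of the orbit coincide, and injectivity of the face step
  -- strips their common steps. The explicit bound turns membership in a face into a finite search.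
  orbit-period : ∀ {d} → AdjDart d → ∃ λ k → k < n * n × orbit (suc k) d ≡ d
  orbit-period {d} ad with pigeonhole (ℕᵖ.n<1+n (n * n)) (λ i → uncurry Fin.combine (orbit (toℕ i) d))
  ... | i , j , i<j , eq with combine-injective _ _ _ _ eq
  ... | eq₁ , eq₂ with orbit-cancel (toℕ i) (toℕ j) ad i<j (cong₂ _,_ eq₁ eq₂)
  ... | k , k<j , eq′ = k , ≤-trans k<j (s≤s⁻¹ (Finᵖ.toℕ<n j)) , eq′

  reach-orbit : ∀ {d e} → Reach next-dart d e → ∃ λ k → orbit k d ≡ e
  reach-orbit start = 0 , refl
  reach-orbit (next r) with reach-orbit r
  ... | k , refl = suc k , refl

  reach-orbit-bounded : ∀ {d e} → AdjDart d → Reach next-dart d e → ∃ λ k → k < n * n × orbit k d ≡ e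
  reach-orbit-bounded {d} ad r with orbit-period ad
  ... | p , p<nn , eqp with go r
    where
    go : ∀ {e} → Reach next-dart d e → ∃ λ k → k ≤ p × orbit k d ≡ e
    go start = 0 , z≤n , refl
    go (next r) with go r
    ... | k , k≤p , refl with k ℕᵖ.≟ p
    ... | yes refl = 0 , z≤n , sym eqp
    ... | no k≢p = suc k , ℕᵖ.≤∧≢⇒< k≤p k≢p , refl
  ... | k , k≤p , eq = k , ≤-<-trans k≤p p<nn , eq

  orbit-reach : ∀ k {d} → Reach next-dart d (orbit k d)
  orbit-reach zero = start
  orbit-reach (suc k) = next (orbit-reach k)

  -- Going once around the period undoes a step; hence lying on the same face is symmetric.
  reach-back : ∀ {d} → AdjDart d → Reach next-dart (next-dart d) d
  reach-back {d} ad with orbit-period ad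
  ... | k , _ , eq = subst (Reach next-dart (next-dart d)) eq (go k)
    where
    go : ∀ k → Reach next-dart (next-dart d) (orbit (suc k) d)
    go zero = start
    go (suc k) = next (go k)

  reach-sym : ∀ {d e} → AdjDart d → Reach next-dart d e → Reach next-dart e d
  reach-sym ad start = start
  reach-sym ad (next r) = reach-trans (reach-back (reach-closed AdjDart next-adj ad r)) (reach-sym ad r)

  abstract
    faceOf : Dart n → Rel n
    faceOf d = mkRel (λ u v → ⌊ Finᵖ.any? (λ (k : Fin (n * n)) → orbit (toℕ k) d ≟ᴰ (u , v)) ⌋)

    ∈-faceOf⁺ : ∀ {d u v} → AdjDart d → Reach next-dart d (u , v) → faceOf d ∋⟨ u , v ⟩ ≡ true
    ∈-faceOf⁺ {u = u} {v} ad r with reach-orbit-bounded ad r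
    ... | k , k<nn , eq = trans (mkRel-∋ _ u v)
      (⌊⌋-true (Finᵖ.any? _) (fromℕ< k<nn , trans (cong (λ j → orbit j _) (toℕ-fromℕ< k<nn)) eq))

    ∈-faceOf⁻ : ∀ {d u v} → faceOf d ∋⟨ u , v ⟩ ≡ true → Reach next-dart d (u , v)
    ∈-faceOf⁻ {d} {u} {v} m with ⌊⌋-true⁻ (Finᵖ.any? _) (trans (sym (mkRel-∋ _ u v)) m)
    ... | k , eq = subst (Reach next-dart d) eq (orbit-reach (toℕ k))

  faceOf-isFace : ∀ {d} → AdjDart d → IsFace G σ (faceOf d)
  faceOf-isFace {d} ad = d , ad , λ e → mk⇔ (λ m → reach-orbit (∈-faceOf⁻ m))
    (λ (k , eq) → ∈-faceOf⁺ ad (subst (Reach next-dart d) eq (orbit-reach k)))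

  faceOf-cong : ∀ {d e} → AdjDart d → Reach next-dart d e → faceOf d ≡ faceOf e
  faceOf-cong ad r = relExt λ u v → ⇔true
    (λ m → ∈-faceOf⁺ (reach-closed AdjDart next-adj ad r) (reach-trans (reach-sym ad r) (∈-faceOf⁻ m)))
    (λ m → ∈-faceOf⁺ ad (reach-trans r (∈-faceOf⁻ m)))

  isFace-faceOf : ∀ {D u v} → IsFace G σ D → D ∋⟨ u , v ⟩ ≡ true → AdjDart (u , v) × D ≡ faceOf (u , v)
  isFace-faceOf {D} {u} {v} (d , ad , iff) m = reach-closed AdjDart next-adj ad r , trans D≡ (faceOf-cong ad r)
    where
    toReach : ∀ {u v} → D ∋⟨ u , v ⟩ ≡ true → Reach next-dart d (u , v)
    toReach m = orbit⇒Reach (λ k → orbit k d) (λ _ → refl) (Equivalence.to (iff _) m)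
    r = toReach m
    D≡ : D ≡ faceOf d
    D≡ = relExt λ u v → ⇔true (∈-faceOf⁺ ad ∘ toReach) (λ m → Equivalence.from (iff _) (reach-orbit (∈-faceOf⁻ m)))

  -- Reversing a dart and then taking a face step is a rotation about its source. So the two closure
  -- properties reach all darts at a vertex, and reversal passes to the neighbours.
  dart-induction : Connected G → (P : Dart n → Set) → (∀ {d} → AdjDart d → P d → P (next-dart d)) →
    (∀ {d} → AdjDart d → P d → P (swap d)) → ∀ {d e} → AdjDart d → P d → AdjDart e → P e
  dart-induction conn P closed-next closed-rev {u , v} {u′ , v′} ad pd ae = around ae (proj₂ (go (conn u u′) ad pd))
    where
    around : ∀ {u v w} → E u w → E u v × P (u , v) → P (u , w)
    around e (e₀ , p) = proj₂ (reach-closed (λ w → E _ w × P (_ , w))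
      (λ (e , p) → rotate-adj e , closed-next (E-sym e) (closed-rev e p)) (e₀ , p) (rotate-reach e₀ e))
    go : ∀ {u v u′} → Walk (adj G) (λ _ → ⊤) u u′ → E u v → P (u , v) → ∃ λ w → E u′ w × P (u′ , w)
    go (here _) e p = _ , e , p
    go (step _ e′ w) e p = go w (E-sym e′) (closed-rev e′ (around e′ (e , p)))

-- Sums modulo 2

⨁ : ∀ {n} → (Fin n → Bool) → Bool
⨁ {zero} p = false
⨁ {suc n} p = p Fin.zero xor ⨁ (p ∘ Fin.suc)

⨁-cong : ∀ {n} {p q : Fin n → Bool} → (∀ i → p i ≡ q i) → ⨁ p ≡ ⨁ q
⨁-cong {zero} eq = refl
⨁-cong {suc n} eq = cong₂ _xor_ (eq Fin.zero) (⨁-cong (eq ∘ Fin.suc))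

⨁-xor : ∀ {n} (p q : Fin n → Bool) → ⨁ (λ i → p i xor q i) ≡ ⨁ p xor ⨁ q
⨁-xor {zero} p q = refl
⨁-xor {suc n} p q = trans (cong ((p Fin.zero xor q Fin.zero) xor_) (⨁-xor (p ∘ Fin.suc) (q ∘ Fin.suc)))
  (xor-interchange (p Fin.zero) (q Fin.zero) (⨁ (p ∘ Fin.suc)) (⨁ (q ∘ Fin.suc)))

⨁-false : ∀ {n} → ⨁ {n} (λ _ → false) ≡ false
⨁-false {zero} = refl
⨁-false {suc n} = ⨁-false {n}

⨁-indicator : ∀ {n} (i : Fin n) → ⨁ (λ j → ⌊ j Finᵖ.≟ i ⌋) ≡ true
⨁-indicator {suc n} Fin.zero = cong (true xor_) (trans (⨁-cong {n} (λ j → ⌊⌋-false (Fin.suc j Finᵖ.≟ Fin.zero) λ ())) (⨁-false {n}))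
⨁-indicator {suc n} (Fin.suc i) = cong₂ _xor_ (⌊⌋-false (Fin.zero Finᵖ.≟ Fin.suc i) λ ())
  (trans (⨁-cong (λ j → ⌊⌋-cong (Fin.suc j Finᵖ.≟ Fin.suc i) (j Finᵖ.≟ i) Finᵖ.suc-injective (cong Fin.suc))) (⨁-indicator i))

⨁-scaled-indicator : ∀ {n} (i : Fin n) c → ⨁ (λ j → ⌊ j Finᵖ.≟ i ⌋ ∧ c) ≡ c
⨁-scaled-indicator i true = trans (⨁-cong (λ j → ∧-true ⌊ j Finᵖ.≟ i ⌋)) (⨁-indicator i)
  where
  ∧-true : ∀ b → b ∧ true ≡ b
  ∧-true true = refl
  ∧-true false = refl
⨁-scaled-indicator {n} i false = trans (⨁-cong (λ j → ∧-false ⌊ j Finᵖ.≟ i ⌋)) (⨁-false {n})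
  where
  ∧-false : ∀ b → b ∧ false ≡ false
  ∧-false true = refl
  ∧-false false = refl

-- The first row and the first column cancel by symmetry, leaving a smaller symmetric matrix.
handshake : ∀ {n} (r : Fin n → Fin n → Bool) → (∀ u v → r u v ≡ r v u) → (∀ u → r u u ≡ false) → ⨁ (λ u → ⨁ (r u)) ≡ false
handshake {zero} r symm irr = refl
handshake {suc n} r symm irr = begin
  (r O O xor ⨁ row) xor ⨁ (λ u → r (Fin.suc u) O xor ⨁ (r (Fin.suc u) ∘ Fin.suc))
    ≡⟨ cong₂ _xor_ (cong (_xor ⨁ row) (irr O)) (⨁-xor (λ u → r (Fin.suc u) O) (λ u → ⨁ (r (Fin.suc u) ∘ Fin.suc))) ⟩
  ⨁ row xor (⨁ (λ u → r (Fin.suc u) O) xor ⨁ (λ u → ⨁ (r (Fin.suc u) ∘ Fin.suc)))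
    ≡⟨ cong (⨁ row xor_) (cong₂ _xor_ (⨁-cong (λ u → symm (Fin.suc u) O))
         (handshake (λ u v → r (Fin.suc u) (Fin.suc v)) (λ u v → symm (Fin.suc u) (Fin.suc v)) (λ u → irr (Fin.suc u)))) ⟩
  ⨁ row xor (⨁ row xor false) ≡⟨ xor-cancelˡ (⨁ row) false ⟩
  false ∎
  where
  open ≡-Reasoning
  O = Fin.zero
  row = r O ∘ Fin.suc

-- Walks and degrees

module _ {n : ℕ} {R : Fin n → Fin n → Bool} where

  walk-++ : ∀ {u v w} → Walk R (λ _ → ⊤) u v → Walk R (λ _ → ⊤) v w → Walk R (λ _ → ⊤) u w
  walk-++ (here _) q = q
  walk-++ (step _ e p) q = step tt e (walk-++ p q)

  walk-reverse : (∀ {u v} → R u v ≡ true → R v u ≡ true) → ∀ {u v} → Walk R (λ _ → ⊤) u v → Walk R (λ _ → ⊤) v u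
  walk-reverse symm (here _) = here tt
  walk-reverse symm (step _ e p) = walk-++ (walk-reverse symm p) (step tt (symm e) (here tt))

  walk-closed : (P : Fin n → Set) → (∀ {u v} → R u v ≡ true → P u → P v) → ∀ {u v} → Walk R (λ _ → ⊤) u v → P u → P v
  walk-closed P cl (here _) p = p
  walk-closed P cl (step _ e w) p = walk-closed P cl w (cl e p)

hasCount-pair : ∀ {A : Set} {p q : A} → p ≢ q → HasCount (λ x → x ≡ p ⊎ x ≡ q) 2
hasCount-pair p≢q = hasCount-⊎ (hasCount-singleton _) (hasCount-singleton _) λ { refl refl → p≢q refl }

hasCount-2⁻ : ∀ {A : Set} {P : A → Set} → HasCount P 2 → ∃ λ p → ∃ λ q → p ≢ q × P p × P q × (∀ {x} → P x → x ≡ p ⊎ x ≡ q)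
hasCount-2⁻ record { elems = p ∷ q ∷ [] ; unique = (p≢q ∷ []) ∷ _ ; sound = s ; complete = c } =
  p , q , p≢q , s p (here refl) , s q (there (here refl)) , λ {x} px → out (c x px)
  where
  out : ∀ {x} → x ∈ p ∷ q ∷ [] → x ≡ p ⊎ x ≡ q
  out (here eq) = inj₁ eq
  out (there (here eq)) = inj₂ eq

hasCount-degIn : ∀ {n} (S : Rel n) u → HasCount (λ v → S ∋⟨ u , v ⟩ ≡ true) (degIn S u)
hasCount-degIn S u = hasCount-countB (lookup (lookup S u))

-- Left to unification, because cycleLength tests degIn S u ≡ 2 with a local function.
degreeTest : ∀ {n} (S : Rel n) → ∃ λ (p : Fin n → Bool) → cycleLength S ≡ countB p
degreeTest S = _ , refl

hasCount-cycleLength : ∀ {n} (S : Rel n) → HasCount (λ u → degIn S u ≡ 2) (cycleLength S)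
hasCount-cycleLength {n} S = hasCount-⇔ (hasCount-countB (proj₁ (degreeTest S))) (λ {u} → two u) (λ {u} → two⁻ u)
  where
  two : ∀ u → proj₁ (degreeTest S) u ≡ true → degIn S u ≡ 2
  two u t with degIn S u
  ... | 2 = refl
  two⁻ : ∀ u → degIn S u ≡ 2 → proj₁ (degreeTest S) u ≡ true
  two⁻ u eq with degIn S u
  two⁻ u refl | .2 = refl

-- The dual tree in a linear vertex order

module Order {n : ℕ} (G : Graph n) (pos : Fin n → ℕ) where

  Edge : Fin n → Fin n → Set
  Edge u v = adj G u v ≡ true

  -- Such a `y` is a cut point of the interval: increasing paths from `a` to `b` cannot avoid it,
  -- which lets `split` factor them.
  Unjumped : Fin n → Fin n → Fin n → Set
  Unjumped a b y = ∀ {c d} → Edge c d → pos a ≤ pos c → pos c < pos y → pos y < pos d → pos d ≤ pos b → ⊥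

  -- The situation of a vertex on the face below `ab`: only the path consisting of `ab` avoids it.
  UnjumpedBut : Fin n → Fin n → Fin n → Set
  UnjumpedBut a b y = ∀ {c d} → Edge c d → pos a ≤ pos c → pos c < pos y → pos y < pos d → pos d ≤ pos b → c ≡ a × d ≡ b

  -- A Tree a b is the part of G on the interval [a, b] below the edge ab. Unless a and b are consecutive,
  -- ab lies on a face whose other edges, in order from a to b, carry the subtrees: a Chain a y k of k of
  -- them, and the last one from y to b. As k is odd, the face has the odd length k + 2.
  data Tree : Fin n → Fin n → Set
  data Chain : Fin n → Fin n → ℕ → Set

  data Tree where
    leaf : ∀ {a b} → Edge a b → pos b ≡ suc (pos a) → Tree a b
    node : ∀ {a y b k} → Edge a b → pos a < pos y → pos y < pos b → UnjumpedBut a b y →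
      Chain a y k → Tree y b → Odd k → Tree a b

  data Chain where
    one  : ∀ {a y} → Tree a y → Chain a y 1
    snoc : ∀ {a y x k} → pos a < pos y → pos y < pos x → Unjumped a x y → Chain a y k → Tree y x → Chain a x (suc k)

-- From increasing paths to cycles

module Paths {n : ℕ} (G : Graph n) (pos : Fin n → ℕ) (pos-injective : ∀ {u v} → pos u ≡ pos v → u ≡ v) where

  open Order G pos

  edge-sym : ∀ {u v} → Edge u v → Edge v u
  edge-sym {u} {v} = trans (symmetric G v u)

  -- l lists the vertices after a of an increasing path from a to b.
  data Path (b : Fin n) : Fin n → List (Fin n) → Set where
    stop : Path b b []
    go   : ∀ {a k l} → Edge a k → pos a < pos k → Path b k l → Path b a (k ∷ l)

  path-end-≥ : ∀ {a b l x} → Path b a l → x ∈ a ∷ l → pos x ≤ pos b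
  path-end-≥ stop (here refl) = ≤-refl
  path-end-≥ (go _ a<k p) (here refl) = ≤-trans (<⇒≤ a<k) (path-end-≥ p (here refl))
  path-end-≥ (go _ _ p) (there x∈) = path-end-≥ p x∈

  path-start-≤ : ∀ {a b l x} → Path b a l → x ∈ a ∷ l → pos a ≤ pos x
  path-start-≤ p (here refl) = ≤-refl
  path-start-≤ (go _ a<k p) (there x∈) = ≤-trans (<⇒≤ a<k) (path-start-≤ p x∈)

  path-start-< : ∀ {a b l x} → Path b a l → x ∈ l → pos a < pos x
  path-start-< (go _ a<k p) x∈ = <-≤-trans a<k (path-start-≤ p x∈)

  path-end-∈ : ∀ {a b l} → Path b a l → b ∈ a ∷ l
  path-end-∈ stop = here refl
  path-end-∈ (go _ _ p) = there (path-end-∈ p)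

  path-unique : ∀ {a b l} → Path b a l → Unique (a ∷ l)
  path-unique stop = [] ∷ []
  path-unique p@(go _ _ q) = All.tabulate (λ { x∈ refl → <-irrefl refl (path-start-< p x∈) }) ∷ path-unique q

  path-end-unique : ∀ {a b b′ l} → Path b a l → Path b′ a l → b ≡ b′
  path-end-unique stop stop = refl
  path-end-unique (go _ _ p) (go _ _ q) = path-end-unique p q

  -- Both paths start at the lowest of their common vertices; removing it leaves the same situation
  -- for the tails.
  path-ext : ∀ {a a′ b b′ l l′} → Path b a l → Path b′ a′ l′ → (∀ {x} → x ∈ a ∷ l → x ∈ a′ ∷ l′) → (∀ {x} → x ∈ a′ ∷ l′ → x ∈ a ∷ l) →
    a ∷ l ≡ a′ ∷ l′
  path-ext {a} {a′} {l = l} {l′} p p′ f g with pos-injective (≤-antisym (path-start-≤ p (g (here refl))) (path-start-≤ p′ (f (here refl))))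
  ... | refl = cong (a ∷_) (tails p p′ (tail p f) (tail p′ g))
    where
    tail : ∀ {b l l′} → Path b a l → (∀ {x} → x ∈ a ∷ l → x ∈ a ∷ l′) → ∀ {x} → x ∈ l → x ∈ l′
    tail p f x∈ with f (there x∈)
    ... | here refl = contradiction (path-start-< p x∈) (<-irrefl refl)
    ... | there x∈′ = x∈′
    tails : ∀ {b b′ l l′} → Path b a l → Path b′ a l′ → (∀ {x} → x ∈ l → x ∈ l′) → (∀ {x} → x ∈ l′ → x ∈ l) → l ≡ l′
    tails stop stop f g = refl
    tails stop (go _ _ _) f g with g (here refl)
    ... | ()
    tails (go _ _ _) stop f g with f (here refl)
    ... | ()
    tails (go _ _ p) (go _ _ p′) f g = path-ext p p′ f g

  Apart : List (Fin n) → Fin n → Fin n → Set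
  Apart vs u w = All (λ x → pos x ≤ pos u ⊎ pos w ≤ pos x) vs

  Around : List (Fin n) → Fin n → Fin n → Set
  Around vs u w = All (λ x → pos u ≤ pos x × pos x ≤ pos w) vs

  -- In a cycle visiting vs in increasing order, u < w are joined iff they are consecutive or the two extremes.
  Linked : List (Fin n) → Fin n → Fin n → Set
  Linked vs u w = pos u < pos w × (Apart vs u w ⊎ Around vs u w)

  Joined : List (Fin n) → Fin n → Fin n → Set
  Joined vs u w = u ∈ vs × w ∈ vs × (Linked vs u w ⊎ Linked vs w u)

  joined? : ∀ vs u w → Dec (Joined vs u w)
  joined? vs u w = (u ∈? vs) ×-dec (w ∈? vs) ×-dec (linked? u w ⊎-dec linked? w u)
    where
    open import Data.List.Membership.DecPropositional (Finᵖ._≟_ {n}) using (_∈?_)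
    linked? : ∀ u w → Dec (Linked vs u w)
    linked? u w = (pos u <? pos w) ×-dec
      (All.all? (λ x → (pos x ≤? pos u) ⊎-dec (pos w ≤? pos x)) vs ⊎-dec
       All.all? (λ x → (pos u ≤? pos x) ×-dec (pos x ≤? pos w)) vs)

  abstract
    cycleOn : List (Fin n) → Rel n
    cycleOn vs = mkRel (λ u w → ⌊ joined? vs u w ⌋)

    ∈-cycleOn⁺ : ∀ {vs u w} → Joined vs u w → cycleOn vs ∋⟨ u , w ⟩ ≡ true
    ∈-cycleOn⁺ {vs} {u} {w} j = trans (mkRel-∋ _ u w) (⌊⌋-true (joined? vs u w) j)

    ∈-cycleOn⁻ : ∀ {vs u w} → cycleOn vs ∋⟨ u , w ⟩ ≡ true → Joined vs u w
    ∈-cycleOn⁻ {vs} {u} {w} t = ⌊⌋-true⁻ (joined? vs u w) (trans (sym (mkRel-∋ _ u w)) t)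

  -- The path has `length l` edges and the cycle one more; requiring two edges keeps the closing
  -- edge from being the path itself.
  CyclePath : Fin n → Fin n → List (Fin n) → Set
  CyclePath a b l = Edge a b × Path b a l × 2 ≤ length l

  Successor Predecessor : List (Fin n) → Fin n → Fin n → Set
  Successor vs u v = v ∈ vs × pos u < pos v × Edge u v × Apart vs u v
  Predecessor vs u v = v ∈ vs × pos v < pos u × Edge u v × Apart vs v u

  successor : ∀ {a b l u} → Path b a l → u ∈ a ∷ l → u ≡ b ⊎ ∃ λ v → Successor (a ∷ l) u v
  successor stop (here refl) = inj₁ refl
  successor (go {k = k} e a<k p) (here refl) = inj₂ (k , there (here refl) , a<k , e ,
    inj₁ ≤-refl ∷ All.tabulate (inj₂ ∘ path-start-≤ p))
  successor (go e a<k p) (there u∈) with successor p u∈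
  ... | inj₁ eq = inj₁ eq
  ... | inj₂ (v , v∈ , u<v , e′ , apart) = inj₂ (v , there v∈ , u<v , e′ ,
    inj₁ (≤-trans (<⇒≤ a<k) (path-start-≤ p u∈)) ∷ apart)

  predecessor : ∀ {a b l u} → Path b a l → u ∈ a ∷ l → u ≡ a ⊎ ∃ λ v → Predecessor (a ∷ l) u v
  predecessor p (here refl) = inj₁ refl
  predecessor (go {a} e a<k p) (there u∈) with predecessor p u∈
  ... | inj₁ refl = inj₂ (a , here refl , a<k , edge-sym e , inj₁ ≤-refl ∷ All.tabulate (inj₂ ∘ path-start-≤ p))
  ... | inj₂ (v , v∈ , v<u , e′ , apart) = inj₂ (v , there v∈ , v<u , e′ ,
    inj₁ (≤-trans (<⇒≤ a<k) (path-start-≤ p v∈)) ∷ apart)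

  apart-unique-above : ∀ {vs u v w} → v ∈ vs → w ∈ vs → pos u < pos v → pos u < pos w → Apart vs u v → Apart vs u w → v ≡ w
  apart-unique-above v∈ w∈ u<v u<w av aw = pos-injective (≤-antisym
    ([ (λ le → contradiction u<w (ℕᵖ.≤⇒≯ le)) , id ]′ (All.lookup av w∈))
    ([ (λ le → contradiction u<v (ℕᵖ.≤⇒≯ le)) , id ]′ (All.lookup aw v∈)))

  apart-unique-below : ∀ {vs u v w} → v ∈ vs → w ∈ vs → pos v < pos u → pos w < pos u → Apart vs v u → Apart vs w u → v ≡ w
  apart-unique-below v∈ w∈ v<u w<u av aw = pos-injective (≤-antisym
    ([ id , (λ le → contradiction v<u (ℕᵖ.≤⇒≯ le)) ]′ (All.lookup aw v∈))
    ([ id , (λ le → contradiction w<u (ℕᵖ.≤⇒≯ le)) ]′ (All.lookup av w∈)))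

  module Cycle {a b : Fin n} {l : List (Fin n)} (path : CyclePath a b l) where

    private
      vs = a ∷ l
      a~b = proj₁ path
      p = proj₁ (proj₂ path)

    middle : ∃ λ m → m ∈ vs × pos a < pos m × pos m < pos b
    middle = find p (proj₂ (proj₂ path))
      where
      find : ∀ {a l} → Path b a l → 2 ≤ length l → ∃ λ m → m ∈ a ∷ l × pos a < pos m × pos m < pos b
      find (go {k = k} _ a<k p@(go _ k<j q)) _ = k , there (here refl) , a<k , <-≤-trans k<j (path-end-≥ q (here refl))
      find (go _ _ stop) (s≤s ())

    a<b : pos a < pos b
    a<b = let (_ , _ , a<m , m<b) = middle in <-trans a<m m<b

    around : Around vs a b
    around = All.tabulate (λ x∈ → path-start-≤ p x∈ , path-end-≥ p x∈)

    b∈ : b ∈ vs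
    b∈ = path-end-∈ p

    around⇒ends : ∀ {u w} → u ∈ vs → w ∈ vs → Around vs u w → u ≡ a × w ≡ b
    around⇒ends u∈ w∈ ar = pos-injective (≤-antisym (proj₁ (All.lookup ar (here refl))) (path-start-≤ p u∈)) ,
      pos-injective (≤-antisym (path-end-≥ p w∈) (proj₂ (All.lookup ar b∈)))

    -- Here the length bound enters: some vertex of the path lies strictly between the extremes, so
    -- the closing edge is never also a step of the path.
    not-apart : ¬ Apart vs a b
    not-apart ap = let (m , m∈ , a<m , m<b) = middle in [ ℕᵖ.<⇒≱ a<m , ℕᵖ.<⇒≱ m<b ]′ (All.lookup ap m∈)

    record Neighbours (u : Fin n) : Set where
      field
        {p₁ p₂} : Fin n
        distinct : p₁ ≢ p₂
        edge₁ : Edge u p₁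
        edge₂ : Edge u p₂
        joined₁ : Joined vs u p₁
        joined₂ : Joined vs u p₂
        only : ∀ {w} → Joined vs u w → w ≡ p₁ ⊎ w ≡ p₂

    -- An inner vertex is joined to its predecessor and successor; at an extreme vertex the closing
    -- edge replaces the missing one. All degrees in the cycle are read off from this.
    neighbours : ∀ {u} → u ∈ vs → Neighbours u
    neighbours {u} u∈ with successor p u∈ | predecessor p u∈
    ... | inj₁ refl | inj₁ refl = contradiction a<b (<-irrefl refl)
    ... | inj₁ refl | inj₂ (v , v∈ , v<u , e , apart) = record
      { distinct = λ { refl → not-apart apart }
      ; edge₁ = e ; edge₂ = edge-sym a~b
      ; joined₁ = u∈ , v∈ , inj₂ (v<u , inj₁ apart)
      ; joined₂ = u∈ , here refl , inj₂ (a<b , inj₂ around)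
      ; only = λ
        { (_ , w∈ , inj₁ (b<w , _)) → contradiction b<w (ℕᵖ.≤⇒≯ (path-end-≥ p w∈))
        ; (_ , w∈ , inj₂ (w<b , inj₁ ap)) → inj₁ (apart-unique-below w∈ v∈ w<b v<u ap apart)
        ; (_ , w∈ , inj₂ (_ , inj₂ ar)) → inj₂ (proj₁ (around⇒ends w∈ u∈ ar)) } }
    ... | inj₂ (v , v∈ , u<v , e , apart) | inj₁ refl = record
      { distinct = λ { refl → not-apart apart }
      ; edge₁ = e ; edge₂ = a~b
      ; joined₁ = u∈ , v∈ , inj₁ (u<v , inj₁ apart)
      ; joined₂ = u∈ , b∈ , inj₁ (a<b , inj₂ around)
      ; only = λ
        { (_ , w∈ , inj₂ (w<a , _)) → contradiction w<a (ℕᵖ.≤⇒≯ (path-start-≤ p w∈))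
        ; (_ , w∈ , inj₁ (a<w , inj₁ ap)) → inj₁ (apart-unique-above w∈ v∈ a<w u<v ap apart)
        ; (_ , w∈ , inj₁ (_ , inj₂ ar)) → inj₂ (proj₂ (around⇒ends u∈ w∈ ar)) } }
    ... | inj₂ (v , v∈ , u<v , e , apart) | inj₂ (v′ , v′∈ , v′<u , e′ , apart′) = record
      { distinct = λ { refl → ℕᵖ.<-asym u<v v′<u }
      ; edge₁ = e ; edge₂ = e′
      ; joined₁ = u∈ , v∈ , inj₁ (u<v , inj₁ apart)
      ; joined₂ = u∈ , v′∈ , inj₂ (v′<u , inj₁ apart′)
      ; only = λ
        { (_ , w∈ , inj₁ (u<w , inj₁ ap)) → inj₁ (apart-unique-above w∈ v∈ u<w u<v ap apart)
        ; (_ , w∈ , inj₂ (w<u , inj₁ ap)) → inj₂ (apart-unique-below w∈ v′∈ w<u v′<u ap apart′)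
        ; (_ , w∈ , inj₁ (_ , inj₂ ar)) → contradiction (path-start-≤ p v′∈)
            (ℕᵖ.<⇒≱ (subst (λ x → pos v′ < pos x) (proj₁ (around⇒ends u∈ w∈ ar)) v′<u))
        ; (_ , w∈ , inj₂ (_ , inj₂ ar)) → contradiction (path-end-≥ p v∈)
            (ℕᵖ.<⇒≱ (subst (λ x → pos x < pos v) (proj₂ (around⇒ends w∈ u∈ ar)) u<v)) } }

    S : Rel n
    S = cycleOn vs

    joined-sym : ∀ {u w} → Joined vs u w → Joined vs w u
    joined-sym (u∈ , w∈ , inj₁ x) = w∈ , u∈ , inj₂ x
    joined-sym (u∈ , w∈ , inj₂ x) = w∈ , u∈ , inj₁ x

    S-sym : ∀ {u w} → S ∋⟨ u , w ⟩ ≡ true → S ∋⟨ w , u ⟩ ≡ true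
    S-sym = ∈-cycleOn⁺ ∘ joined-sym ∘ ∈-cycleOn⁻

    degree-2 : ∀ {u} → u ∈ vs → degIn S u ≡ 2
    degree-2 {u} u∈ = hasCount-unique (hasCount-degIn S u) (hasCount-⇔ (hasCount-pair distinct)
        (λ { (inj₁ refl) → ∈-cycleOn⁺ joined₁ ; (inj₂ refl) → ∈-cycleOn⁺ joined₂ }) (only ∘ ∈-cycleOn⁻))
      where open Neighbours (neighbours u∈)

    degree-0 : ∀ {u} → u ∉ vs → degIn S u ≡ 0
    degree-0 {u} u∉ = hasCount-unique (hasCount-degIn S u) (hasCount-empty λ t → u∉ (proj₁ (∈-cycleOn⁻ t)))

    open import Data.List.Membership.DecPropositional (Finᵖ._≟_ {n}) using (_∈?_)

    degree-2⇒∈ : ∀ {u} → degIn S u ≡ 2 → u ∈ vs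
    degree-2⇒∈ {u} d with u ∈? vs
    ... | yes u∈ = u∈
    ... | no u∉ = contradiction (trans (sym d) (degree-0 u∉)) λ ()

    walk-down : ∀ {u} → u ∈ vs → Acc _<_ (pos u) → Walk (S ∋⟨_,_⟩) (λ _ → ⊤) u a
    walk-down u∈ (acc smaller) with predecessor p u∈
    ... | inj₁ refl = here tt
    ... | inj₂ (v , v∈ , v<u , _ , apart) = step tt (∈-cycleOn⁺ (u∈ , v∈ , inj₂ (v<u , inj₁ apart))) (walk-down v∈ (smaller v<u))

    isCycle : IsCycle G S
    isCycle = (λ u w → edge ∘ ∈-cycleOn⁻) , (λ u w → ⇔true S-sym S-sym) ,
      (a , b , ∈-cycleOn⁺ (here refl , b∈ , inj₁ (a<b , inj₂ around))) , degree ,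
      (λ u v du dv → walk-++ (walk-down (degree-2⇒∈ du) (<-wellFounded _))
        (walk-reverse S-sym (walk-down (degree-2⇒∈ dv) (<-wellFounded _))))
      where
      edge : ∀ {u w} → Joined vs u w → Edge u w
      edge {u} j = [ (λ eq → subst (Edge u) (sym eq) edge₁) , (λ eq → subst (Edge u) (sym eq) edge₂) ]′ (only j)
        where open Neighbours (neighbours (proj₁ j))
      degree : ∀ u → degIn S u ≡ 0 ⊎ degIn S u ≡ 2
      degree u with u ∈? vs
      ... | yes u∈ = inj₂ (degree-2 u∈)
      ... | no u∉ = inj₁ (degree-0 u∉)

    cycleLength-vs : cycleLength S ≡ suc (length l)
    cycleLength-vs = hasCount-unique (hasCount-cycleLength S) record
      { elems = vs ; unique = path-unique p ; size = refl
      ; sound = λ _ → degree-2 ; complete = λ _ → degree-2⇒∈ }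

  -- The vertices of degree two recover the vertex set, and an increasing path is determined by its
  -- vertex set.
  cycleOn-injective : ∀ {a b l a′ b′ l′} → CyclePath a b l → CyclePath a′ b′ l′ → cycleOn (a ∷ l) ≡ cycleOn (a′ ∷ l′) →
    a ∷ l ≡ a′ ∷ l′
  cycleOn-injective c c′ eq = path-ext (proj₁ (proj₂ c)) (proj₁ (proj₂ c′))
    (λ x∈ → Cycle.degree-2⇒∈ c′ (subst (λ S → degIn S _ ≡ 2) eq (Cycle.degree-2 c x∈)))
    (λ x∈ → Cycle.degree-2⇒∈ c (subst (λ S → degIn S _ ≡ 2) (sym eq) (Cycle.degree-2 c′ x∈)))

  -- From cycles to increasing paths

  module CycleOrder (noncrossing : ∀ {c d y b} → Edge c d → Edge y b → pos c < pos y → pos y < pos d → pos d < pos b → ⊥)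
    {top : ℕ} (bounded : ∀ v → pos v ≤ top) {S : Rel n} (cycle : IsCycle G S) where

    private
      InS : Fin n → Fin n → Set
      InS u v = S ∋⟨ u , v ⟩ ≡ true

      InS-edge : ∀ {u v} → InS u v → Edge u v
      InS-edge = proj₁ cycle _ _

      InS-sym : ∀ {u v} → InS u v → InS v u
      InS-sym {u} {v} s = trans (sym (proj₁ (proj₂ cycle) u v)) s

      InS⇒≢ : ∀ {u v} → InS u v → u ≢ v
      InS⇒≢ s refl = contradiction (trans (sym (InS-edge s)) (irrefl G _)) λ ()

    On : Fin n → Set
    On u = degIn S u ≡ 2

    InS⇒On : ∀ {u v} → InS u v → On u
    InS⇒On {u} s with proj₁ (proj₂ (proj₂ (proj₂ cycle))) u
    ... | inj₂ d = d
    ... | inj₁ d = contradiction (HasCount.complete none _ s) (empty (HasCount.size none))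
      where
      none = subst (HasCount _) d (hasCount-degIn S u)
      empty : ∀ {A : Set} {x : A} {xs} → length xs ≡ 0 → x ∉ xs
      empty {xs = []} _ ()

    two-neighbours : ∀ {u} → On u → ∃ λ p → ∃ λ q → p ≢ q × InS u p × InS u q × (∀ {w} → InS u w → w ≡ p ⊎ w ≡ q)
    two-neighbours {u} d = hasCount-2⁻ (subst (HasCount _) d (hasCount-degIn S u))

    other-neighbour : ∀ {u v} → InS u v → ∃ λ v′ → v′ ≢ v × InS u v′ × (∀ {w} → InS u w → w ≡ v ⊎ w ≡ v′)
    other-neighbour {u} {v} s with two-neighbours (InS⇒On s)
    ... | p , q , p≢q , sp , sq , only with only s
    ... | inj₁ refl = q , ≢-sym p≢q , sq , only
    ... | inj₂ refl = p , p≢q , sp , [ inj₂ , inj₁ ]′ ∘ only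

    spread : (P : Fin n → Set) → (∀ {u v} → InS u v → P u → P v) → ∀ {u} → On u → P u → ∀ {v} → On v → P v
    spread P closed du pu dv = walk-closed P closed (proj₂ (proj₂ (proj₂ (proj₂ cycle))) _ _ du dv) pu

    -- The edges of S meeting the open interval (u, v) have even degree at every inner vertex, so by the
    -- handshake lemma S enters the interval at both ends or at neither.
    module Separation {u v : Fin n} (s : InS u v) (u<v : pos u < pos v) where

      private
        u′ = proj₁ (other-neighbour s)
        v′ = proj₁ (other-neighbour (InS-sym s))
        s-u′ : InS u u′
        s-u′ = proj₁ (proj₂ (proj₂ (other-neighbour s)))
        s-v′ : InS v v′
        s-v′ = proj₁ (proj₂ (proj₂ (other-neighbour (InS-sym s))))
        only-u : ∀ {w} → InS u w → w ≡ v ⊎ w ≡ u′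
        only-u = proj₂ (proj₂ (proj₂ (other-neighbour s)))
        only-v : ∀ {w} → InS v w → w ≡ u ⊎ w ≡ v′
        only-v = proj₂ (proj₂ (proj₂ (other-neighbour (InS-sym s))))

      Inner : Fin n → Set
      Inner x = pos u < pos x × pos x < pos v

      inner? : ∀ x → Dec (Inner x)
      inner? x = (pos u <? pos x) ×-dec (pos x <? pos v)

      ¬inner-u : ¬ Inner u
      ¬inner-u (lt , _) = <-irrefl refl lt

      ¬inner-v : ¬ Inner v
      ¬inner-v (_ , lt) = <-irrefl refl lt

      -- An edge from an inner vertex to a point beyond `u` or `v` would cross `uv`.
      leave : ∀ {x y} → InS x y → Inner x → Inner y ⊎ (y ≡ u ⊎ y ≡ v)
      leave {x} {y} sxy (u<x , x<v) with <-cmp (pos u) (pos y) | <-cmp (pos y) (pos v)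
      ... | tri≈ _ eq _ | _ = inj₂ (inj₁ (sym (pos-injective eq)))
      ... | _ | tri≈ _ eq _ = inj₂ (inj₂ (pos-injective eq))
      ... | tri> _ _ y<u | _ = ⊥-elim (noncrossing (InS-edge (InS-sym sxy)) (InS-edge s) y<u u<x x<v)
      ... | tri< _ _ _ | tri> _ _ v<y = ⊥-elim (noncrossing (InS-edge s) (InS-edge sxy) u<x x<v v<y)
      ... | tri< u<y _ _ | tri< y<v _ _ = inj₁ (u<y , y<v)

      private
        I : Fin n → Bool
        I x = ⌊ inner? x ⌋

        I-u : I u ≡ false
        I-u = ⌊⌋-false (inner? u) ¬inner-u

        I-v : I v ≡ false
        I-v = ⌊⌋-false (inner? v) ¬inner-v

        r : Fin n → Fin n → Bool
        r x y = S ∋⟨ x , y ⟩ ∧ (I x ∨ I y)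

        r-end : ∀ {x z w} → I x ≡ false → I z ≡ false → InS x w → (∀ {y} → InS x y → y ≡ z ⊎ y ≡ w) → ⨁ (r x) ≡ I w
        r-end {x} {z} {w} Ix Iz sw only = trans (⨁-cong cell) (⨁-scaled-indicator w (I w))
          where
          cell : ∀ y → r x y ≡ ⌊ y Finᵖ.≟ w ⌋ ∧ I w
          cell y with S ∋⟨ x , y ⟩ in eq | y Finᵖ.≟ w
          ... | true | yes refl = cong (_∨ I y) Ix
          ... | false | yes refl = contradiction (trans (sym sw) eq) λ ()
          ... | false | no _ = refl
          ... | true | no y≢w with only eq
          ... | inj₁ refl = cong₂ _∨_ Ix Iz
          ... | inj₂ y≡w = contradiction y≡w y≢w

        r-inner : ∀ {x} → Inner x → ⨁ (r x) ≡ false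
        r-inner {x} inner = row (degree (proj₁ (proj₂ (proj₂ (proj₂ cycle))) x))
          where
          Ix : I x ≡ true
          Ix = ⌊⌋-true (inner? x) inner
          cell₀ : ∀ y → r x y ≡ S ∋⟨ x , y ⟩
          cell₀ y = trans (cong (λ i → S ∋⟨ x , y ⟩ ∧ (i ∨ I y)) Ix) (∧-trueʳ (S ∋⟨ x , y ⟩))
            where
            ∧-trueʳ : ∀ b → b ∧ true ≡ b
            ∧-trueʳ true = refl
            ∧-trueʳ false = refl
          degree : degIn S x ≡ 0 ⊎ degIn S x ≡ 2 → (∀ y → ¬ InS x y) ⊎ On x
          degree (inj₂ d) = inj₂ d
          degree (inj₁ d) = inj₁ λ y sy → contradiction (trans (sym d) (InS⇒On sy)) λ ()
          row : (∀ y → ¬ InS x y) ⊎ On x → ⨁ (r x) ≡ false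
          row (inj₁ none) = trans (⨁-cong (λ y → trans (cell₀ y) (¬-not (none y)))) (⨁-false {n})
          row (inj₂ d) with two-neighbours d
          ... | p , q , p≢q , sp , sq , only = begin
              ⨁ (r x) ≡⟨ ⨁-cong (λ y → trans (cell₀ y) (cell y)) ⟩
              ⨁ (λ y → ⌊ y Finᵖ.≟ p ⌋ xor ⌊ y Finᵖ.≟ q ⌋) ≡⟨ ⨁-xor (λ y → ⌊ y Finᵖ.≟ p ⌋) (λ y → ⌊ y Finᵖ.≟ q ⌋) ⟩
              ⨁ (λ y → ⌊ y Finᵖ.≟ p ⌋) xor ⨁ (λ y → ⌊ y Finᵖ.≟ q ⌋) ≡⟨ cong₂ _xor_ (⨁-indicator p) (⨁-indicator q) ⟩
              false ∎
            where
            open ≡-Reasoning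
            cell : ∀ y → S ∋⟨ x , y ⟩ ≡ ⌊ y Finᵖ.≟ p ⌋ xor ⌊ y Finᵖ.≟ q ⌋
            cell y with y Finᵖ.≟ p | y Finᵖ.≟ q
            ... | yes refl | yes refl = contradiction refl p≢q
            ... | yes refl | no _ = sp
            ... | no _ | yes refl = sq
            ... | no y≢p | no y≢q = ¬-not λ sy → [ y≢p , y≢q ]′ (only sy)

        r-outer : ∀ {x} → x ≢ u → x ≢ v → ¬ Inner x → ⨁ (r x) ≡ false
        r-outer {x} x≢u x≢v out = trans (⨁-cong cell) (⨁-false {n})
          where
          cell : ∀ y → r x y ≡ false
          cell y with S ∋⟨ x , y ⟩ in eq | inner? x | inner? y
          ... | false | _ | _ = refl
          ... | true | yes inner | _ = contradiction inner out
          ... | true | no _ | no _ = refl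
          ... | true | no _ | yes inner with leave (InS-sym eq) inner
          ... | inj₁ i = contradiction i out
          ... | inj₂ (inj₁ x≡u) = contradiction x≡u x≢u
          ... | inj₂ (inj₂ x≡v) = contradiction x≡v x≢v

        rows : ∀ x → ⨁ (r x) ≡ (⌊ x Finᵖ.≟ u ⌋ ∧ I u′) xor (⌊ x Finᵖ.≟ v ⌋ ∧ I v′)
        rows x with x Finᵖ.≟ u | x Finᵖ.≟ v
        ... | yes refl | yes refl = contradiction u<v (<-irrefl refl)
        ... | yes refl | no _ = trans (r-end I-u I-v s-u′ only-u) (sym (xor-identityʳ (I u′)))
        ... | no _ | yes refl = r-end I-v I-u s-v′ only-v
        ... | no x≢u | no x≢v = elsewhere (inner? x)
          where
          elsewhere : Dec (Inner x) → ⨁ (r x) ≡ false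
          elsewhere (yes inner) = r-inner inner
          elsewhere (no out) = r-outer x≢u x≢v out

        ends-agree : I u′ ≡ I v′
        ends-agree = xor-false⇒≡ (begin
            I u′ xor I v′ ≡⟨ cong₂ _xor_ (⨁-scaled-indicator u (I u′)) (⨁-scaled-indicator v (I v′)) ⟨
            ⨁ at-u xor ⨁ at-v ≡⟨ ⨁-xor at-u at-v ⟨
            ⨁ (λ x → at-u x xor at-v x) ≡⟨ ⨁-cong rows ⟨
            ⨁ (λ x → ⨁ (r x)) ≡⟨ handshake r r-sym r-irrefl ⟩
            false ∎)
          where
          open ≡-Reasoning
          at-u at-v : Fin n → Bool
          at-u x = ⌊ x Finᵖ.≟ u ⌋ ∧ I u′
          at-v x = ⌊ x Finᵖ.≟ v ⌋ ∧ I v′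
          r-sym : ∀ x y → r x y ≡ r y x
          r-sym x y = cong₂ _∧_ (proj₁ (proj₂ cycle) x y) (∨-comm (I x) (I y))
          r-irrefl : ∀ x → r x x ≡ false
          r-irrefl x = ∧-falseˡ (I x ∨ I x) (¬-not λ sx → InS⇒≢ sx refl)

      abstract
        -- By `ends-agree`, either both ends continue inside, and the closed interval is never left,
        -- or neither does, and the open interval is never entered. Connectedness spreads this over
        -- the cycle.
        separation : (∀ {x} → On x → pos x ≤ pos u ⊎ pos v ≤ pos x) ⊎ (∀ {x} → On x → pos u ≤ pos x × pos x ≤ pos v)
        separation with inner? u′ | inner? v′ | ends-agree
        ... | yes iu | yes iv | _ = inj₂ (spread Closed stay (InS⇒On s) (≤-refl , <⇒≤ u<v))
          where
          Closed : Fin n → Set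
          Closed x = pos u ≤ pos x × pos x ≤ pos v
          inner⇒closed : ∀ {x} → Inner x → Closed x
          inner⇒closed (a , b) = <⇒≤ a , <⇒≤ b
          stay : ∀ {x y} → InS x y → Closed x → Closed y
          stay {x} sxy (u≤x , x≤v) with ℕᵖ.m≤n⇒m<n∨m≡n u≤x | ℕᵖ.m≤n⇒m<n∨m≡n x≤v
          ... | inj₂ eq | _ with pos-injective eq
          ... | refl = [ (λ { refl → <⇒≤ u<v , ≤-refl }) , (λ { refl → inner⇒closed iu }) ]′ (only-u sxy)
          stay {x} sxy (u≤x , x≤v) | inj₁ _ | inj₂ eq with pos-injective eq
          ... | refl = [ (λ { refl → ≤-refl , <⇒≤ u<v }) , (λ { refl → inner⇒closed iv }) ]′ (only-v sxy)
          stay {x} sxy (u≤x , x≤v) | inj₁ u<x | inj₁ x<v =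
            [ inner⇒closed , [ (λ { refl → ≤-refl , <⇒≤ u<v }) , (λ { refl → <⇒≤ u<v , ≤-refl }) ]′ ]′ (leave sxy (u<x , x<v))
        ... | no ¬iu | no ¬iv | _ = inj₁ λ {x} dx → apart (spread (¬_ ∘ Inner) avoid (InS⇒On s) ¬inner-u dx)
          where
          apart : ∀ {x} → ¬ Inner x → pos x ≤ pos u ⊎ pos v ≤ pos x
          apart {x} out with pos x ≤? pos u
          ... | yes le = inj₁ le
          ... | no nle = inj₂ (ℕᵖ.≮⇒≥ λ lt → out (ℕᵖ.≰⇒> nle , lt))
          avoid : ∀ {x y} → InS x y → ¬ Inner x → ¬ Inner y
          avoid sxy out iy with leave (InS-sym sxy) iy
          ... | inj₁ ix = out ix
          ... | inj₂ (inj₁ refl) = [ (λ { refl → ¬inner-v iy }) , (λ { refl → ¬iu iy }) ]′ (only-u sxy)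
          ... | inj₂ (inj₂ refl) = [ (λ { refl → ¬inner-u iy }) , (λ { refl → ¬iv iy }) ]′ (only-v sxy)
        ... | yes _ | no _ | ()
        ... | no _ | yes _ | ()

    Next : Fin n → Fin n → Set
    Next u v = InS u v × pos u < pos v × (∀ {x} → On x → pos x ≤ pos u ⊎ pos v ≤ pos x)

    Last : Fin n → Set
    Last b = ∀ {x} → On x → pos x ≤ pos b

    -- By `separation`, an edge of the cycle either passes over no vertex of it or spans all of it.
    -- Two edges leaving `u` in the same direction cannot be of the same kind, since their far ends
    -- would coincide; with one neighbour on each side, the upward edge cannot span.
    next-vertex : ∀ {u} → On u → (∃ λ v → Next u v) ⊎ Last u
    next-vertex {u} du with two-neighbours du
    ... | p , q , p≢q , sp , sq , only with <-cmp (pos u) (pos p) | <-cmp (pos u) (pos q)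
    ... | tri≈ _ eq _ | _ = contradiction (pos-injective eq) (InS⇒≢ sp)
    ... | _ | tri≈ _ eq _ = contradiction (pos-injective eq) (InS⇒≢ sq)
    ... | tri< u<p _ _ | tri> _ _ q<u with Separation.separation sp u<p
    ... | inj₁ apart = inj₁ (p , sp , u<p , apart)
    ... | inj₂ around = contradiction q<u (ℕᵖ.≤⇒≯ (proj₁ (around (InS⇒On (InS-sym sq)))))
    next-vertex {u} du | p , q , p≢q , sp , sq , only | tri> _ _ p<u | tri< u<q _ _ with Separation.separation sq u<q
    ... | inj₁ apart = inj₁ (q , sq , u<q , apart)
    ... | inj₂ around = contradiction p<u (ℕᵖ.≤⇒≯ (proj₁ (around (InS⇒On (InS-sym sp)))))
    next-vertex {u} du | p , q , p≢q , sp , sq , only | tri< u<p _ _ | tri< u<q _ _ with Separation.separation sp u<p | Separation.separation sq u<q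
    ... | inj₁ apart | _ = inj₁ (p , sp , u<p , apart)
    ... | _ | inj₁ apart = inj₁ (q , sq , u<q , apart)
    ... | inj₂ ap | inj₂ aq = contradiction (pos-injective (≤-antisym (proj₂ (aq (InS⇒On (InS-sym sp)))) (proj₂ (ap (InS⇒On (InS-sym sq)))))) p≢q
    next-vertex {u} du | p , q , p≢q , sp , sq , only | tri> _ _ p<u | tri> _ _ q<u
      with Separation.separation (InS-sym sp) p<u | Separation.separation (InS-sym sq) q<u
    ... | inj₂ ap | _ = inj₂ λ dx → proj₂ (ap dx)
    ... | _ | inj₂ aq = inj₂ λ dx → proj₂ (aq dx)
    ... | inj₁ ap | inj₁ aq = contradiction (pos-injective (≤-antisym
            ([ id , (λ le → contradiction p<u (ℕᵖ.≤⇒≯ le)) ]′ (aq (InS⇒On (InS-sym sp))))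
            ([ id , (λ le → contradiction q<u (ℕᵖ.≤⇒≯ le)) ]′ (ap (InS⇒On (InS-sym sq)))))) p≢q

    record Ascent (u : Fin n) : Set where
      field
        {end} : Fin n
        {rest} : List (Fin n)
        path : Path end u rest
        last : Last end
        end-on : On end
        visited : ∀ {x} → x ∈ rest → On x
        covers : ∀ {x} → On x → pos u < pos x → x ∈ rest

    ascend : ∀ {u} → On u → Acc _<_ (top ∸ pos u) → Ascent u
    ascend {u} du (acc smaller) with next-vertex du
    ... | inj₂ last = record { path = stop ; last = last ; end-on = du ; visited = λ ()
                             ; covers = λ dx u<x → contradiction u<x (ℕᵖ.≤⇒≯ (last dx)) }
    ... | inj₁ (v , s , u<v , apart) = record
        { path = go (InS-edge s) u<v path ; last = last ; end-on = end-on
        ; visited = λ { (here refl) → InS⇒On (InS-sym s) ; (there x∈) → visited x∈ }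
        ; covers = covers′ }
      where
      open Ascent (ascend (InS⇒On (InS-sym s)) (smaller (ℕᵖ.∸-monoʳ-< u<v (bounded v))))
      covers′ : ∀ {x} → On x → pos u < pos x → x ∈ v ∷ rest
      covers′ dx u<x with apart dx
      ... | inj₁ x≤u = contradiction u<x (ℕᵖ.≤⇒≯ x≤u)
      ... | inj₂ v≤x with ℕᵖ.m≤n⇒m<n∨m≡n v≤x
      ... | inj₁ v<x = there (covers dx v<x)
      ... | inj₂ eq = here (sym (pos-injective eq))

    lowest : ∃ λ a → On a × ∀ {x} → On x → pos a ≤ pos x
    lowest with least (λ i → Finᵖ.any? (λ v → (pos v ℕᵖ.≟ i) ×-dec (degIn S v ℕᵖ.≟ 2)))
        (_ , _ , refl , InS⇒On (proj₂ (proj₂ (proj₁ (proj₂ (proj₂ cycle))))))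
    ... | i , (a , refl , da) , minimal = a , da , λ dx → minimal _ (_ , refl , dx)

    -- Ascending from the lowest vertex gives the path. The farther neighbour of that vertex is not
    -- the next vertex, so its edge spans the cycle and is the closing edge.
    cycle⇒path : ∃ λ a → ∃ λ b → ∃ λ l → CyclePath a b l × cycleOn (a ∷ l) ≡ S
    cycle⇒path with lowest
    ... | a , da , a-least = a , end , rest , (InS-edge chord , path , long) , relExt λ u w →
        ⇔true (joined⇒InS ∘ ∈-cycleOn⁻) (∈-cycleOn⁺ ∘ InS⇒joined)
      where
      open Ascent (ascend da (<-wellFounded _))
      above : ∀ {x} → InS a x → pos a < pos x
      above s = ℕᵖ.≤∧≢⇒< (a-least (InS⇒On (InS-sym s))) (InS⇒≢ s ∘ pos-injective)
      furthest : ∀ {p q} → InS a p → InS a q → pos p < pos q → InS a end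
      furthest sp sq p<q with Separation.separation sq (above sq)
      ... | inj₁ apart = contradiction p<q (ℕᵖ.≤⇒≯ ([ (λ le → contradiction (above sp) (ℕᵖ.≤⇒≯ le)) , id ]′ (apart (InS⇒On (InS-sym sp)))))
      ... | inj₂ around = subst (InS a) (pos-injective (≤-antisym (last (InS⇒On (InS-sym sq))) (proj₂ (around end-on)))) sq
      chord : InS a end
      chord = from (two-neighbours da)
        where
        from : (∃ λ p → ∃ λ q → p ≢ q × InS a p × InS a q × _) → InS a end
        from (p , q , p≢q , sp , sq , _) with <-cmp (pos p) (pos q)
        ... | tri< p<q _ _ = furthest sp sq p<q
        ... | tri≈ _ eq _ = contradiction (pos-injective eq) p≢q
        ... | tri> _ _ q<p = furthest sq sp q<p
      long : 2 ≤ length rest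
      long = let (_ , _ , p≢q , sp , sq , _) = two-neighbours da in
        at-least-2 p≢q (covers (InS⇒On (InS-sym sp)) (above sp)) (covers (InS⇒On (InS-sym sq)) (above sq))
        where
        at-least-2 : ∀ {p q xs} → p ≢ q → p ∈ xs → q ∈ xs → 2 ≤ length xs
        at-least-2 p≢q (here refl) (here refl) = contradiction refl p≢q
        at-least-2 _ (here _) (there (here _)) = s≤s (s≤s z≤n)
        at-least-2 _ (here _) (there (there _)) = s≤s (s≤s z≤n)
        at-least-2 _ (there (here _)) _ = s≤s (s≤s z≤n)
        at-least-2 _ (there (there _)) _ = s≤s (s≤s z≤n)
      on⇒∈ : ∀ {x} → On x → x ∈ a ∷ rest
      on⇒∈ dx with ℕᵖ.m≤n⇒m<n∨m≡n (a-least dx)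
      ... | inj₁ a<x = there (covers dx a<x)
      ... | inj₂ eq = here (sym (pos-injective eq))
      ∈⇒on : ∀ {x} → x ∈ a ∷ rest → On x
      ∈⇒on (here refl) = da
      ∈⇒on (there x∈) = visited x∈
      InS⇒linked : ∀ {u w} → InS u w → pos u < pos w → Linked (a ∷ rest) u w
      InS⇒linked s u<w with Separation.separation s u<w
      ... | inj₁ apart = u<w , inj₁ (All.tabulate (apart ∘ ∈⇒on))
      ... | inj₂ around = u<w , inj₂ (All.tabulate (around ∘ ∈⇒on))
      InS⇒joined : ∀ {u w} → InS u w → Joined (a ∷ rest) u w
      InS⇒joined {u} {w} s = on⇒∈ (InS⇒On s) , on⇒∈ (InS⇒On (InS-sym s)) , direction
        where
        direction : Linked (a ∷ rest) u w ⊎ Linked (a ∷ rest) w u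
        direction with <-cmp (pos u) (pos w)
        ... | tri< u<w _ _ = inj₁ (InS⇒linked s u<w)
        ... | tri≈ _ eq _ = contradiction (pos-injective eq) (InS⇒≢ s)
        ... | tri> _ _ w<u = inj₂ (InS⇒linked (InS-sym s) w<u)
      linked⇒InS : ∀ {u w} → u ∈ a ∷ rest → w ∈ a ∷ rest → Linked (a ∷ rest) u w → InS u w
      linked⇒InS {u} {w} u∈ w∈ (u<w , inj₂ around) = subst₂ InS
        (sym (pos-injective (≤-antisym (proj₁ (All.lookup around (here refl))) (a-least (∈⇒on u∈)))))
        (sym (pos-injective (≤-antisym (last (∈⇒on w∈)) (proj₂ (All.lookup around (on⇒∈ end-on)))))) chord
      linked⇒InS {u} {w} u∈ w∈ (u<w , inj₁ apart) with next-vertex (∈⇒on u∈)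
      ... | inj₂ last-u = contradiction u<w (ℕᵖ.≤⇒≯ (last-u (∈⇒on w∈)))
      ... | inj₁ (v , s , u<v , apart′) = subst (InS u) (pos-injective (≤-antisym
              ([ (λ le → contradiction u<w (ℕᵖ.≤⇒≯ le)) , id ]′ (apart′ (∈⇒on w∈)))
              ([ (λ le → contradiction u<v (ℕᵖ.≤⇒≯ le)) , id ]′ (All.lookup apart (on⇒∈ (InS⇒On (InS-sym s))))))) s
      joined⇒InS : ∀ {u w} → Joined (a ∷ rest) u w → InS u w
      joined⇒InS (u∈ , w∈ , inj₁ link) = linked⇒InS u∈ w∈ link
      joined⇒InS (u∈ , w∈ , inj₂ link) = InS-sym (linked⇒InS w∈ u∈ link)

  -- Counting paths and cycles over the dual tree

  even? : ∀ k → Even k ⊎ Even (suc k)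
  even? zero = inj₁ e0
  even? (suc k) = [ inj₂ ∘ e2+ , inj₁ ]′ (even? k)

  even-suc-⊥ : ∀ {k} → Even k → ¬ Even (suc k)
  even-suc-⊥ (e2+ e) (e2+ e′) = even-suc-⊥ e e′

  even-+ : ∀ {j k} → Even j → Even k → Even (j + k)
  even-+ e0 e = e
  even-+ (e2+ e′) e = e2+ (even-+ e′ e)

  even-cancel : ∀ {j k} → Even j → Even (j + k) → Even k
  even-cancel e0 e = e
  even-cancel (e2+ e′) (e2+ e) = even-cancel e′ e

  odd+odd : ∀ {j k} → Even (suc j) → Even (suc k) → Even (j + k)
  odd+odd {j} {k} e e′ with even-+ e e′
  ... | e″ with subst (Even ∘ suc) (+-suc j k) e″
  ... | e2+ e‴ = e‴

  even-+⁻ : ∀ {j k} → Even (j + k) → (Even j × Even k) ⊎ (Even (suc j) × Even (suc k))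
  even-+⁻ {j} {k} e with even? j
  ... | inj₁ ej = inj₁ (ej , even-cancel ej e)
  ... | inj₂ oj = inj₂ (oj , even-cancel oj (subst Even (cong suc (sym (+-suc j k))) (e2+ e)))

  odd-+⁻ : ∀ {j k} → Even (suc (j + k)) → (Even j × Even (suc k)) ⊎ (Even (suc j) × Even k)
  odd-+⁻ {j} {k} e with even? j
  ... | inj₁ ej = inj₁ (ej , even-cancel ej (subst Even (sym (+-suc j k)) e))
  ... | inj₂ oj = inj₂ (oj , even-cancel oj e)

  Within : Fin n → Fin n → Fin n → Fin n → Set
  Within a b c d = pos a ≤ pos c × pos d ≤ pos b

  Chord : Fin n → Fin n → Set
  Chord c d = Edge c d × suc (pos c) < pos d

  Triple : Set
  Triple = Fin n × Fin n × List (Fin n)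

  -- The cases are `X - Y = 1`, where all links have weight -1, and `X - Y = 0`, where some link has
  -- weight 0. In the second, the top face of that link is nobody's chosen child, so `N < 2 * s` is
  -- strict. In the first, a link that has any face has a top face not counted by `s`, so `s < N`
  -- unless there are no faces.
  Status : ℕ → ℕ → ℕ → ℕ → Set
  Status X Y N s = (X ≡ suc Y × N ≤ 2 * s × ((N ≡ 0 × s ≡ 0) ⊎ s < N)) ⊎ (X ≡ Y × N < 2 * s × s ≤ N)

  weak : ∀ {N s} → (N ≡ 0 × s ≡ 0) ⊎ s < N → s ≤ N
  weak (inj₁ (refl , refl)) = z≤n
  weak (inj₂ lt) = <⇒≤ lt

  -- The formulas say `X - Y = (X₁ - Y₁)(X₂ - Y₂)` without subtraction, so the difference is 1 only
  -- if both factors are. A strict bound on one side makes the sum strict.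
  status-* : ∀ {X₁ Y₁ N₁ s₁ X₂ Y₂ N₂ s₂} → Status X₁ Y₁ N₁ s₁ → Status X₂ Y₂ N₂ s₂ →
    Status (X₁ * X₂ + Y₁ * Y₂) (X₁ * Y₂ + Y₁ * X₂) (N₁ + N₂) (s₁ + s₂)
  status-* {N₁ = N₁} {s₁} {N₂ = N₂} {s₂} = product
    where
    double : 2 * s₁ + 2 * s₂ ≡ 2 * (s₁ + s₂)
    double = sym (ℕᵖ.*-distribˡ-+ 2 s₁ s₂)
    strict : (N₁ ≡ 0 × s₁ ≡ 0) ⊎ s₁ < N₁ → (N₂ ≡ 0 × s₂ ≡ 0) ⊎ s₂ < N₂ → (N₁ + N₂ ≡ 0 × s₁ + s₂ ≡ 0) ⊎ s₁ + s₂ < N₁ + N₂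
    strict (inj₁ (refl , refl)) u = u
    strict (inj₂ lt) u = inj₂ (ℕᵖ.+-mono-<-≤ lt (weak u))
    product : ∀ {X₁ Y₁ X₂ Y₂} → Status X₁ Y₁ N₁ s₁ → Status X₂ Y₂ N₂ s₂ →
      Status (X₁ * X₂ + Y₁ * Y₂) (X₁ * Y₂ + Y₁ * X₂) (N₁ + N₂) (s₁ + s₂)
    product {Y₁ = Y₁} {Y₂ = Y₂} (inj₁ (refl , le , u)) (inj₁ (refl , le′ , u′)) = inj₁
      ( solveℕ 2 (λ y z → (conℕ 1 ⊕ y) ⊗ (conℕ 1 ⊕ z) ⊕ y ⊗ z ⊜ conℕ 1 ⊕ ((conℕ 1 ⊕ y) ⊗ z ⊕ y ⊗ (conℕ 1 ⊕ z))) refl Y₁ Y₂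
      , ≤-trans (ℕᵖ.+-mono-≤ le le′) (≤-reflexive double) , strict u u′)
    product (inj₁ (_ , le , u)) (inj₂ (refl , lt , u′)) = inj₂
      (refl , <-≤-trans (ℕᵖ.+-mono-≤-< le lt) (≤-reflexive double) , ℕᵖ.+-mono-≤ (weak u) u′)
    product {X₁} {X₂ = X₂} {Y₂} (inj₂ (refl , lt , u)) t = inj₂
      (+-comm (X₁ * X₂) (X₁ * Y₂) , <-≤-trans (ℕᵖ.+-mono-<-≤ lt (lower t)) (≤-reflexive double) , ℕᵖ.+-mono-≤ u (upper t))
      where
      lower : ∀ {X Y} → Status X Y N₂ s₂ → N₂ ≤ 2 * s₂
      lower (inj₁ (_ , le , _)) = le
      lower (inj₂ (_ , lt , _)) = <⇒≤ lt
      upper : ∀ {X Y} → Status X Y N₂ s₂ → s₂ ≤ N₂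
      upper (inj₁ (_ , _ , u)) = weak u
      upper (inj₂ (_ , _ , u)) = u

  -- In a part of the dual tree with N faces, the odd subtrees outnumber the even ones by s. X and Y count the
  -- paths with edge number congruent to k and to k + 1 modulo 2. Since X - Y is multiplicative along a chain
  -- and vanishes or is 1 on each link, it is 0 or 1.
  record Block (Q : List (Fin n) → Set) (W : Fin n → Fin n → Set) (k : ℕ) : Set where
    field
      {X Y N s co ce m} : ℕ
      paths₀ : HasCount (λ l → Q l × Even (k + length l)) X
      paths₁ : HasCount (λ l → Q l × Even (suc (k + length l))) Y
      chords : HasCount {Fin n × Fin n} (λ (c , d) → W c d × Chord c d) N
      -- The closing edge changes the parity: paths with evenly many edges give odd cycles.
      odd-cycles : HasCount {Triple} (λ (c , d , l) → W c d × CyclePath c d l × Even (length l)) co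
      even-cycles : HasCount {Triple} (λ (c , d , l) → W c d × CyclePath c d l × Even (suc (length l))) ce
      excess : co ≡ ce + s
      status : Status X Y N s
      X≥1 : 1 ≤ X
      -- `m` is the number of links that have a face. Changing the parity on exactly one of them
      -- yields `m` paths of the second kind; closed by an edge above, they become the even cycles
      -- still missing in `N≤ce+m`.
      Y≥m : m ≤ Y
      N≤ce+m : N ≤ ce + m

  path-++ : ∀ {a y x l₁ l₂} → Path y a l₁ → Path x y l₂ → Path x a (l₁ ++ l₂)
  path-++ stop q = q
  path-++ (go e lt p) q = go e lt (path-++ p q)

  -- An increasing path meets its end `y` only at the end, so `y` marks where the first list stops.
  ++-path-injective : ∀ {a y l₁ l₁′ l₂ l₂′} → Path y a l₁ → Path y a l₁′ → l₁ ++ l₂ ≡ l₁′ ++ l₂′ → (l₁ , l₂) ≡ (l₁′ , l₂′)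
  ++-path-injective stop stop eq = cong ([] ,_) eq
  ++-path-injective stop p@(go _ _ _) _ = contradiction (path-start-< p (end-in-tail p)) (<-irrefl refl)
    where
    end-in-tail : ∀ {a k l y} → Path y a (k ∷ l) → y ∈ k ∷ l
    end-in-tail (go _ _ p) = path-end-∈ p
  ++-path-injective p@(go _ _ _) stop _ = contradiction (path-start-< p (end-in-tail p)) (<-irrefl refl)
    where
    end-in-tail : ∀ {a k l y} → Path y a (k ∷ l) → y ∈ k ∷ l
    end-in-tail (go _ _ p) = path-end-∈ p
  ++-path-injective (go {k = k} _ _ p) (go _ _ p′) eq with cong Data.List.head eq
  ... | refl with ++-path-injective p p′ (cong (Data.List.drop 1) eq)
  ... | refl = refl

  Split : Fin n → Fin n → Fin n → List (Fin n) → Set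
  Split a y x l = ∃ λ l₁ → ∃ λ l₂ → Path y a l₁ × Path x y l₂ × l₁ ++ l₂ ≡ l

  split : ∀ {a y x l} → Unjumped a x y → pos a ≤ pos y → pos y < pos x → Path x a l → Split a y x l
  split unjumped a≤y y<x p with ℕᵖ.m≤n⇒m<n∨m≡n a≤y
  split unjumped a≤y y<x p | inj₂ eq with pos-injective eq
  ... | refl = [] , _ , stop , p , refl
  split unjumped a≤y y<x stop | inj₁ a<y = contradiction y<x (ℕᵖ.<-asym a<y)
  split {a} {y} {x} unjumped a≤y y<x (go {k = k} e a<k p) | inj₁ a<y with pos k ≤? pos y
  ... | no k≰y = ⊥-elim (unjumped e ≤-refl a<y (ℕᵖ.≰⇒> k≰y) (path-end-≥ p (here refl)))
  ... | yes k≤y = let (l₁ , l₂ , p₁ , p₂ , eq) = split (λ c~d k≤c → unjumped c~d (≤-trans (<⇒≤ a<k) k≤c)) k≤y y<x p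
                  in k ∷ l₁ , l₂ , go e a<k p₁ , p₂ , cong (k ∷_) eq

  LongPath : Fin n → Fin n → List (Fin n) → Set
  LongPath b a l = Path b a l × 2 ≤ length l

  -- With two edges available, the first step is not `ab` and so cannot jump over `y`. Behind it the
  -- exceptional edge is out of reach, as its source `a` lies below.
  split-long : ∀ {a y b l} → UnjumpedBut a b y → pos a < pos y → pos y < pos b → LongPath b a l → Split a y b l
  split-long unjumped a<y y<b (stop , ())
  split-long {a} {y} {b} unjumped a<y y<b (go {k = k} e a<k p , long) with pos k ≤? pos y
  ... | no k≰y = ⊥-elim (short (proj₂ (unjumped e ≤-refl a<y (ℕᵖ.≰⇒> k≰y) (path-end-≥ p (here refl)))) p long)
    where
    short : ∀ {l} → k ≡ b → Path b k l → ¬ 2 ≤ length (k ∷ l)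
    short refl stop (s≤s ())
    short refl p@(go _ lt q) _ = contradiction lt (ℕᵖ.≤⇒≯ (path-end-≥ q (here refl)))
  ... | yes k≤y = let (l₁ , l₂ , p₁ , p₂ , eq) = split only k≤y y<b p in k ∷ l₁ , l₂ , go e a<k p₁ , p₂ , cong (k ∷_) eq
    where
    only : Unjumped k b y
    only c~d k≤c c<y y<d d≤b = contradiction (cong pos (proj₁ (unjumped c~d (≤-trans (<⇒≤ a<k) k≤c) c<y y<d d≤b)))
      (λ eq → ℕᵖ.<⇒≢ (<-≤-trans a<k k≤c) (sym eq))

  path-nonempty : ∀ {a b l} → pos a < pos b → Path b a l → 1 ≤ length l
  path-nonempty a<b stop = contradiction a<b (<-irrefl refl)
  path-nonempty a<b (go _ _ _) = s≤s z≤n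

  cyclePath-< : ∀ {c d l} → CyclePath c d l → pos c < pos d
  cyclePath-< c = Cycle.a<b c

  -- Concatenation at `y` is a bijection from pairs of paths, and parities add, whence the products
  -- in `X` and `Y`. `Q` is left open because chains use all paths and faces only those with at
  -- least two edges. For a tree as second block, `k₂ + k₁` is `suc k₁` by computation.
  combine : ∀ {a y x k₁ k₂} {Q : List (Fin n) → Set} →
    (∀ {l₁ l₂} → Path y a l₁ → Path x y l₂ → Q (l₁ ++ l₂)) → (∀ {l} → Q l → Split a y x l) →
    Block (Path y a) (Within a y) k₁ → Block (Path x y) (Within y x) k₂ →
    Block Q (λ c d → Within a y c d ⊎ Within y x c d) (k₂ + k₁)
  combine {a} {y} {x} {k₁} {k₂} {Q} join split′ B₁ B₂ = record
    { X = B₁.X * B₂.X + B₁.Y * B₂.Y ; Y = B₁.X * B₂.Y + B₁.Y * B₂.X ; N = B₁.N + B₂.N ; s = B₁.s + B₂.s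
    ; co = B₁.co + B₂.co ; ce = B₁.ce + B₂.ce ; m = B₁.m + B₂.m
    ; paths₀ = hasCount-⇔ (hasCount-map (uncurry _++_) (hasCount-⊎ (hasCount-× B₁.paths₀ B₂.paths₀) (hasCount-× B₁.paths₁ B₂.paths₁)
          (λ ((_ , e) , _) ((_ , o) , _) → even-suc-⊥ e o))
        (λ r r′ → ++-path-injective (first-path r) (first-path r′)))
        (λ { ((l₁ , l₂) , inj₁ ((p , e) , (q , e′)) , refl) → join p q , subst Even (sum-lengths l₁ l₂) (even-+ e e′)
           ; ((l₁ , l₂) , inj₂ ((p , o) , (q , o′)) , refl) → join p q , subst Even (sum-lengths l₁ l₂) (odd+odd o o′) })
        (λ (Ql , e) → rejoin₀ (split′ Ql) e)
    ; paths₁ = hasCount-⇔ (hasCount-map (uncurry _++_) (hasCount-⊎ (hasCount-× B₁.paths₀ B₂.paths₁) (hasCount-× B₁.paths₁ B₂.paths₀)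
          (λ ((_ , e) , _) ((_ , o) , _) → even-suc-⊥ e o))
        (λ r r′ → ++-path-injective (first-path r) (first-path r′)))
        (λ { ((l₁ , l₂) , inj₁ ((p , e) , (q , o)) , refl) → join p q , subst (Even ∘ suc) (sum-lengths l₁ l₂)
               (subst Even (+-suc (k₁ + length l₁) (k₂ + length l₂)) (even-+ e o))
           ; ((l₁ , l₂) , inj₂ ((p , o) , (q , e)) , refl) → join p q , subst (Even ∘ suc) (sum-lengths l₁ l₂) (even-+ o e) })
        (λ (Ql , o) → rejoin₁ (split′ Ql) o)
    ; chords = hasCount-⇔ (hasCount-⊎ B₁.chords B₂.chords λ (w , _ , lt) (w′ , _) → apart w w′ (<-trans ≤-refl lt))
        (λ { (inj₁ (p , q)) → inj₁ p , q ; (inj₂ (p , q)) → inj₂ p , q }) (λ { (inj₁ p , q) → inj₁ (p , q) ; (inj₂ p , q) → inj₂ (p , q) })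
    ; odd-cycles = hasCount-⇔ (hasCount-⊎ B₁.odd-cycles B₂.odd-cycles λ (w , c , _) (w′ , _) → apart w w′ (cyclePath-< c))
        (λ { (inj₁ (p , q)) → inj₁ p , q ; (inj₂ (p , q)) → inj₂ p , q }) (λ { (inj₁ p , q) → inj₁ (p , q) ; (inj₂ p , q) → inj₂ (p , q) })
    ; even-cycles = hasCount-⇔ (hasCount-⊎ B₁.even-cycles B₂.even-cycles λ (w , c , _) (w′ , _) → apart w w′ (cyclePath-< c))
        (λ { (inj₁ (p , q)) → inj₁ p , q ; (inj₂ (p , q)) → inj₂ p , q }) (λ { (inj₁ p , q) → inj₁ (p , q) ; (inj₂ p , q) → inj₂ (p , q) })
    ; excess = trans (cong₂ _+_ B₁.excess B₂.excess) (+-interchange B₁.ce B₁.s B₂.ce B₂.s)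
    ; status = status-* B₁.status B₂.status
    ; X≥1 = ≤-trans (ℕᵖ.*-mono-≤ B₁.X≥1 B₂.X≥1) (ℕᵖ.m≤m+n _ _)
    ; Y≥m = ≤-trans (ℕᵖ.+-mono-≤ (≤-trans B₁.Y≥m (grow-right B₁.Y B₂.X≥1)) (≤-trans B₂.Y≥m (grow-left B₂.Y B₁.X≥1)))
        (≤-reflexive (+-comm (B₁.Y * B₂.X) (B₁.X * B₂.Y)))
    ; N≤ce+m = ≤-trans (ℕᵖ.+-mono-≤ B₁.N≤ce+m B₂.N≤ce+m) (≤-reflexive (+-interchange B₁.ce B₁.m B₂.ce B₂.m))
    }
    where
    module B₁ = Block B₁
    module B₂ = Block B₂
    +-interchange : ∀ p q r t → (p + q) + (r + t) ≡ (p + r) + (q + t)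
    +-interchange = solveℕ 4 (λ p q r t → (p ⊕ q) ⊕ (r ⊕ t) ⊜ (p ⊕ r) ⊕ (q ⊕ t)) refl
    grow-right : ∀ y {z} → 1 ≤ z → y ≤ y * z
    grow-right y {suc z} _ = ℕᵖ.m≤m*n y (suc z)
    grow-left : ∀ y {z} → 1 ≤ z → y ≤ z * y
    grow-left y {suc z} _ = ℕᵖ.m≤n*m y (suc z)
    sum-lengths : ∀ (l₁ l₂ : List (Fin n)) → (k₁ + length l₁) + (k₂ + length l₂) ≡ (k₂ + k₁) + length (l₁ ++ l₂)
    sum-lengths l₁ l₂ = trans (solveℕ 4 (λ p q r t → (p ⊕ q) ⊕ (r ⊕ t) ⊜ (r ⊕ p) ⊕ (q ⊕ t)) refl k₁ (length l₁) k₂ (length l₂))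
      (cong ((k₂ + k₁) +_) (sym (length-++ l₁)))
    first-path : ∀ {l₁ l₂ : List (Fin n)} {E₁ E₂ O₁ O₂ : Set}
      → (((Path y a l₁ × E₁) × (Path x y l₂ × E₂)) ⊎ ((Path y a l₁ × O₁) × (Path x y l₂ × O₂))) → Path y a l₁
    first-path (inj₁ ((p , _) , _)) = p
    first-path (inj₂ ((p , _) , _)) = p
    First₀ First₁ Second₀ Second₁ : List (Fin n) → Set
    First₀ l = Path y a l × Even (k₁ + length l)
    First₁ l = Path y a l × Even (suc (k₁ + length l))
    Second₀ l = Path x y l × Even (k₂ + length l)
    Second₁ l = Path x y l × Even (suc (k₂ + length l))
    R₀ R₁ : List (Fin n) × List (Fin n) → Set
    R₀ (l₁ , l₂) = (First₀ l₁ × Second₀ l₂) ⊎ (First₁ l₁ × Second₁ l₂)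
    R₁ (l₁ , l₂) = (First₀ l₁ × Second₁ l₂) ⊎ (First₁ l₁ × Second₀ l₂)
    rejoin₀ : ∀ {l} → Split a y x l → Even ((k₂ + k₁) + length l) → ∃ λ ls → R₀ ls × uncurry _++_ ls ≡ l
    rejoin₀ (l₁ , l₂ , p , q , refl) e = (l₁ , l₂) , [ (λ (e , e′) → inj₁ ((p , e) , (q , e′))) , (λ (o , o′) → inj₂ ((p , o) , (q , o′))) ]′
      (even-+⁻ (subst Even (sym (sum-lengths l₁ l₂)) e)) , refl
    rejoin₁ : ∀ {l} → Split a y x l → Even (suc ((k₂ + k₁) + length l)) → ∃ λ ls → R₁ ls × uncurry _++_ ls ≡ l
    rejoin₁ (l₁ , l₂ , p , q , refl) o = (l₁ , l₂) , [ (λ (e , o) → inj₁ ((p , e) , (q , o))) , (λ (o , e) → inj₂ ((p , o) , (q , e))) ]′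
      (odd-+⁻ (subst (Even ∘ suc) (sym (sum-lengths l₁ l₂)) o)) , refl
    apart : ∀ {c d} → Within a y c d → Within y x c d → ¬ pos c < pos d
    apart (_ , d≤y) (y≤c , _) = ℕᵖ.≤⇒≯ (≤-trans d≤y y≤c)

  -- `combine` yields the union of two intervals; for edges of `G` this agrees with the whole
  -- interval, since no edge passes over the common point.
  rewindow : ∀ {Q W W′ k} → (∀ {c d} → Edge c d → pos c < pos d → W c d → W′ c d) →
    (∀ {c d} → Edge c d → pos c < pos d → W′ c d → W c d) → Block Q W k → Block Q W′ k
  rewindow f g B = record
    { X = X ; Y = Y ; N = N ; s = s ; co = co ; ce = ce ; m = m
    ; paths₀ = paths₀ ; paths₁ = paths₁
    ; chords = hasCount-⇔ chords (λ (w , e , lt) → f e (<-trans ≤-refl lt) w , e , lt) (λ (w , e , lt) → g e (<-trans ≤-refl lt) w , e , lt)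
    ; odd-cycles = hasCount-⇔ odd-cycles (λ (w , c , e) → f (proj₁ c) (cyclePath-< c) w , c , e)
          (λ (w , c , e) → g (proj₁ c) (cyclePath-< c) w , c , e)
    ; even-cycles = hasCount-⇔ even-cycles (λ (w , c , e) → f (proj₁ c) (cyclePath-< c) w , c , e)
          (λ (w , c , e) → g (proj₁ c) (cyclePath-< c) w , c , e)
    ; excess = excess ; status = status ; X≥1 = X≥1 ; Y≥m = Y≥m ; N≤ce+m = N≤ce+m }
    where open Block B

  -- Index 1 compares parities with that of the single edge `ab`. The two added inequalities need a
  -- common top edge: both fail for a chain of two single faces, hence they are not part of `Block`.
  TreeBlock : Fin n → Fin n → Set
  TreeBlock a b = Σ (Block (Path b a) (Within a b) 1) λ B → (Block.N B ≤ 1 ⊎ Block.s B < Block.N B) × Block.N B ≤ suc (Block.ce B)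

  leaf-block : ∀ {a b} → Edge a b → pos b ≡ suc (pos a) → TreeBlock a b
  leaf-block {a} {b} a~b unit = record
    { X = 1 ; Y = 0 ; N = 0 ; s = 0 ; co = 0 ; ce = 0 ; m = 0
    ; paths₀ = hasCount-⇔ (hasCount-singleton (b ∷ [])) (λ { refl → go a~b a<b stop , e2+ e0 }) (single ∘ proj₁)
    ; paths₁ = hasCount-empty λ (p , e) → odd-single (single p) e
    ; chords = hasCount-empty λ (w , e , lt) → narrow w lt
    ; odd-cycles = hasCount-empty λ (w , c , _) → no-cycle w c
    ; even-cycles = hasCount-empty λ (w , c , _) → no-cycle w c
    ; excess = refl ; status = inj₁ (refl , z≤n , inj₁ (refl , refl)) ; X≥1 = ≤-refl ; Y≥m = z≤n ; N≤ce+m = z≤n } , inj₁ z≤n , z≤n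
    where
    a<b : pos a < pos b
    a<b = ≤-reflexive (sym unit)
    single : ∀ {l} → Path b a l → l ≡ b ∷ []
    single stop = contradiction a<b (<-irrefl refl)
    single (go {k = k} e a<k p) with pos-injective {k} {b} (≤-antisym (path-end-≥ p (here refl)) (≤-trans (≤-reflexive unit) a<k))
    ... | refl with p
    ... | stop = refl
    ... | go _ lt q = contradiction lt (ℕᵖ.≤⇒≯ (path-end-≥ q (here refl)))
    odd-single : ∀ {l} → l ≡ b ∷ [] → ¬ Even (suc (suc (length l)))
    odd-single refl (e2+ ())
    narrow : ∀ {c d} → Within a b c d → ¬ suc (pos c) < pos d
    narrow (a≤c , d≤b) lt = ℕᵖ.<⇒≱ (<-≤-trans lt d≤b) (≤-trans (≤-reflexive unit) (s≤s a≤c))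
    no-cycle : ∀ {c d l} → Within a b c d → ¬ CyclePath c d l
    no-cycle w c = let (_ , _ , c<m , m<d) = Cycle.middle c in narrow w (≤-trans (s≤s c<m) m<d)

  -- As the lower side has evenly many links, `X` and `Y` count the long paths with evenly and oddly
  -- many edges. The edge `ab` adds one odd path, and closing the long paths adds `X` odd and `Y`
  -- even cycles. So the new difference is `suc Y - X`, while `s` grows by `X - Y`.
  node-block : ∀ {a b k} {W : Fin n → Fin n → Set} → Edge a b → suc (pos a) < pos b → Even (suc k) →
    (∀ {c d} → Edge c d → pos c < pos d → W c d → Within a b c d × ¬ (c ≡ a × d ≡ b)) →
    (∀ {c d} → Edge c d → pos c < pos d → Within a b c d → (c ≡ a × d ≡ b) ⊎ W c d) →
    Block (LongPath b a) W (suc k) → TreeBlock a b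
  node-block {a} {b} {k} {W} a~b long even W⇒ ⇒W B = assemble status
    where
    open Block B
    a<b : pos a < pos b
    a<b = <-trans ≤-refl long
    long-even : HasCount (λ l → LongPath b a l × Even (length l)) X
    long-even = hasCount-⇔ paths₀ (λ (p , e) → p , even-cancel even e) (λ (p , e) → p , even-+ even e)
    long-odd : HasCount (λ l → LongPath b a l × Even (suc (length l))) Y
    long-odd = hasCount-⇔ paths₁ (λ {l} (p , e) → p , even-cancel even (subst Even (sym (+-suc (suc k) (length l))) e))
      (λ {l} (p , e) → p , subst Even (+-suc (suc k) (length l)) (even-+ even e))
    direct-or-long : ∀ {l} → Path b a l → l ≡ b ∷ [] ⊎ LongPath b a l
    direct-or-long stop = contradiction a<b (<-irrefl refl)
    direct-or-long (go e lt stop) = inj₁ refl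
    direct-or-long p@(go _ _ (go _ _ _)) = inj₂ (p , s≤s (s≤s z≤n))
    odd-paths : HasCount (λ l → Path b a l × Even (suc (length l))) (suc Y)
    odd-paths = hasCount-⇔ (hasCount-⊎ (hasCount-singleton (b ∷ [])) long-odd λ { refl ((_ , s≤s ()) , _) })
      (λ { (inj₁ refl) → go a~b a<b stop , e2+ e0 ; (inj₂ ((p , _) , e)) → p , e })
      (λ (p , e) → [ inj₁ , (λ q → inj₂ (q , e)) ]′ (direct-or-long p))
    even-paths : HasCount (λ l → Path b a l × Even (suc (suc (length l)))) X
    even-paths = hasCount-⇔ long-even (λ ((p , _) , e) → p , e2+ e) (λ { (p , e2+ e) → not-direct e (direct-or-long p) , e })
      where
      not-direct : ∀ {l} → Even (length l) → l ≡ b ∷ [] ⊎ LongPath b a l → LongPath b a l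
      not-direct () (inj₁ refl)
      not-direct _ (inj₂ q) = q
    all-chords : HasCount {Fin n × Fin n} (λ (c , d) → Within a b c d × Chord c d) (suc N)
    all-chords = hasCount-⇔ (hasCount-⊎ (hasCount-singleton (a , b)) chords
          λ { refl (w , e , lt) → proj₂ (W⇒ e (<-trans ≤-refl lt) w) (refl , refl) })
      (λ { (inj₁ refl) → (≤-refl , ≤-refl) , a~b , long ; (inj₂ (w , e , lt)) → proj₁ (W⇒ e (<-trans ≤-refl lt) w) , e , lt })
      (λ { {c , d} (w , e , lt) → [ (λ { (refl , refl) → inj₁ refl }) , (λ w′ → inj₂ (w′ , e , lt)) ]′ (⇒W e (<-trans ≤-refl lt) w) })
    all-cycles : ∀ {P : ℕ → Set} {i j} → HasCount {Triple} (λ (c , d , l) → W c d × CyclePath c d l × P (length l)) i →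
      HasCount (λ l → LongPath b a l × P (length l)) j → HasCount {Triple} (λ (c , d , l) → Within a b c d × CyclePath c d l × P (length l)) (i + j)
    all-cycles below here-cycles = hasCount-⇔ (hasCount-⊎ below (hasCount-map (λ l → (a , b , l)) here-cycles λ { _ _ refl → refl })
        λ { (w , c , _) (_ , _ , refl) → proj₂ (W⇒ (proj₁ c) (cyclePath-< c) w) (refl , refl) })
      (λ { (inj₁ (w , c , e)) → proj₁ (W⇒ (proj₁ c) (cyclePath-< c) w) , c , e ; (inj₂ (_ , (q , e) , refl)) → (≤-refl , ≤-refl) , (a~b , q) , e })
      (λ { {c , d , l} (w , cyc , e) → [ (λ { (refl , refl) → inj₂ (l , (proj₂ cyc , e) , refl) }) , (λ w′ → inj₁ (w′ , cyc , e)) ]′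
           (⇒W (proj₁ cyc) (cyclePath-< cyc) w) })
    N≤ce+Y : N ≤ ce + Y
    N≤ce+Y = ≤-trans N≤ce+m (ℕᵖ.+-monoʳ-≤ ce Y≥m)
    block : ∀ s′ → co + X ≡ (ce + Y) + s′ → Status (suc Y) X (suc N) s′ → Block (Path b a) (Within a b) 1
    block s′ eq st = record
      { X = suc Y ; Y = X ; N = suc N ; s = s′ ; co = co + X ; ce = ce + Y ; m = 1
      ; paths₀ = odd-paths ; paths₁ = even-paths ; chords = all-chords
      ; odd-cycles = all-cycles {Even} odd-cycles long-even
      ; even-cycles = all-cycles {Even ∘ suc} even-cycles long-odd
      ; excess = eq ; status = st ; X≥1 = s≤s z≤n ; Y≥m = X≥1
      ; N≤ce+m = ≤-trans (s≤s N≤ce+Y) (≤-reflexive (+-comm 1 (ce + Y))) }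
    assemble : Status X Y N s → TreeBlock a b
    -- All lower weights are -1, so the new face has weight 0 and counts in `s`. Strictness is
    -- inherited from below unless this is the only face.
    assemble (inj₁ (X≡ , le , u)) = block (suc s) eq (inj₂ (sym X≡ , twice , s≤s (weak u))) ,
        [ (λ (N≡0 , _) → inj₁ (s≤s (≤-reflexive N≡0))) , (λ lt → inj₂ (s≤s lt)) ]′ u , s≤s N≤ce+Y
      where
      eq : co + X ≡ (ce + Y) + suc s
      eq = trans (cong₂ _+_ excess X≡) (solveℕ 3 (λ p q r → (p ⊕ q) ⊕ (conℕ 1 ⊕ r) ⊜ (p ⊕ r) ⊕ (conℕ 1 ⊕ q)) refl ce s Y)
      twice : suc N < 2 * suc s
      twice = ≤-trans (s≤s (s≤s le)) (≤-reflexive (solveℕ 1 (λ q → conℕ 2 ⊕ conℕ 2 ⊗ q ⊜ conℕ 2 ⊗ (conℕ 1 ⊕ q)) refl s))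
    -- Some lower weight vanishes, so the new face has weight -1: it raises `N` but not `s`.
    assemble (inj₂ (X≡ , lt , u)) = block s eq (inj₁ (cong suc (sym X≡) , lt , inj₂ (s≤s u))) , inj₂ (s≤s u) , s≤s N≤ce+Y
      where
      eq : co + X ≡ (ce + Y) + s
      eq = trans (cong₂ _+_ excess X≡) (solveℕ 3 (λ p q r → (p ⊕ q) ⊕ r ⊜ (p ⊕ r) ⊕ q) refl ce s Y)

  treeBlock : ∀ {a b} → Tree a b → TreeBlock a b
  chainBlock : ∀ {a x k} → Chain a x k → Block (Path x a) (Within a x) k

  chainBlock (one t) = proj₁ (treeBlock t)
  chainBlock (snoc {a} {y} {x} a<y y<x unjumped c t) = rewindow widen narrow
      (combine path-++ (split unjumped (<⇒≤ a<y) y<x) (chainBlock c) (proj₁ (treeBlock t)))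
    where
    widen : ∀ {c d} → Edge c d → pos c < pos d → Within a y c d ⊎ Within y x c d → Within a x c d
    widen _ _ (inj₁ (p , q)) = p , ≤-trans q (<⇒≤ y<x)
    widen _ _ (inj₂ (p , q)) = ≤-trans (<⇒≤ a<y) p , q
    narrow : ∀ {c d} → Edge c d → pos c < pos d → Within a x c d → Within a y c d ⊎ Within y x c d
    narrow {c} {d} e _ (a≤c , d≤x) with pos d ≤? pos y | pos y ≤? pos c
    ... | yes d≤y | _ = inj₁ (a≤c , d≤y)
    ... | no _ | yes y≤c = inj₂ (y≤c , d≤x)
    ... | no d≰y | no y≰c = ⊥-elim (unjumped e a≤c (ℕᵖ.≰⇒> y≰c) (ℕᵖ.≰⇒> d≰y) d≤x)

  treeBlock (leaf e unit) = leaf-block e unit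
  treeBlock (node {a} {y} {b} {k} e a<y y<b unjumped c t odd) = node-block e (≤-trans (s≤s a<y) y<b) even widen narrow
      (combine (λ {l₁} {l₂} p q → path-++ p q , ≤-trans (ℕᵖ.+-mono-≤ (path-nonempty a<y p) (path-nonempty y<b q)) (≤-reflexive (sym (length-++ l₁))))
        (split-long unjumped a<y y<b) (chainBlock c) (proj₁ (treeBlock t)))
    where
    even : Even (suc k)
    even = [ (λ e → contradiction e odd) , id ]′ (even? k)
    widen : ∀ {c d} → Edge c d → pos c < pos d → Within a y c d ⊎ Within y b c d → Within a b c d × ¬ (c ≡ a × d ≡ b)
    widen _ _ (inj₁ (p , q)) = (p , ≤-trans q (<⇒≤ y<b)) , λ { (_ , refl) → ℕᵖ.<⇒≱ y<b q }
    widen _ _ (inj₂ (p , q)) = (≤-trans (<⇒≤ a<y) p , q) , λ { (refl , _) → ℕᵖ.<⇒≱ a<y p }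
    narrow : ∀ {c d} → Edge c d → pos c < pos d → Within a b c d → (c ≡ a × d ≡ b) ⊎ (Within a y c d ⊎ Within y b c d)
    narrow {c} {d} e _ (a≤c , d≤b) with pos d ≤? pos y | pos y ≤? pos c
    ... | yes d≤y | _ = inj₂ (inj₁ (a≤c , d≤y))
    ... | no _ | yes y≤c = inj₂ (inj₂ (y≤c , d≤b))
    ... | no d≰y | no y≰c = inj₁ (unjumped e a≤c (ℕᵖ.≰⇒> y≰c) (ℕᵖ.≰⇒> d≰y) d≤b)

-- Growing spanning trees

-- Nodes and links are abstract because the same growth serves the dual, where darts link faces, and
-- `G`, where darts link vertices. A target outside `R` keeps the links acyclic.
data Grow {N L : Set} (src tgt : L → N) (Ok : L → Set) (r : N) : List N → List L → Set where
  seed : Grow src tgt Ok r (r ∷ []) []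
  grow : ∀ {R ls l} → Grow src tgt Ok r R ls → Ok l → src l ∈ R → tgt l ∉ R → Grow src tgt Ok r (tgt l ∷ R) (l ∷ ls)

module _ {N L : Set} {src tgt : L → N} {Ok : L → Set} {r : N} where

  grow-root : ∀ {R ls} → Grow src tgt Ok r R ls → r ∈ R
  grow-root seed = here refl
  grow-root (grow g _ _ _) = there (grow-root g)

  grow-ends : ∀ {R ls l} → Grow src tgt Ok r R ls → l ∈ ls → src l ∈ R × tgt l ∈ R
  grow-ends (grow g _ s∈ _) (here refl) = there s∈ , here refl
  grow-ends (grow g _ _ _) (there l∈) = let (a , b) = grow-ends g l∈ in there a , there b

  grow-ok : ∀ {R ls l} → Grow src tgt Ok r R ls → l ∈ ls → Ok l
  grow-ok (grow _ ok _ _) (here refl) = ok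
  grow-ok (grow g _ _ _) (there l∈) = grow-ok g l∈

  grow-length : ∀ {R ls} → Grow src tgt Ok r R ls → length R ≡ suc (length ls)
  grow-length seed = refl
  grow-length (grow g _ _ _) = cong suc (grow-length g)

  missing : DecidableEquality N → ∀ (R all : List N) → (∃ λ x → x ∈ all × x ∉ R) ⊎ (∀ {x} → x ∈ all → x ∈ R)
  missing _≟_ R [] = inj₂ λ ()
  missing _≟_ R (x ∷ all) with x ∈? R | missing _≟_ R all
    where open import Data.List.Membership.DecPropositional _≟_ using (_∈?_)
  ... | no x∉ | _ = inj₁ (x , here refl , x∉)
  ... | yes _ | inj₁ (y , y∈ , y∉) = inj₁ (y , there y∈ , y∉)
  ... | yes x∈ | inj₂ sub = inj₂ λ { (here refl) → x∈ ; (there y∈) → sub y∈ }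

  grow-exists : DecidableEquality N → ∀ {all} → Unique all →
    (∀ {R ls x} → Grow src tgt Ok r R ls → x ∈ all → x ∉ R → ∃ λ l → Ok l × src l ∈ R × tgt l ∉ R) →
    ∀ m → suc m ≤ length all → ∃ λ R → ∃ λ ls → Grow src tgt Ok r R ls × length ls ≡ m
  grow-exists _≟_ u expand zero _ = _ , _ , seed , refl
  grow-exists _≟_ {all} u expand (suc m) m<all with grow-exists _≟_ u expand m (<⇒≤ m<all)
  ... | R , ls , g , refl with missing _≟_ R all
  ... | inj₂ sub = contradiction (≤-trans m<all (≤-trans (unique-⊆⇒length-≤ u sub) (≤-reflexive (grow-length g)))) (<-irrefl refl)
  ... | inj₁ (x , x∈ , x∉) with expand g x∈ x∉
  ... | l , ok , s∈ , t∉ = _ , _ , grow g ok s∈ t∉ , refl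

  -- The value at each new node is still free and can be fitted to its link: on a tree every edge
  -- function is a coboundary.
  grow-potential : DecidableEquality N → ∀ {R ls} → Grow src tgt Ok r R ls → (ψ : L → Bool) →
    ∃ λ (g : N → Bool) → ∀ {l} → l ∈ ls → g (src l) xor g (tgt l) ≡ ψ l
  grow-potential _≟_ seed ψ = (λ _ → false) , λ ()
  grow-potential _≟_ (grow {R} {ls} {l} gr ok s∈ t∉) ψ with grow-potential _≟_ gr ψ
  ... | g , hg = g′ , h′
    where
    g′ : N → Bool
    g′ v = if ⌊ v ≟ tgt l ⌋ then g (src l) xor ψ l else g v
    at-new : g′ (tgt l) ≡ g (src l) xor ψ l
    at-new = cong (if_then g (src l) xor ψ l else g (tgt l)) (⌊⌋-true (tgt l ≟ tgt l) refl)
    at-old : ∀ {v} → v ∈ R → g′ v ≡ g v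
    at-old {v} v∈ = cong (if_then g (src l) xor ψ l else g v) (⌊⌋-false (v ≟ tgt l) (λ { refl → t∉ v∈ }))
    h′ : ∀ {l′} → l′ ∈ l ∷ ls → g′ (src l′) xor g′ (tgt l′) ≡ ψ l′
    h′ (here refl) = trans (cong₂ _xor_ (at-old s∈) at-new)
      (xor-cancelˡ (g (src l)) (ψ l))
    h′ (there l∈) = let (a , b) = grow-ends gr l∈ in trans (cong₂ _xor_ (at-old a) (at-old b)) (hg l∈)

_∈±_ : ∀ {n} → Dart n → List (Dart n) → Set
d ∈± ls = d ∈ ls ⊎ swap d ∈ ls

-- The representative under which `edgeCount` counts an undirected edge.
orient : ∀ {n} → Dart n → Dart n
orient (u , v) = if toℕ u <ᵇ toℕ v then (u , v) else (v , u)

orient-either : ∀ {n} (d : Dart n) → orient d ≡ d ⊎ orient d ≡ swap d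
orient-either (u , v) with toℕ u <ᵇ toℕ v
... | true = inj₁ refl
... | false = inj₂ refl

orient-≡ : ∀ {n} (d e : Dart n) → orient d ≡ orient e → e ≡ d ⊎ e ≡ swap d
orient-≡ d e eq with orient-either d | orient-either e
... | inj₁ p | inj₁ q = inj₁ (trans (sym q) (trans (sym eq) p))
... | inj₁ p | inj₂ q = inj₂ (cong swap (trans (sym q) (trans (sym eq) p)))
... | inj₂ p | inj₁ q = inj₂ (trans (sym q) (trans (sym eq) p))
... | inj₂ p | inj₂ q = inj₁ (cong swap (trans (sym q) (trans (sym eq) p)))

orient-∈± : ∀ {n} {d : Dart n} {ls} → orient d ∈ map orient ls → d ∈± ls
orient-∈± {d = d} m with ∈-map⁻ orient m
... | e , e∈ , eq with orient-≡ d e eq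
... | inj₁ refl = inj₁ e∈
... | inj₂ refl = inj₂ e∈

-- A repeated edge, in either direction, would have the new target among the nodes already reached.
grow-orient-unique : ∀ {n} {N : Set} {src tgt : Dart n → N} {Ok r R ls} → (∀ d → src (swap d) ≡ tgt d) →
  (∀ d → tgt (swap d) ≡ src d) → Grow src tgt Ok r R ls → Unique (map orient ls)
grow-orient-unique _ _ seed = []
grow-orient-unique {src = src} {tgt} hs ht (grow {R} {ls} {l} g _ _ t∉) = All.tabulate fresh ∷ grow-orient-unique hs ht g
  where
  fresh : ∀ {x} → x ∈ map orient ls → orient l ≢ x
  fresh x∈ refl with orient-∈± {ls = ls} x∈
  ... | inj₁ l∈ = t∉ (proj₂ (grow-ends g l∈))
  ... | inj₂ l∈ = t∉ (subst (_∈ R) (hs l) (proj₁ (grow-ends g l∈)))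

-- Vanishing cohomology of a plane map

module PlaneMap {n : ℕ} (G : Graph n) (σ : Fin n → Fin n → Fin n) (rotation : IsRotationSystem G σ)
  (connected : Connected G) {f : ℕ} (faces : HasCount (IsFace G σ) f) (euler : n + f ≡ 2 + edgeCount G) where

  open RotationSystem G σ rotation
  open import Data.List.Membership.DecPropositional (_≟ᴿ_ {n}) using () renaming (_∈?_ to _∈ᴿ?_)
  open import Data.List.Membership.DecPropositional (_≟ᴰ_ {n}) using () renaming (_∈?_ to _∈ᴰ?_)
  open import Data.List.Membership.DecPropositional (Finᵖ._≟_ {n}) using () renaming (_∈?_ to _∈ⱽ?_)

  _∈±?_ : ∀ d ls → Dec (d ∈± ls)
  d ∈±? ls = (d ∈ᴰ? ls) ⊎-dec (swap d ∈ᴰ? ls)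

  anyDart? : ∀ {P : Dart n → Set} → (∀ d → Dec (P d)) → Dec (∃ P)
  anyDart? P? with Finᵖ.any? (λ u → Finᵖ.any? (λ v → P? (u , v)))
  ... | yes (u , v , p) = yes ((u , v) , p)
  ... | no ¬p = no λ ((u , v) , p) → ¬p (u , v , p)

  DualGrow : Dart n → List (Rel n) → List (Dart n) → Set
  DualGrow d = Grow faceOf (faceOf ∘ swap) AdjDart (faceOf d)

  -- Summed along a face, `δ κ` telescopes to zero. If it is also invariant under `swap`, it is a
  -- cocycle on the edges of `G`.
  δ : (Dart n → Bool) → Dart n → Bool
  δ κ d = κ d xor κ (next-dart d)

  -- Walking around the face added last, κ can only change at the dual tree edge through which it was added.
  peel : ∀ {d₀ R ls} → DualGrow d₀ R ls → (κ : Dart n → Bool) → (∀ {d} → AdjDart d → δ κ (swap d) ≡ δ κ d) →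
    (∀ {d} → AdjDart d → ¬ d ∈± ls → δ κ d ≡ false) → ∀ {d} → AdjDart d → δ κ d ≡ false
  peel seed κ symm off ad = off ad λ { (inj₁ ()) ; (inj₂ ()) }
  peel (grow {R} {ls} {l} g al s∈ t∉) κ symm off = peel g κ symm off′
    where
    e = swap l
    ae : AdjDart e
    ae = E-sym al
    faceOf-x : ∀ {x} → Reach next-dart (next-dart e) x → faceOf x ≡ faceOf e
    faceOf-x r = trans (sym (faceOf-cong (next-adj ae) r)) (sym (faceOf-cong ae (next start)))
    constant : ∀ {x} → Reach next-dart (next-dart e) x → κ x ≡ κ (next-dart e)
    constant start = refl
    constant (next {x} r) with x ≟ᴰ e
    ... | yes refl = refl
    ... | no x≢e = trans (sym (xor-false⇒≡ (off ax outside))) (constant r)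
      where
      ax = reach-closed AdjDart next-adj (next-adj ae) r
      -- Every earlier link of the dual tree joins two faces of `R`, so none of them lies on the new
      -- face.
      F∉R : faceOf x ∉ R
      F∉R F∈R = t∉ (subst (_∈ R) (faceOf-x r) F∈R)
      outside : ¬ x ∈± (l ∷ ls)
      outside (inj₁ (here refl)) = F∉R s∈
      outside (inj₁ (there x∈)) = F∉R (proj₁ (grow-ends g x∈))
      outside (inj₂ (here eq)) = x≢e (cong swap eq)
      outside (inj₂ (there x∈)) = F∉R (proj₂ (grow-ends g x∈))
    at-e : δ κ e ≡ false
    at-e = ≡⇒xor-false (constant (reach-back ae))
    off′ : ∀ {d} → AdjDart d → ¬ d ∈± ls → δ κ d ≡ false
    off′ {d} ad d∉ with d ∈±? (l ∷ ls)
    ... | no d∉′ = off ad d∉′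
    ... | yes (inj₁ (here refl)) = trans (sym (symm al)) at-e
    ... | yes (inj₁ (there d∈)) = contradiction (inj₁ d∈) d∉
    ... | yes (inj₂ (here refl)) = at-e
    ... | yes (inj₂ (there d∈)) = contradiction (inj₂ d∈) d∉

  -- Without a link leaving `R`, the darts on faces of `R` are closed under face steps and reversal,
  -- hence are all darts.
  dual-expand : ∀ {d₀ R ls D} → AdjDart d₀ → DualGrow d₀ R ls → IsFace G σ D → D ∉ R →
    ∃ λ l → AdjDart l × faceOf l ∈ R × faceOf (swap l) ∉ R
  dual-expand {d₀} {R} ad₀ g face D∉ with anyDart? (λ d → (adj G (proj₁ d) (proj₂ d) ≟ᵇ true) ×-dec (faceOf d ∈ᴿ? R) ×-dec ¬? (faceOf (swap d) ∈ᴿ? R))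
  ... | yes found = found
  ... | no none = contradiction (D∈R face) D∉
    where
    closed-rev : ∀ {d} → AdjDart d → faceOf d ∈ R → faceOf (swap d) ∈ R
    closed-rev {d} ad m with faceOf (swap d) ∈ᴿ? R
    ... | yes m′ = m′
    ... | no m∉ = contradiction (d , ad , m , m∉) none
    D∈R : ∀ {D} → IsFace G σ D → D ∈ R
    D∈R face@(d , ad , iff) = subst (_∈ R) (sym (proj₂ (isFace-faceOf face (Equivalence.from (iff d) (0 , refl)))))
      (dart-induction connected (λ d → faceOf d ∈ R) (λ ad → subst (_∈ R) (faceOf-cong ad (next start))) closed-rev
        ad₀ (grow-root g) ad)

  walk-induction : ∀ {A : V → Set} (P : V → Set) → (∀ {u v} → A u → E u v → A v → P u → P v) →
    ∀ {u v} → Walk (adj G) A u v → P u → P v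
  walk-induction P cl (here _) p = p
  walk-induction {A} P cl (step a e w) p = walk-induction P cl w (cl a e (first w) p)
    where
    first : ∀ {u v} → Walk (adj G) A u v → A u
    first (here a) = a
    first (step a _ _) = a

  OffDual : List (Dart n) → Dart n → Set
  OffDual ls d = AdjDart d × ¬ d ∈± ls

  -- Deleting the edges crossed by the dual tree leaves `G` connected. If no allowed link leaves
  -- `R′`, the indicator of `R′` changes only across deleted edges, hence by `peel` across none, and
  -- the connected `G` lies in `R′`.
  primal-expand : ∀ {d₀ R ls v₀ R′ ls′ v} → DualGrow d₀ R ls → Grow proj₁ proj₂ (OffDual ls) v₀ R′ ls′ → v ∉ R′ →
    ∃ λ l → OffDual ls l × proj₁ l ∈ R′ × proj₂ l ∉ R′
  primal-expand {ls = ls} {v₀} {R′} {v = v} dg pg v∉ with anyDart? (λ d → ((adj G (proj₁ d) (proj₂ d) ≟ᵇ true) ×-dec ¬? (d ∈±? ls))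
    ×-dec (proj₁ d ∈ⱽ? R′) ×-dec ¬? (proj₂ d ∈ⱽ? R′))
  ... | yes found = found
  ... | no none = contradiction
      (walk-induction (_∈ R′) (λ {u} {w} _ e _ u∈ → ⌊⌋-true⁻ (w ∈ⱽ? R′)
          (trans (sym (xor-false⇒≡ (peel dg κ symm off e))) (⌊⌋-true (u ∈ⱽ? R′) u∈)))
        (connected v₀ v) (grow-root pg)) v∉
    where
    κ : Dart n → Bool
    κ (u , _) = ⌊ u ∈ⱽ? R′ ⌋
    symm : ∀ {d} → AdjDart d → δ κ (swap d) ≡ δ κ d
    symm {u , v} _ = xor-comm ⌊ v ∈ⱽ? R′ ⌋ ⌊ u ∈ⱽ? R′ ⌋
    leaves : ∀ {u w} → E u w → ¬ (u , w) ∈± ls → u ∈ R′ → w ∈ R′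
    leaves {u} {w} e d∉ u∈ with w ∈ⱽ? R′
    ... | yes w∈ = w∈
    ... | no w∉ = contradiction ((u , w) , (e , d∉) , u∈ , w∉) none
    off : ∀ {d} → AdjDart d → ¬ d ∈± ls → δ κ d ≡ false
    off {u , w} e d∉ = ≡⇒xor-false (⌊⌋-cong (u ∈ⱽ? R′) (w ∈ⱽ? R′) (leaves e d∉)
      (leaves (E-sym e) λ { (inj₁ m) → d∉ (inj₂ m) ; (inj₂ m) → d∉ (inj₁ m) }))

  Oriented : Dart n → Set
  Oriented (u , v) = (adj G u v ∧ (toℕ u <ᵇ toℕ v)) ≡ true

  orient-oriented : ∀ {d} → AdjDart d → Oriented (orient d)
  orient-oriented {u , v} e with toℕ u <ᵇ toℕ v in u<v
  ... | true = cong₂ _∧_ e u<v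
  ... | false = cong₂ _∧_ (E-sym e) (T⇒true (ℕᵖ.<⇒<ᵇ (ℕᵖ.≤∧≢⇒< (ℕᵖ.≮⇒≥ λ lt → subst T u<v (ℕᵖ.<⇒<ᵇ lt))
      (λ eq → E⇒≢ e (sym (toℕ-injective eq))))))
    where
    T⇒true : ∀ {b} → T b → b ≡ true
    T⇒true {true} _ = refl

  -- The cocycle `δ κ` is the coboundary of a vertex function.
  Potential : (Dart n → Bool) → Set
  Potential κ = ∃ λ (g : V → Bool) → ∀ {u v} → E u v → g u xor g v ≡ δ κ (u , v)

  -- A spanning tree of the dual and a spanning tree of G avoiding it together use (f - 1) + (n - 1)
  -- edges, which by Euler's formula is all of them.
  abstract
    potential : ∀ {d₀} → AdjDart d₀ → (κ : Dart n → Bool) → (∀ {d} → AdjDart d → δ κ (swap d) ≡ δ κ d) → Potential κ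
    potential {d₀@(v₀ , _)} ad₀ κ symm = correct
      (grow-exists _≟ᴿ_ (HasCount.unique faces)
        (λ g D∈ → dual-expand ad₀ g (HasCount.sound faces _ D∈)) (f ∸ 1)
        (≤-reflexive (trans (ℕᵖ.m+[n∸m]≡n f≥1) (sym (HasCount.size faces)))))
      where
      nonempty : ∀ {A : Set} {x : A} {xs} → x ∈ xs → 1 ≤ length xs
      nonempty (here _) = s≤s z≤n
      nonempty (there _) = s≤s z≤n
      f≥1 : 1 ≤ f
      f≥1 = ≤-trans (nonempty (HasCount.complete faces (faceOf d₀) (faceOf-isFace ad₀))) (≤-reflexive (HasCount.size faces))
      n≥1 : 1 ≤ n
      n≥1 = ≤-trans (s≤s z≤n) (Finᵖ.toℕ<n v₀)
      edges : HasCount Oriented (edgeCount G)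
      edges = hasCount-countB₂ (λ u v → adj G u v ∧ (toℕ u <ᵇ toℕ v))

      correct : (∃ λ R → ∃ λ ls → DualGrow d₀ R ls × length ls ≡ f ∸ 1) → Potential κ
      correct (R , ls , dg , ls-length) = correct′
        (grow-exists Finᵖ._≟_ (Uniqueᵖ.allFin⁺ n) (λ g _ → primal-expand dg g) (n ∸ 1)
          (≤-reflexive (trans (ℕᵖ.m+[n∸m]≡n n≥1) (sym (length-tabulate id)))))
        where
        correct′ : (∃ λ R′ → ∃ λ ls′ → Grow proj₁ proj₂ (OffDual ls) v₀ R′ ls′ × length ls′ ≡ n ∸ 1) → Potential κ
        correct′ (R′ , ls′ , pg , ls′-length) = g , λ {u} {v} e → sym (xor-false⇒≡ (trans (sym (δκ′ (u , v))) (peel dg κ′ symm′ off e)))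
          where
          g : V → Bool
          g = proj₁ (grow-potential Finᵖ._≟_ pg (δ κ))
          hg : ∀ {l} → l ∈ ls′ → g (proj₁ l) xor g (proj₂ l) ≡ δ κ l
          hg = proj₂ (grow-potential Finᵖ._≟_ pg (δ κ))
          used : List (Dart n)
          used = map orient ls′ ++ map orient ls
          used-unique : Unique used
          used-unique = Uniqueᵖ.++⁺ (grow-orient-unique (λ _ → refl) (λ _ → refl) pg)
            (grow-orient-unique (λ _ → refl) (λ _ → refl) dg)
            λ (p , q) → let (l , l∈ , eq) = ∈-map⁻ orient p
                        in proj₂ (grow-ok pg l∈) (orient-∈± (subst (_∈ map orient ls) eq q))
          used-edges : ∀ {x} → x ∈ used → x ∈ HasCount.elems edges
          used-edges x∈ with ∈-++⁻ (map orient ls′) x∈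
          ... | inj₁ p = let (l , l∈ , eq) = ∈-map⁻ orient p in
            HasCount.complete edges _ (subst Oriented (sym eq) (orient-oriented (proj₁ (grow-ok pg l∈))))
          ... | inj₂ p = let (l , l∈ , eq) = ∈-map⁻ orient p in
            HasCount.complete edges _ (subst Oriented (sym eq) (orient-oriented (grow-ok dg l∈)))
          used-length : length used ≡ (n ∸ 1) + (f ∸ 1)
          used-length = trans (length-++ (map orient ls′)) (cong₂ _+_
            (trans (length-map orient ls′) ls′-length) (trans (length-map orient ls) ls-length))
          euler′ : edgeCount G ≡ (n ∸ 1) + (f ∸ 1)
          euler′ = ℕᵖ.suc-injective (ℕᵖ.suc-injective (trans (sym euler) (sym (trans (sym (+-suc (suc (n ∸ 1)) (f ∸ 1)))
            (cong₂ _+_ (ℕᵖ.m+[n∸m]≡n n≥1) (ℕᵖ.m+[n∸m]≡n f≥1))))))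
          covered : ∀ {d} → AdjDart d → d ∈± ls′ ⊎ d ∈± ls
          covered {d} ad with ∈-++⁻ (map orient ls′) (unique-⊆-full _≟ᴰ_ used-unique used-edges
            (≤-reflexive (trans (HasCount.size edges) (trans euler′ (sym used-length))))
            (HasCount.complete edges _ (orient-oriented ad)))
          ... | inj₁ m = inj₁ (orient-∈± m)
          ... | inj₂ m = inj₂ (orient-∈± m)
          -- Since `g` is fitted to `δ κ` on the tree of `G`, the corrected function has `δ`
          -- supported on the dual tree, where `peel` removes it.
          κ′ : Dart n → Bool
          κ′ (u , v) = κ (u , v) xor g u
          δκ′ : ∀ d → δ κ′ d ≡ δ κ d xor (g (proj₁ d) xor g (proj₂ d))
          δκ′ d@(u , v) = xor-interchange (κ d) (g u) (κ (next-dart d)) (g v)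
          symm′ : ∀ {d} → AdjDart d → δ κ′ (swap d) ≡ δ κ′ d
          symm′ {u , v} ad = trans (δκ′ (v , u)) (trans (cong₂ _xor_ (symm ad) (xor-comm (g v) (g u))) (sym (δκ′ (u , v))))
          off : ∀ {d} → AdjDart d → ¬ d ∈± ls → δ κ′ d ≡ false
          off {d@(u , v)} ad d∉ with covered ad
          ... | inj₁ (inj₁ m) = trans (δκ′ d) (≡⇒xor-false (sym (hg m)))
          ... | inj₁ (inj₂ m) = trans (δκ′ d) (≡⇒xor-false (trans (sym (symm ad)) (trans (sym (hg m)) (xor-comm (g v) (g u)))))
          ... | inj₂ m = contradiction m d∉

  -- If the face passed v twice, the darts at v between the two passages would be the only edges at v
  -- crossed by a potential that is constant on G - v.
  face-simple : TwoConnected G → ∀ {v w₁ w₂} → E w₁ v → E w₂ v → Reach next-dart (w₁ , v) (w₂ , v) → w₁ ≡ w₂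
  face-simple (_ , _ , 2conn) {v} {w₁} {w₂} e₁ e₂ r = conclude
    (arcPotential _≟ᴰ_ next-dart AdjDart next-adj next-injective {w₁ , v} {w₂ , v} e₁ r)
    (arcPotential Finᵖ._≟_ (σ v) (E v) rotate-adj rotate-injective {w₁} {w₂} (E-sym e₁) (rotate-reach (E-sym e₁) (E-sym e₂)))
    where
    conclude : (∃ λ s → ∀ d → AdjDart d → s (next-dart d) xor s d ≡ ⌊ d ≟ᴰ (w₁ , v) ⌋ xor ⌊ d ≟ᴰ (w₂ , v) ⌋) →
      (∃ λ (μ : V → Bool) → ∀ w → E v w → μ (σ v w) xor μ w ≡ ⌊ w Finᵖ.≟ w₁ ⌋ xor ⌊ w Finᵖ.≟ w₂ ⌋) → w₁ ≡ w₂
    conclude (seg , hseg) (μ , hμ) = ⌊⌋-true⁻ (w₁ Finᵖ.≟ w₂) (trans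
        (sym (xor-false⇒≡ (trans (sym (hμ w₁ v~w₁)) (≡⇒xor-false (sym μ-same)))))
        (⌊⌋-true (w₁ Finᵖ.≟ w₁) refl))
      where
      v~w₁ = E-sym e₁
      ι : V → V → Bool
      ι u w = ⌊ u Finᵖ.≟ v ⌋ ∧ μ w
      ι-at : ∀ w → ι v w ≡ μ w
      ι-at w = ∧-trueˡ (μ w) (⌊⌋-true (v Finᵖ.≟ v) refl)
      ι-off : ∀ {u} w → u ≢ v → ι u w ≡ false
      ι-off {u} w u≢v = ∧-falseˡ (μ w) (⌊⌋-false (u Finᵖ.≟ v) u≢v)
      -- `seg` marks the part of the face between the two passages, `μ` the arc of the rotation
      -- between them. Their jumps at darts entering `v` cancel, so that `δ κ` is `μ` on the edges
      -- at `v` and zero elsewhere.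
      κ : Dart n → Bool
      κ (u , w) = seg (u , w) xor ι u w
      entering : ∀ d → ⌊ d ≟ᴰ (w₁ , v) ⌋ xor ⌊ d ≟ᴰ (w₂ , v) ⌋ ≡ ⌊ proj₂ d Finᵖ.≟ v ⌋ ∧ (⌊ proj₁ d Finᵖ.≟ w₁ ⌋ xor ⌊ proj₁ d Finᵖ.≟ w₂ ⌋)
      entering (u , w) with w Finᵖ.≟ v
      ... | yes refl = cong₂ _xor_ (⌊⌋-cong ((u , w) ≟ᴰ (w₁ , w)) (u Finᵖ.≟ w₁) (cong proj₁) (cong (_, w)))
        (⌊⌋-cong ((u , w) ≟ᴰ (w₂ , w)) (u Finᵖ.≟ w₂) (cong proj₁) (cong (_, w)))
      ... | no w≢v = cong₂ _xor_ (⌊⌋-false ((u , w) ≟ᴰ (w₁ , v)) (w≢v ∘ cong proj₂)) (⌊⌋-false ((u , w) ≟ᴰ (w₂ , v)) (w≢v ∘ cong proj₂))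
      δκ : ∀ {u w} → E u w → δ κ (u , w) ≡ (⌊ w Finᵖ.≟ v ⌋ ∧ (⌊ u Finᵖ.≟ w₁ ⌋ xor ⌊ u Finᵖ.≟ w₂ ⌋)) xor (ι u w xor ι w (σ w u))
      δκ {u} {w} e = trans
        (xor-interchange (seg (u , w)) (ι u w) (seg (w , σ w u)) (ι w (σ w u)))
        (cong (_xor (ι u w xor ι w (σ w u))) (trans (xor-comm (seg (u , w)) (seg (w , σ w u))) (trans (hseg (u , w) e) (entering (u , w)))))
      source : V → Bool
      source u = ⌊ u Finᵖ.≟ w₁ ⌋ xor ⌊ u Finᵖ.≟ w₂ ⌋
      leaving : ∀ {w} → E v w → δ κ (v , w) ≡ μ w
      leaving {w} e = begin
        δ κ (v , w) ≡⟨ δκ e ⟩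
        (⌊ w Finᵖ.≟ v ⌋ ∧ source v) xor (ι v w xor ι w (σ w v))
          ≡⟨ xor-cong (⌊ w Finᵖ.≟ v ⌋ ∧ source v) (ι v w xor ι w (σ w v)) false (μ w xor false)
               (∧-falseˡ (source v) (⌊⌋-false (w Finᵖ.≟ v) w≢v))
               (xor-cong (ι v w) (ι w (σ w v)) (μ w) false (ι-at w) (ι-off (σ w v) w≢v)) ⟩
        μ w xor false ≡⟨ xor-identityʳ (μ w) ⟩
        μ w ∎
        where
        open ≡-Reasoning
        w≢v : w ≢ v
        w≢v = E⇒≢ (E-sym e)
      arriving : ∀ {u} → E u v → δ κ (u , v) ≡ μ u
      arriving {u} e = begin
        δ κ (u , v) ≡⟨ δκ e ⟩
        (⌊ v Finᵖ.≟ v ⌋ ∧ source u) xor (ι u v xor ι v (σ v u))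
          ≡⟨ xor-cong (⌊ v Finᵖ.≟ v ⌋ ∧ source u) (ι u v xor ι v (σ v u)) (μ (σ v u) xor μ u) (false xor μ (σ v u))
               (trans (∧-trueˡ (source u) (⌊⌋-true (v Finᵖ.≟ v) refl)) (sym (hμ u (E-sym e))))
               (xor-cong (ι u v) (ι v (σ v u)) false (μ (σ v u)) (ι-off v (E⇒≢ e)) (ι-at (σ v u))) ⟩
        (μ (σ v u) xor μ u) xor μ (σ v u) ≡⟨ xor-comm (μ (σ v u) xor μ u) (μ (σ v u)) ⟩
        μ (σ v u) xor (μ (σ v u) xor μ u) ≡⟨ xor-cancelˡ (μ (σ v u)) (μ u) ⟩
        μ u ∎
        where open ≡-Reasoning
      elsewhere : ∀ {u w} → E u w → u ≢ v → w ≢ v → δ κ (u , w) ≡ false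
      elsewhere {u} {w} e u≢v w≢v = trans (δκ e)
        (xor-cong (⌊ w Finᵖ.≟ v ⌋ ∧ source u) (ι u w xor ι w (σ w u)) false false
          (∧-falseˡ (source u) (⌊⌋-false (w Finᵖ.≟ v) w≢v))
          (xor-cong (ι u w) (ι w (σ w u)) false false (ι-off w u≢v) (ι-off (σ w u) w≢v)))
      symm : ∀ {d} → AdjDart d → δ κ (swap d) ≡ δ κ d
      symm {u , w} e = compare (u Finᵖ.≟ v) (w Finᵖ.≟ v)
        where
        compare : Dec (u ≡ v) → Dec (w ≡ v) → δ κ (w , u) ≡ δ κ (u , w)
        compare (yes refl) _ = trans (arriving (E-sym e)) (sym (leaving e))
        compare (no _) (yes refl) = trans (leaving (E-sym e)) (sym (arriving e))
        compare (no u≢v) (no w≢v) = trans (elsewhere (E-sym e) w≢v u≢v) (sym (elsewhere e u≢v w≢v))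
      -- The potential is constant on the connected graph `G - v`, hence `μ` is constant on the
      -- neighbours of `v`; but it jumps after `w₁` if `w₁` and `w₂` differ.
      μ-same : μ w₁ ≡ μ (σ v w₁)
      μ-same = separate (potential e₁ κ symm)
        where
        separate : (∃ λ (g : V → Bool) → ∀ {u w} → E u w → g u xor g w ≡ δ κ (u , w)) → μ w₁ ≡ μ (σ v w₁)
        separate (g , hg) = trans (sym (at v~w₁)) (trans (cong (g v xor_) constant) (at (rotate-adj v~w₁)))
          where
          at : ∀ {w} → E v w → g v xor g w ≡ μ w
          at e = trans (hg e) (leaving e)
          constant : g w₁ ≡ g (σ v w₁)
          constant = sym (walk-induction (λ u → g u ≡ g w₁)
            (λ u≢v e w≢v eq → trans (sym (xor-false⇒≡ (trans (hg e) (elsewhere e u≢v w≢v)))) eq)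
            (2conn v w₁ (σ v w₁) (E⇒≢ e₁) (≢-sym (E⇒≢ (rotate-adj v~w₁)))) refl)

  -- H₁ = 0: a symmetric edge set C that is a coboundary around every vertex bounds a set φ of faces.
  fill : ∀ {d₀} → AdjDart d₀ → (C : V → V → Bool) → (∀ u v → C u v ≡ C v u) → (κ : Dart n → Bool) →
    (∀ {v w} → E v w → κ (v , σ v w) ≡ κ (v , w) xor C v w) →
    ∃ λ (φ : Dart n → Bool) → (∀ {d} → AdjDart d → φ (next-dart d) ≡ φ d) × (∀ {u v} → E u v → φ (u , v) xor φ (v , u) ≡ C u v)
  fill ad₀ C C-sym κ hκ = φ , (λ {d} → φ-next d) , φ-flip
    where
    open ≡-Reasoning
    δκ : ∀ {u v} → E u v → δ κ (u , v) ≡ κ (u , v) xor (κ (v , u) xor C u v)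
    δκ {u} {v} e = cong (κ (u , v) xor_) (trans (hκ (E-sym e)) (cong (κ (v , u) xor_) (C-sym v u)))
    shuffle : ∀ a b c → b xor (a xor c) ≡ a xor (b xor c)
    shuffle = solve 3 (λ a b c → b :+ (a :+ c) := a :+ (b :+ c)) refl
    symm : ∀ {d} → AdjDart d → δ κ (swap d) ≡ δ κ d
    symm {u , v} e = begin
      δ κ (v , u) ≡⟨ δκ (E-sym e) ⟩
      κ (v , u) xor (κ (u , v) xor C v u) ≡⟨ shuffle (κ (u , v)) (κ (v , u)) (C v u) ⟩
      κ (u , v) xor (κ (v , u) xor C v u) ≡⟨ cong (λ c → κ (u , v) xor (κ (v , u) xor c)) (C-sym v u) ⟩
      κ (u , v) xor (κ (v , u) xor C u v) ≡⟨ δκ e ⟨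
      δ κ (u , v) ∎
    g : V → Bool
    g = proj₁ (potential ad₀ κ symm)
    hg : ∀ {u v} → E u v → g u xor g v ≡ δ κ (u , v)
    hg = proj₂ (potential ad₀ κ symm)
    -- Adding the potential makes `κ` constant along faces without changing how it varies around a
    -- vertex.
    φ : Dart n → Bool
    φ (u , v) = κ (u , v) xor g u
    φ-next : ∀ d → AdjDart d → φ (next-dart d) ≡ φ d
    φ-next (u , v) e = sym (xor-false⇒≡ (trans (xor-interchange (κ (u , v)) (g u) (κ (v , σ v u)) (g v)) (≡⇒xor-false (sym (hg e)))))
    φ-flip : ∀ {u v} → E u v → φ (u , v) xor φ (v , u) ≡ C u v
    φ-flip {u} {v} e = begin
      φ (u , v) xor φ (v , u) ≡⟨ xor-interchange (κ (u , v)) (g u) (κ (v , u)) (g v) ⟩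
      (κ (u , v) xor κ (v , u)) xor (g u xor g v) ≡⟨ cong ((κ (u , v) xor κ (v , u)) xor_) (trans (hg e) (δκ e)) ⟩
      (κ (u , v) xor κ (v , u)) xor (κ (u , v) xor (κ (v , u) xor C u v)) ≡⟨ cancel (κ (u , v)) (κ (v , u)) (C u v) ⟩
      C u v ∎
      where
      cancel : ∀ a b c → (a xor b) xor (a xor (b xor c)) ≡ c
      cancel = solve 3 (λ a b c → (a :+ b) :+ (a :+ (b :+ c)) := c) refl

  -- The Hamiltonian outer cycle

  module OuterFace (2conn : TwoConnected G) (Fout : Rel n) (isFace : IsFace G σ Fout) (spanning : AllVerticesOn Fout) where

    Outer : V → V → Set
    Outer u v = Fout ∋⟨ u , v ⟩ ≡ true

    succ : V → V
    succ v = proj₁ (spanning v)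

    outer-succ : ∀ v → Outer v (succ v)
    outer-succ v = proj₂ (spanning v)

    outer-face : ∀ {u v} → Outer u v → E u v × Fout ≡ faceOf (u , v)
    outer-face {u} {v} = isFace-faceOf {Fout} {u} {v} isFace

    outer⇒E : ∀ {u v} → Outer u v → E u v
    outer⇒E {u} {v} o = proj₁ (outer-face {u} {v} o)

    outer-reach : ∀ {u v u′ v′} → Outer u v → Outer u′ v′ → Reach next-dart (u , v) (u′ , v′)
    outer-reach {u} {v} {u′} {v′} o o′ = ∈-faceOf⁻ {u , v} {u′} {v′}
      (subst (λ S → S ∋⟨ u′ , v′ ⟩ ≡ true) (proj₂ (outer-face {u} {v} o)) o′)

    reach-outer : ∀ {u v u′ v′} → Outer u v → Reach next-dart (u , v) (u′ , v′) → Outer u′ v′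
    reach-outer {u} {v} {u′} {v′} o r = subst (λ S → S ∋⟨ u′ , v′ ⟩ ≡ true) (sym (proj₂ (outer-face {u} {v} o)))
      (∈-faceOf⁺ {u , v} {u′} {v′} (outer⇒E {u} {v} o) r)

    abstract
      outer-previous : ∀ {v w} → Outer v w → ∃ λ u → Outer u v × σ v u ≡ w
      outer-previous {v} {w} o = last-step (reach-back (outer⇒E o)) refl
        where
        last-step : ∀ {d} → Reach next-dart (next-dart (v , w)) d → d ≡ (v , w) → ∃ λ u → Outer u v × σ v u ≡ w
        last-step start eq = contradiction (sym (cong proj₁ eq)) (E⇒≢ (outer⇒E o))
        last-step (next {u , _} r) refl = u , reach-outer o (reach-trans (next start) r) , refl

    -- By `face-simple` the outer face enters `v` by one dart only, and the rotation determines the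
    -- dart that follows.
    outer-target-unique : ∀ {v w w′} → Outer v w → Outer v w′ → w ≡ w′
    outer-target-unique {v} o o′ with outer-previous o | outer-previous o′
    ... | u , p , refl | u′ , p′ , refl = cong (σ v) (face-simple 2conn (outer⇒E p) (outer⇒E p′) (outer-reach p p′))

    outer⇒succ : ∀ {v w} → Outer v w → w ≡ succ v
    outer⇒succ o = outer-target-unique o (outer-succ _)

    succ-injective : ∀ {u v} → succ u ≡ succ v → u ≡ v
    succ-injective {u} {v} eq = face-simple 2conn (outer⇒E o) (outer⇒E (outer-succ v)) (outer-reach o (outer-succ v))
      where
      o : Outer u (succ v)
      o = subst (Outer u) eq (outer-succ u)

    pred : V → V
    pred v = proj₁ (outer-previous (outer-succ v))

    outer-pred : ∀ v → Outer (pred v) v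
    outer-pred v = proj₁ (proj₂ (outer-previous (outer-succ v)))

    rotate-pred : ∀ v → σ v (pred v) ≡ succ v
    rotate-pred v = proj₂ (proj₂ (outer-previous (outer-succ v)))

    succ-pred : ∀ v → succ (pred v) ≡ v
    succ-pred v = sym (outer⇒succ (outer-pred v))

    first : V
    first = fromℕ< (≤-trans (s≤s z≤n) (proj₁ 2conn))

    at : ℕ → V
    at zero = first
    at (suc i) = succ (at i)

    at-onto : ∀ v → ∃ λ i → at i ≡ v
    at-onto v = proj₁ (index (outer-reach (outer-succ first) (outer-succ v)))
      where
      index : ∀ {u w} → Reach next-dart (first , succ first) (u , w) → (∃ λ i → at i ≡ u) × w ≡ succ u
      index start = (0 , refl) , refl
      index (next r) with index r
      ... | (i , refl) , refl = (suc i , refl) , outer⇒succ (reach-outer (outer-succ first) (next r))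

    abstract
      pos : V → ℕ
      pos v = proj₁ (least (λ i → at i Finᵖ.≟ v) (at-onto v))

      at-pos : ∀ v → at (pos v) ≡ v
      at-pos v = proj₁ (proj₂ (least (λ i → at i Finᵖ.≟ v) (at-onto v)))

      pos-least : ∀ i → pos (at i) ≤ i
      pos-least i = proj₂ (proj₂ (least (λ j → at j Finᵖ.≟ at i) (at-onto (at i)))) i refl

    pos-injective : ∀ {u v} → pos u ≡ pos v → u ≡ v
    pos-injective {u} {v} eq = trans (sym (at-pos u)) (trans (cong at eq) (at-pos v))

    pos-first : pos first ≡ 0
    pos-first = ℕᵖ.n≤0⇒n≡0 (pos-least 0)

    pos-succ-≤ : ∀ v → pos (succ v) ≤ suc (pos v)
    pos-succ-≤ v = subst (λ u → pos (succ u) ≤ suc (pos v)) (at-pos v) (pos-least (suc (pos v)))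

    pos-succ : ∀ v → succ v ≢ first → pos (succ v) ≡ suc (pos v)
    pos-succ v ≢first = ≤-antisym (pos-succ-≤ v) (above (pos (succ v)) (at-pos (succ v)))
      where
      above : ∀ j → at j ≡ succ v → suc (pos v) ≤ j
      above zero eq = contradiction (sym eq) ≢first
      above (suc j) eq = s≤s (subst (λ u → pos u ≤ j) (succ-injective eq) (pos-least j))

    pos-pred : ∀ v → v ≢ first → pos v ≡ suc (pos (pred v))
    pos-pred v v≢first = trans (cong pos (sym (succ-pred v))) (pos-succ (pred v) (v≢first ∘ trans (sym (succ-pred v))))

    final : V
    final = pred first

    succ-final : succ final ≡ first
    succ-final = succ-pred first

    -- The walk `at` has period `suc (pos final)`, so a larger position could be lowered by one
    -- period, against minimality.
    pos-≤-final : ∀ v → pos v ≤ pos final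
    pos-≤-final v = ℕᵖ.≮⇒≥ beyond
      where
      periodic : ∀ k → at (k + suc (pos final)) ≡ at k
      periodic zero = trans (cong succ (at-pos final)) succ-final
      periodic (suc k) = cong succ (periodic k)
      beyond : ¬ pos final < pos v
      beyond lt = ℕᵖ.<⇒≱ (ℕᵖ.m<m+n k (s≤s z≤n))
        (subst (_≤ k) (trans (cong pos (trans (sym (periodic k)) (trans (cong at k+p) (at-pos v)))) (sym k+p)) (pos-least k))
        where
        k = pos v ∸ suc (pos final)
        k+p : k + suc (pos final) ≡ pos v
        k+p = ℕᵖ.m∸n+n≡m lt

    pos<⇒≢first : ∀ {u v} → pos u < pos v → v ≢ first
    pos<⇒≢first u<v refl = contradiction (subst (pos _ <_) pos-first u<v) λ ()

    pos<⇒succ≢first : ∀ {u v} → pos u < pos v → succ u ≢ first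
    pos<⇒succ≢first {u} {v} u<v eq = contradiction (subst (λ w → pos w < pos v) (succ-injective (trans eq (sym succ-final))) u<v)
      (ℕᵖ.≤⇒≯ (pos-≤-final v))

    consecutive⇒succ : ∀ {u v} → pos v ≡ suc (pos u) → v ≡ succ u
    consecutive⇒succ {u} {v} eq = pos-injective (trans eq (sym (pos-succ u (pos<⇒succ≢first (≤-reflexive (sym eq))))))

    -- Inside and outside of a chord

    open Order G pos
    open Paths G pos pos-injective

    -- The edge set of the cycle formed by the edge ab and the outer path from a to b.
    OnCut : V → V → V → V → Set
    OnCut a b u v = (PathStep u v ⊎ PathStep v u) ⊎ ((u ≡ a × v ≡ b) ⊎ (u ≡ b × v ≡ a))
      where
      PathStep : V → V → Set
      PathStep u v = pos a ≤ pos u × pos v ≡ suc (pos u) × pos v ≤ pos b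

    onCut? : ∀ a b u v → Dec (OnCut a b u v)
    onCut? a b u v = (pathStep? u v ⊎-dec pathStep? v u) ⊎-dec
      (((u Finᵖ.≟ a) ×-dec (v Finᵖ.≟ b)) ⊎-dec ((u Finᵖ.≟ b) ×-dec (v Finᵖ.≟ a)))
      where
      pathStep? : ∀ u v → Dec (pos a ≤ pos u × pos v ≡ suc (pos u) × pos v ≤ pos b)
      pathStep? u v = (pos a ≤? pos u) ×-dec (pos v ℕᵖ.≟ suc (pos u)) ×-dec (pos v ≤? pos b)

    onCut-sym : ∀ {a b u v} → OnCut a b u v → OnCut a b v u
    onCut-sym (inj₁ (inj₁ s)) = inj₁ (inj₂ s)
    onCut-sym (inj₁ (inj₂ s)) = inj₁ (inj₁ s)
    onCut-sym (inj₂ (inj₁ (p , q))) = inj₂ (inj₂ (q , p))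
    onCut-sym (inj₂ (inj₂ (p , q))) = inj₂ (inj₁ (q , p))

    -- `φ` is the indicator of the inside of the closed curve `OnCut`, as a function on faces: it
    -- flips exactly across the curve and is false on the outer face.
    record Cut (a b : V) : Set where
      field
        φ : Dart n → Bool
        φ-next : ∀ {u v} → E u v → φ (v , σ v u) ≡ φ (u , v)
        φ-outer : ∀ {u v} → Outer u v → φ (u , v) ≡ false
        φ-on : ∀ {u v} → E u v → OnCut a b u v → φ (u , v) ≡ not (φ (v , u))
        φ-off : ∀ {u v} → E u v → ¬ OnCut a b u v → φ (u , v) ≡ φ (v , u)

    rotate-to-succ : ∀ {v w} → E v w → σ v w ≡ succ v → w ≡ pred v
    rotate-to-succ {v} e eq = rotate-injective e (E-sym (outer⇒E (outer-pred v))) (trans eq (sym (rotate-pred v)))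

    abstract
      -- At each vertex of the curve its two edges divide the rotation into arcs, and `κ` marks one
      -- of them. At vertices between `a` and `b` the two edges are consecutive, so the arc is the
      -- single dart to `succ v`; off the curve it is empty. `fill` does the rest.
      cut : ∀ {a b} → E a b → suc (pos a) < pos b → Cut a b
      cut {a} {b} a~b long = assemble
          (arcPotential Finᵖ._≟_ (σ a) (E a) rotate-adj rotate-injective {succ a} {b} (outer⇒E (outer-succ a))
            (rotate-reach (outer⇒E (outer-succ a)) a~b))
          (arcPotential Finᵖ._≟_ (σ b) (E b) rotate-adj rotate-injective {pred b} {a} b~pred (rotate-reach b~pred (E-sym a~b)))
        where
        a<b : pos a < pos b
        a<b = <-trans ≤-refl long
        b~pred : E b (pred b)
        b~pred = E-sym (outer⇒E (outer-pred b))
        pos-succ-a : pos (succ a) ≡ suc (pos a)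
        pos-succ-a = pos-succ a (pos<⇒succ≢first a<b)
        pos-pred-b : pos b ≡ suc (pos (pred b))
        pos-pred-b = pos-pred b (pos<⇒≢first a<b)
        C : V → V → Bool
        C u v = ⌊ onCut? a b u v ⌋
        C-xor : ∀ {u v} {P Q : Set} (P? : Dec P) (Q? : Dec Q) → (OnCut a b u v → P ⊎ Q) → (P → OnCut a b u v) → (Q → OnCut a b u v) →
          (P → ¬ Q) → C u v ≡ ⌊ P? ⌋ xor ⌊ Q? ⌋
        C-xor {u} {v} (yes p) (yes q) f g h disj = contradiction q (disj p)
        C-xor {u} {v} (yes p) (no ¬q) f g h disj = ⌊⌋-true (onCut? a b u v) (g p)
        C-xor {u} {v} (no ¬p) (yes q) f g h disj = ⌊⌋-true (onCut? a b u v) (h q)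
        C-xor {u} {v} (no ¬p) (no ¬q) f g h disj = ⌊⌋-false (onCut? a b u v) ([ ¬p , ¬q ]′ ∘ f)

        C-a : ∀ w → C a w ≡ ⌊ w Finᵖ.≟ succ a ⌋ xor ⌊ w Finᵖ.≟ b ⌋
        C-a w = C-xor {a} {w} (w Finᵖ.≟ succ a) (w Finᵖ.≟ b) to
          (λ { refl → inj₁ (inj₁ (≤-refl , pos-succ-a , ≤-trans (≤-reflexive pos-succ-a) a<b)) })
          (λ { refl → inj₂ (inj₁ (refl , refl)) }) (λ { refl eq → ℕᵖ.<⇒≢ long (trans (sym pos-succ-a) (cong pos eq)) })
          where
          to : OnCut a b a w → w ≡ succ a ⊎ w ≡ b
          to (inj₁ (inj₁ (_ , eq , _))) = inj₁ (consecutive⇒succ eq)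
          to (inj₁ (inj₂ (le , eq , _))) = contradiction le (ℕᵖ.<⇒≱ (≤-reflexive (sym eq)))
          to (inj₂ (inj₁ (_ , eq))) = inj₂ eq
          to (inj₂ (inj₂ (refl , _))) = contradiction a<b (<-irrefl refl)

        pred-step : ∀ {v w} → pos v ≡ suc (pos w) → w ≡ pred v
        pred-step {v} {w} eq = succ-injective (trans (sym (consecutive⇒succ eq)) (sym (succ-pred v)))

        C-b : ∀ w → C b w ≡ ⌊ w Finᵖ.≟ pred b ⌋ xor ⌊ w Finᵖ.≟ a ⌋
        C-b w = C-xor {b} {w} (w Finᵖ.≟ pred b) (w Finᵖ.≟ a) to
          (λ { refl → inj₁ (inj₂ (s≤s⁻¹ (≤-trans a<b (≤-reflexive pos-pred-b)) , pos-pred-b , ≤-refl)) })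
          (λ { refl → inj₂ (inj₂ (refl , refl)) })
          (λ { refl eq → ℕᵖ.<⇒≢ long (sym (trans pos-pred-b (cong (suc ∘ pos) eq))) })
          where
          to : OnCut a b b w → w ≡ pred b ⊎ w ≡ a
          to (inj₁ (inj₁ (_ , eq , le))) = contradiction le (ℕᵖ.<⇒≱ (≤-reflexive (sym eq)))
          to (inj₁ (inj₂ (_ , eq , _))) = inj₁ (pred-step eq)
          to (inj₂ (inj₁ (refl , _))) = contradiction a<b (<-irrefl refl)
          to (inj₂ (inj₂ (_ , eq))) = inj₂ eq

        C-inside : ∀ {v} → pos a < pos v → pos v < pos b → ∀ w → C v w ≡ ⌊ w Finᵖ.≟ succ v ⌋ xor ⌊ w Finᵖ.≟ pred v ⌋
        C-inside {v} a<v v<b w = C-xor {v} {w} (w Finᵖ.≟ succ v) (w Finᵖ.≟ pred v) to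
          (λ { refl → inj₁ (inj₁ (<⇒≤ a<v , pos-succ-v , ≤-trans (≤-reflexive pos-succ-v) v<b)) })
          (λ { refl → inj₁ (inj₂ (s≤s⁻¹ (≤-trans a<v (≤-reflexive pos-pred-v)) , pos-pred-v , <⇒≤ v<b)) })
          (λ { refl eq → ℕᵖ.<⇒≢ (≤-trans (ℕᵖ.n≤1+n _) (≤-reflexive (cong suc (sym pos-succ-v)))) (trans pos-pred-v (cong (suc ∘ pos) (sym eq))) })
          where
          pos-succ-v : pos (succ v) ≡ suc (pos v)
          pos-succ-v = pos-succ v (pos<⇒succ≢first v<b)
          pos-pred-v : pos v ≡ suc (pos (pred v))
          pos-pred-v = pos-pred v (pos<⇒≢first a<v)
          to : OnCut a b v w → w ≡ succ v ⊎ w ≡ pred v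
          to (inj₁ (inj₁ (_ , eq , _))) = inj₁ (consecutive⇒succ eq)
          to (inj₁ (inj₂ (_ , eq , _))) = inj₂ (pred-step eq)
          to (inj₂ (inj₁ (refl , _))) = contradiction a<v (<-irrefl refl)
          to (inj₂ (inj₂ (refl , _))) = contradiction v<b (<-irrefl refl)

        Inside : V → Set
        Inside v = pos a < pos v × pos v < pos b
        inside? : ∀ v → Dec (Inside v)
        inside? v = (pos a <? pos v) ×-dec (pos v <? pos b)

        C-outside : ∀ {v} w → v ≢ a → v ≢ b → ¬ Inside v → C v w ≡ false
        C-outside {v} w v≢a v≢b out = ⌊⌋-false (onCut? a b v w) no-step
          where
          no-step : ¬ OnCut a b v w
          no-step (inj₁ (inj₁ (a≤v , eq , w≤b))) = out (ℕᵖ.≤∧≢⇒< a≤v (v≢a ∘ sym ∘ pos-injective) , ≤-trans (≤-reflexive (sym eq)) w≤b)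
          no-step (inj₁ (inj₂ (a≤w , eq , v≤b))) = out (≤-trans (s≤s a≤w) (≤-reflexive (sym eq)) , ℕᵖ.≤∧≢⇒< v≤b (v≢b ∘ pos-injective))
          no-step (inj₂ (inj₁ (eq , _))) = v≢a eq
          no-step (inj₂ (inj₂ (eq , _))) = v≢b eq

        assemble : (∃ λ (μ : V → Bool) → ∀ w → E a w → μ (σ a w) xor μ w ≡ ⌊ w Finᵖ.≟ succ a ⌋ xor ⌊ w Finᵖ.≟ b ⌋) →
          (∃ λ (μ : V → Bool) → ∀ w → E b w → μ (σ b w) xor μ w ≡ ⌊ w Finᵖ.≟ pred b ⌋ xor ⌊ w Finᵖ.≟ a ⌋) → Cut a b
        assemble (μa , hμa) (μb , hμb) = normalise (fill {first , succ first} first~ C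
            (λ u v → ⌊⌋-cong (onCut? a b u v) (onCut? a b v u) onCut-sym onCut-sym) κ (λ {v} {w} → hκ v w))
          where
          first~ : E first (succ first)
          first~ = outer⇒E (outer-succ first)
          select : ∀ {v} → Dec (v ≡ a) → Dec (v ≡ b) → Dec (Inside v) → V → Bool
          select (yes _) _ _ w = μa w
          select (no _) (yes _) _ w = μb w
          select {v} (no _) (no _) (yes _) w = ⌊ w Finᵖ.≟ succ v ⌋
          select (no _) (no _) (no _) w = false
          κ : Dart n → Bool
          κ (v , w) = select (v Finᵖ.≟ a) (v Finᵖ.≟ b) (inside? v) w
          xor-solve : ∀ x y z → x xor y ≡ z → x ≡ y xor z
          xor-solve x y _ refl = sym (trans (cong (y xor_) (xor-comm x y)) (xor-cancelˡ y x))
          hκ : ∀ v w → E v w → κ (v , σ v w) ≡ κ (v , w) xor C v w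
          hκ v w e = cases (v Finᵖ.≟ a) (v Finᵖ.≟ b) (inside? v)
            where
            cases : ∀ p q r → select p q r (σ v w) ≡ select {v} p q r w xor C v w
            cases (yes refl) _ _ = xor-solve (μa (σ a w)) (μa w) (C a w) (trans (hμa w e) (sym (C-a w)))
            cases (no _) (yes refl) _ = xor-solve (μb (σ b w)) (μb w) (C b w) (trans (hμb w e) (sym (C-b w)))
            cases (no _) (no _) (yes (a<v , v<b)) = trans
              (⌊⌋-cong (σ v w Finᵖ.≟ succ v) (w Finᵖ.≟ pred v) (rotate-to-succ e) (λ { refl → rotate-pred v }))
              (trans (sym (xor-cancelˡ ⌊ w Finᵖ.≟ succ v ⌋ ⌊ w Finᵖ.≟ pred v ⌋)) (cong (⌊ w Finᵖ.≟ succ v ⌋ xor_) (sym (C-inside a<v v<b w))))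
            cases (no v≢a) (no v≢b) (no out) = sym (C-outside w v≢a v≢b out)
          normalise : (∃ λ (φ : Dart n → Bool) → (∀ {d} → AdjDart d → φ (next-dart d) ≡ φ d) ×
            (∀ {u v} → E u v → φ (u , v) xor φ (v , u) ≡ C u v)) → Cut a b
          normalise (φ , φ-next , φ-flip) = record
            -- `fill` does not fix the value on the outer face; adding `base` makes it false there.
            { φ = λ d → φ d xor base
            ; φ-next = λ {u} {v} e → cong (_xor base) (φ-next {u , v} e)
            ; φ-outer = λ {u} {v} o → ≡⇒xor-false (proj₂ (reach-closed (λ d → AdjDart d × φ d ≡ base)
                (λ {d} (ad , eq) → next-adj ad , trans (φ-next {d} ad) eq) (first~ , refl) (outer-reach (outer-succ first) o)))
            ; φ-on = λ {u} {v} e c → on (φ (u , v)) (φ (v , u)) base (trans (φ-flip e) (⌊⌋-true (onCut? a b u v) c))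
            ; φ-off = λ {u} {v} e ¬c → cong (_xor base) (xor-false⇒≡ {φ (u , v)} {φ (v , u)} (trans (φ-flip e) (⌊⌋-false (onCut? a b u v) ¬c)))
            }
            where
            base : Bool
            base = φ (first , succ first)
            on : ∀ x y z → x xor y ≡ true → x xor z ≡ not (y xor z)
            on true false true _ = refl
            on true false false _ = refl
            on false true true _ = refl
            on false true false _ = refl

    absurd : ∀ {A : Set} {b} → b ≡ true → b ≡ false → A
    absurd refl ()

    E-pred : ∀ v → E v (pred v)
    E-pred v = E-sym (outer⇒E (outer-pred v))

    E-succ : ∀ v → E v (succ v)
    E-succ v = outer⇒E (outer-succ v)

    rotate-fixed : ∀ {v w u} → E v w → σ v w ≡ w → E v u → u ≡ w
    rotate-fixed {v} {w} e fix e′ = reach-closed (_≡ w) (λ { refl → fix }) refl (rotate-reach e e′)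

    module CutFacts {a b : V} (a~b : E a b) (long : suc (pos a) < pos b) where

      open Cut (cut a~b long) public

      a<b : pos a < pos b
      a<b = <-trans ≤-refl long

      -- Turning about `v` from the outer dart to `succ v`, the first step crosses the curve. The
      -- curve is met again only at `pred v`, from where the rotation is back at `succ v`.
      out-inside : ∀ {v w} → pos a < pos v → pos v < pos b → E v w → w ≢ succ v → φ (v , w) ≡ true
      out-inside {v} {w} a<v v<b e w≢ = [ (λ eq → contradiction eq w≢) , id ]′ (proj₂ (reach-closed Swept rotate-on
          (E-succ v , inj₁ refl) (rotate-reach (E-succ v) e)))
        where
        Swept : V → Set
        Swept y = E v y × (y ≡ succ v ⊎ φ (v , y) ≡ true)
        on-succ : OnCut a b v (succ v)
        on-succ = inj₁ (inj₁ (<⇒≤ a<v , eq , ≤-trans (≤-reflexive eq) v<b))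
          where eq = pos-succ v (pos<⇒succ≢first v<b)
        onCut⇒ : ∀ {y} → OnCut a b v y → y ≡ succ v ⊎ y ≡ pred v
        onCut⇒ (inj₁ (inj₁ (_ , eq , _))) = inj₁ (consecutive⇒succ eq)
        onCut⇒ {y} (inj₁ (inj₂ (_ , eq , _))) = inj₂ (succ-injective (trans (sym (consecutive⇒succ eq)) (sym (succ-pred v))))
        onCut⇒ (inj₂ (inj₁ (refl , _))) = contradiction a<v (<-irrefl refl)
        onCut⇒ (inj₂ (inj₂ (refl , _))) = contradiction v<b (<-irrefl refl)
        rotate-on : ∀ {y} → Swept y → Swept (σ v y)
        rotate-on {y} (e , inj₁ refl) = rotate-adj e , inj₂ (trans (φ-next (E-sym e))
          (trans (φ-on (E-sym e) (onCut-sym on-succ)) (cong not (φ-outer (outer-succ v)))))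
        rotate-on {y} (e , inj₂ t) with onCut? a b v y
        ... | no off = rotate-adj e , inj₂ (trans (φ-next (E-sym e)) (trans (sym (φ-off e off)) t))
        ... | yes on with onCut⇒ on
        ... | inj₁ refl = absurd t (φ-outer (outer-succ v))
        ... | inj₂ refl = rotate-adj e , inj₁ (rotate-pred v)

      in-inside : ∀ {v w} → pos a < pos v → pos v < pos b → E w v → w ≢ pred v → φ (w , v) ≡ true
      in-inside {v} {w} a<v v<b e w≢ = trans (sym (φ-next e))
        (out-inside a<v v<b (rotate-adj (E-sym e)) (w≢ ∘ rotate-to-succ (E-sym e)))

      Outside : V → Set
      Outside v = pos v < pos a ⊎ pos b < pos v

      out-outside : ∀ {v w} → Outside v → E v w → φ (v , w) ≡ false
      out-outside {v} {w} out e = proj₂ (reach-closed (λ y → E v y × φ (v , y) ≡ false)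
          (λ {y} (e , t) → rotate-adj e , trans (φ-next (E-sym e)) (trans (sym (φ-off e (off-cut out))) t))
          (E-succ v , φ-outer (outer-succ v)) (rotate-reach (E-succ v) e))
        where
        off-cut : ∀ {y} → Outside v → ¬ OnCut a b v y
        off-cut (inj₁ v<a) (inj₁ (inj₁ (le , _ , _))) = ℕᵖ.<⇒≱ v<a le
        off-cut (inj₁ v<a) (inj₁ (inj₂ (le , eq , _))) = ℕᵖ.<⇒≱ (<-trans v<a (≤-<-trans le (≤-reflexive (sym eq)))) ≤-refl
        off-cut (inj₁ v<a) (inj₂ (inj₁ (refl , _))) = <-irrefl refl v<a
        off-cut (inj₁ v<a) (inj₂ (inj₂ (refl , _))) = <-irrefl refl (<-trans v<a a<b)
        off-cut (inj₂ b<v) (inj₁ (inj₁ (_ , eq , le))) = ℕᵖ.<⇒≱ (<-trans b<v (≤-reflexive (sym eq))) le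
        off-cut (inj₂ b<v) (inj₁ (inj₂ (_ , _ , le))) = ℕᵖ.<⇒≱ b<v le
        off-cut (inj₂ b<v) (inj₂ (inj₁ (refl , _))) = <-irrefl refl (<-trans b<v a<b)
        off-cut (inj₂ b<v) (inj₂ (inj₂ (refl , _))) = <-irrefl refl b<v

      in-outside : ∀ {v w} → Outside v → E w v → φ (w , v) ≡ false
      in-outside out e = trans (sym (φ-next e)) (out-outside out (rotate-adj (E-sym e)))

      -- Turning about `b` from the outer dart, the value stays false as long as `ab` has not been
      -- crossed, thus up to the dart `(b , a)` itself.
      chord-false : φ (b , a) ≡ false
      chord-false = ¬-not λ t → absurd t (proj₂ (reach-closed (λ y → E b y × φ (b , y) ≡ false) (rotate-false t)
          (E-succ b , φ-outer (outer-succ b)) (rotate-reach (E-succ b) (E-sym a~b))))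
        where
        rotate-false : φ (b , a) ≡ true → ∀ {y} → E b y × φ (b , y) ≡ false → E b (σ b y) × φ (b , σ b y) ≡ false
        rotate-false t {y} (e , f) with onCut? a b b y
        ... | no off = rotate-adj e , trans (φ-next (E-sym e)) (trans (sym (φ-off e off)) f)
        ... | yes (inj₁ (inj₁ (_ , eq , le))) = contradiction le (ℕᵖ.<⇒≱ (≤-reflexive (sym eq)))
        ... | yes (inj₁ (inj₂ (_ , eq , _))) = rotate-adj e , φ-outer (subst (Outer b)
                (sym (trans (cong (σ b) (succ-injective (trans (sym (consecutive⇒succ eq)) (sym (succ-pred b))))) (rotate-pred b)))
                (outer-succ b))
        ... | yes (inj₂ (inj₁ (refl , _))) = contradiction a<b (<-irrefl refl)
        ... | yes (inj₂ (inj₂ (_ , refl))) = absurd t f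

      chord-true : φ (a , b) ≡ true
      chord-true = trans (φ-on a~b (inj₂ (inj₁ (refl , refl)))) (cong not chord-false)

    -- In the cut along `cd`, the dart `(y , b)` would be inside because of `y` and outside because
    -- of `b`.
    noncrossing : ∀ {c d y b} → E c d → E y b → pos c < pos y → pos y < pos d → pos d < pos b → ⊥
    noncrossing {c} {d} {y} {b} c~d y~b c<y y<d d<b = absurd (out-inside c<y y<d y~b b≢succ) (in-outside (inj₂ d<b) y~b)
      where
      open CutFacts c~d (≤-trans (s≤s c<y) y<d)
      b≢succ : b ≢ succ y
      b≢succ refl = ℕᵖ.<⇒≱ d<b (≤-trans (pos-succ-≤ y) y<d)

    -- The face below a chord

    module LowerFace {a b : V} (a~b : E a b) (long : suc (pos a) < pos b)
      (subtree : ∀ {c d} → E c d → pos c < pos d → pos d ∸ pos c < pos b ∸ pos a → Tree c d) where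

      open CutFacts a~b long

      -- An edge over `z` that ends before `y` crosses `zy`. If it ends at `y`, its cut has the dart
      -- `(y , z)` inside and the preceding dart `(x , y)` of the same face outside.
      chain-unjumped : ∀ {x y z} → E x y → pos y < pos x → σ y x ≡ z → pos z < pos y → Unjumped a y z
      chain-unjumped {x} {y} {z} x~y y<x refl z<y {c} {d} c~d a≤c c<z z<d d≤y with ℕᵖ.m≤n⇒m<n∨m≡n d≤y
      ... | inj₁ d<y = noncrossing c~d (E-sym (rotate-adj (E-sym x~y))) c<z z<d d<y
      ... | inj₂ d≡y with pos-injective d≡y
      ... | refl = absurd (Cy.in-inside c<z z<y y~z y≢pred) (trans (Cy.φ-next x~y) (Cy.out-outside (inj₂ y<x) x~y))
        where
        module Cy = CutFacts c~d (≤-trans (s≤s c<z) z<d)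
        y~z = rotate-adj (E-sym x~y)
        y≢pred : y ≢ pred z
        y≢pred eq = ℕᵖ.<⇒≱ z<y (≤-trans (ℕᵖ.n≤1+n _) (≤-reflexive (trans (cong (suc ∘ pos) eq) (sym (pos-pred z (pos<⇒≢first c<z))))))

      record OnFace (x y : V) : Set where
        field
          adjacent : E x y
          falling : pos y < pos x
          top : x ≡ b ⊎ UnjumpedBut a b x
          inside : φ (x , y) ≡ true

      interval : ∀ {y z} → E y z → φ (y , z) ≡ true → pos a ≤ pos z × pos z ≤ pos b
      interval {y} {z} e t = ℕᵖ.≮⇒≥ (λ lt → absurd t (in-outside (inj₁ lt) e)) , ℕᵖ.≮⇒≥ (λ lt → absurd t (in-outside (inj₂ lt) e))

      -- In the cut along `yx`, the dart `(x , y)` lies on the outer side of the chord, but its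
      -- successor on the same face would be inside.
      not-above : ∀ {x y} → OnFace x y → pos y < pos (σ y x) → pos (σ y x) < pos x → ⊥
      not-above {x} {y} on y<z z<x = absurd (Yx.in-inside y<z z<x y~z y≢pred) (trans (Yx.φ-next adjacent) Yx.chord-false)
        where
        open OnFace on
        z = σ y x
        y~z = rotate-adj (E-sym adjacent)
        module Yx = CutFacts (E-sym adjacent) (≤-trans (s≤s y<z) z<x)
        y≢pred : y ≢ pred z
        y≢pred eq = absurd (trans (φ-next adjacent) inside) (φ-outer (subst (λ w → Outer w z) (sym eq) (outer-pred z)))

      next-inside : ∀ {x y} → OnFace x y → φ (y , σ y x) ≡ true
      next-inside on = trans (φ-next (OnFace.adjacent on)) (OnFace.inside on)

      -- The cuts along ab and yx exclude every other position of the next vertex σ y x of the face.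
      step-down : ∀ {x y} → OnFace x y → pos a < pos y → pos a ≤ pos (σ y x) × pos (σ y x) < pos y
      step-down {x} {y} on a<y = proj₁ z-interval , below
        where
        open OnFace on
        y~z : E y (σ y x)
        y~z = rotate-adj (E-sym adjacent)
        z-interval = interval y~z (next-inside on)
        below : pos (σ y x) < pos y
        below with <-cmp (pos (σ y x)) (pos y)
        ... | tri< lt _ _ = lt
        ... | tri≈ _ eq _ = contradiction (sym (pos-injective eq)) (E⇒≢ y~z)
        ... | tri> _ _ y<z with <-cmp (pos (σ y x)) (pos x)
        ... | tri< z<x _ _ = ⊥-elim (not-above on y<z z<x)
        ... | tri≈ _ eq _ = contradiction (subst (λ w → pos w < pos y) (rotate-fixed (E-sym adjacent) (pos-injective eq) (E-pred y))
                (≤-reflexive (sym (pos-pred y (pos<⇒≢first a<y))))) (ℕᵖ.<-asym falling)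
        ... | tri> _ _ x<z with top
        ... | inj₁ refl = contradiction (proj₂ z-interval) (ℕᵖ.<⇒≱ x<z)
        ... | inj₂ unjumped = contradiction (cong pos (proj₁ (unjumped y~z (<⇒≤ a<y) falling x<z (proj₂ z-interval))))
                (λ eq → ℕᵖ.<⇒≢ a<y (sym eq))

      -- A vertex below `x` is excluded as in `not-above`. Returning to `x` would make it the only
      -- neighbour of `a`, which also has `b`. Above `x`, only the edge `ab` passes over it.
      close : ∀ {x} → OnFace x a → pos x < pos b → σ a x ≡ b
      close {x} on x<b with <-cmp (pos (σ a x)) (pos x)
        where open OnFace on
      ... | tri< z<x _ _ = ⊥-elim (not-above on (ℕᵖ.≤∧≢⇒< (proj₁ (interval a~z (next-inside on))) (E⇒≢ a~z ∘ pos-injective)) z<x)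
        where
        a~z : E a (σ a x)
        a~z = rotate-adj (E-sym (OnFace.adjacent on))
      ... | tri≈ _ eq _ = contradiction (cong pos (rotate-fixed (E-sym (OnFace.adjacent on)) (pos-injective eq) a~b)) (λ eq → ℕᵖ.<⇒≢ x<b (sym eq))
      ... | tri> _ _ x<z with OnFace.top on
      ... | inj₁ refl = contradiction x<b (<-irrefl refl)
      ... | inj₂ unjumped = proj₂ (unjumped a~z ≤-refl (OnFace.falling on) x<z (proj₂ (interval a~z (next-inside on))))
        where
        a~z : E a (σ a x)
        a~z = rotate-adj (E-sym (OnFace.adjacent on))

      -- The walk along the face from the dart `(x , y)` down to `a`, with `suc k` darts.
      data Descent : V → V → ℕ → Set where
        bottom : ∀ {x} → pos a < pos x → σ a x ≡ b → Descent x a 0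
        down : ∀ {x y k} → pos y < pos x → Descent y (σ y x) k → Descent x y (suc k)

      -- Walk and chain are built together so that they share `k`: this carries the parity of the
      -- face length over to the number of links.
      descend : ∀ {x y} → OnFace x y → pos a < pos y → UnjumpedBut a b y → pos y < pos b → Acc _<_ (pos y) →
        ∃ λ k → Descent x y k × Chain a y k
      descend {x} {y} on a<y unjumped y<b (acc smaller) with ℕᵖ.m≤n⇒m<n∨m≡n (proj₁ (step-down on a<y))
      ... | inj₂ a≡z with pos-injective a≡z
      ... | a≡z′ = 1 , down falling (subst (λ z → Descent y z 0) a≡z′ (bottom a<y (close (subst (OnFace y) (sym a≡z′) on′) y<b))) ,
          one (subst (λ z → Tree z y) (sym a≡z′) (subtree (E-sym y~z) z<y small))
        where
        open OnFace on
        z<y = proj₂ (step-down on a<y)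
        y~z = rotate-adj (E-sym adjacent)
        on′ : OnFace y (σ y x)
        on′ = record { adjacent = y~z ; falling = z<y ; top = inj₂ unjumped ; inside = next-inside on }
        small : pos y ∸ pos (σ y x) < pos b ∸ pos a
        small = subst (λ p → pos y ∸ p < pos b ∸ pos a) a≡z (ℕᵖ.∸-monoˡ-< y<b (<⇒≤ a<y))
      descend {x} {y} on a<y unjumped y<b (acc smaller) | inj₁ a<z = extend (descend on′ a<z but (<-trans z<y y<b) (smaller z<y))
        where
        open OnFace on
        z<y = proj₂ (step-down on a<y)
        y~z = rotate-adj (E-sym adjacent)
        on′ : OnFace y (σ y x)
        on′ = record { adjacent = y~z ; falling = z<y ; top = inj₂ unjumped ; inside = next-inside on }
        un : Unjumped a y (σ y x)
        un = chain-unjumped adjacent falling refl z<y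
        but : UnjumpedBut a b (σ y x)
        but {c} {d} c~d a≤c c<z z<d d≤b with pos d ≤? pos y
        ... | yes d≤y = ⊥-elim (un c~d a≤c c<z z<d d≤y)
        ... | no d≰y = unjumped c~d a≤c (<-trans c<z z<y) (ℕᵖ.≰⇒> d≰y) d≤b
        small : pos y ∸ pos (σ y x) < pos b ∸ pos a
        small = ≤-<-trans (ℕᵖ.∸-monoʳ-≤ (pos y) (<⇒≤ a<z)) (ℕᵖ.∸-monoˡ-< y<b (<⇒≤ a<y))
        extend : (∃ λ k → Descent y (σ y x) k × Chain a (σ y x) k) → ∃ λ k → Descent x y k × Chain a y k
        extend (k , descent , chain) = suc k , down falling descent , snoc a<z z<y un chain (subtree (E-sym y~z) z<y small)

      apex : V
      apex = σ b a

      b~apex : E b apex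
      b~apex = rotate-adj (E-sym a~b)

      apex-inside : φ (b , apex) ≡ true
      apex-inside = trans (φ-next a~b) chord-true

      a<apex : pos a < pos apex
      a<apex = ℕᵖ.≤∧≢⇒< (proj₁ (interval b~apex apex-inside)) λ eq → ℕᵖ.<⇒≢ long (sym (trans (pos-pred b (pos<⇒≢first a<b))
        (cong (suc ∘ pos) (rotate-fixed (E-sym a~b) (sym (pos-injective eq)) (E-pred b)))))

      apex<b : pos apex < pos b
      apex<b = ℕᵖ.≤∧≢⇒< (proj₂ (interval b~apex apex-inside)) (E⇒≢ (E-sym b~apex) ∘ pos-injective)

      -- An edge over the apex ending before `b` crosses the edge from the apex to `b`. One from `c`
      -- to `b` with `c` above `a` would separate `(b , apex)` from the dart `(a , b)` before it on
      -- the face.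
      apex-unjumped : UnjumpedBut a b apex
      apex-unjumped {c} {d} c~d a≤c c<y y<d d≤b with ℕᵖ.m≤n⇒m<n∨m≡n d≤b
      ... | inj₁ d<b = ⊥-elim (noncrossing c~d (E-sym b~apex) c<y y<d d<b)
      ... | inj₂ d≡b with pos-injective d≡b | ℕᵖ.m≤n⇒m<n∨m≡n a≤c
      ... | refl | inj₂ a≡c = sym (pos-injective a≡c) , refl
      ... | refl | inj₁ a<c = absurd (Cb.in-inside c<y y<d b~apex b≢pred) (trans (Cb.φ-next a~b) (Cb.out-outside (inj₁ a<c) a~b))
        where
        module Cb = CutFacts c~d (≤-trans (s≤s c<y) y<d)
        b≢pred : b ≢ pred apex
        b≢pred eq = ℕᵖ.<⇒≱ apex<b (≤-trans (ℕᵖ.n≤1+n _) (≤-reflexive (trans (cong (suc ∘ pos) eq) (sym (pos-pred apex (pos<⇒≢first c<y))))))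

      lower : ∃ λ k → Descent b apex k × Chain a apex k
      lower = descend (record { adjacent = b~apex ; falling = apex<b ; top = inj₁ refl ; inside = apex-inside })
        a<apex apex-unjumped apex<b (<-wellFounded (pos apex))

      darts : ∀ {x y k} → Descent x y k → List (Dart n)
      darts (bottom {x} _ _) = (x , a) ∷ []
      darts (down {x} {y} _ d) = (x , y) ∷ darts d

      darts-length : ∀ {x y k} (d : Descent x y k) → length (darts d) ≡ suc k
      darts-length (bottom _ _) = refl
      darts-length (down _ d) = cong suc (darts-length d)

      darts-falling : ∀ {x y k e} (d : Descent x y k) → e ∈ darts d → pos (proj₂ e) < pos (proj₁ e) × pos (proj₁ e) ≤ pos x
      darts-falling (bottom lt _) (here refl) = lt , ≤-refl
      darts-falling (down lt d) (here refl) = lt , ≤-refl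
      darts-falling (down lt d) (there m) = let (p , q) = darts-falling d m in p , ≤-trans q (<⇒≤ lt)

      darts-unique : ∀ {x y k} (d : Descent x y k) → Unique (darts d)
      darts-unique (bottom _ _) = [] ∷ []
      darts-unique (down lt d) = All.tabulate (λ { m refl → ℕᵖ.<⇒≱ lt (proj₂ (darts-falling d m)) }) ∷ darts-unique d

      darts-head : ∀ {x y k} (d : Descent x y k) → (x , y) ∈ darts d
      darts-head (bottom _ _) = here refl
      darts-head (down _ _) = here refl

      darts-next : ∀ {x y k e} (d : Descent x y k) → e ∈ darts d → next-dart e ∈ darts d ⊎ next-dart e ≡ (a , b)
      darts-next (bottom _ eq) (here refl) = inj₂ (cong (a ,_) eq)
      darts-next (down _ d) (here refl) = inj₁ (there (darts-head d))
      darts-next (down _ d) (there m) = [ inj₁ ∘ there , inj₂ ]′ (darts-next d m)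

      darts-reach : ∀ {x y k e} (d : Descent x y k) → e ∈ darts d → Reach next-dart (x , y) e
      darts-reach (bottom _ _) (here refl) = start
      darts-reach (down _ d) (here refl) = start
      darts-reach (down _ d) (there m) = reach-trans (next start) (darts-reach d m)

      -- The darts of the descent fall strictly, hence are distinct, and lead back to `(a , b)`;
      -- with this rising dart they form the whole orbit.
      face-length : ∀ {k} → Descent b apex k → faceLength (faceOf (a , b)) ≡ suc (suc k)
      face-length {k} d = hasCount-unique (hasCount-countB₂ (faceOf (a , b) ∋⟨_,_⟩)) record
        { elems = (a , b) ∷ darts d
        ; unique = All.tabulate (λ { m refl → ℕᵖ.<-asym a<b (proj₁ (darts-falling d m)) }) ∷ darts-unique d
        ; size = cong suc (darts-length d)
        ; sound = λ e m → ∈-faceOf⁺ {a , b} a~b (sound′ m)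
        ; complete = λ e m → reach-closed (_∈ (a , b) ∷ darts d) closed (here refl) (∈-faceOf⁻ {a , b} m)
        }
        where
        sound′ : ∀ {e} → e ∈ (a , b) ∷ darts d → Reach next-dart (a , b) e
        sound′ (here refl) = start
        sound′ (there m) = reach-trans (next start) (darts-reach d m)
        closed : ∀ {e} → e ∈ (a , b) ∷ darts d → next-dart e ∈ (a , b) ∷ darts d
        closed (here refl) = there (darts-head d)
        closed (there m) = [ there , (λ eq → here eq) ]′ (darts-next d m)

      finite-face : faceOf (a , b) ≢ Fout
      finite-face eq = ℕᵖ.<⇒≢ long (sym (trans (cong pos (outer⇒succ o)) (pos-succ a (pos<⇒succ≢first a<b))))
        where
        o : Outer a b
        o = subst (λ S → S ∋⟨ a , b ⟩ ≡ true) eq (∈-faceOf⁺ {a , b} a~b start)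

    E-first-final : E first final
    E-first-final = E-pred first

    module _ (odd-faces : ∀ D → IsFace G σ D → D ≢ Fout → Odd (faceLength D)) where

      tree : ∀ {a b} → E a b → pos a < pos b → Acc _<_ (pos b ∸ pos a) → Tree a b
      tree {a} {b} a~b a<b (acc smaller) with ℕᵖ.m≤n⇒m<n∨m≡n a<b
      ... | inj₂ eq = leaf a~b (sym eq)
      ... | inj₁ long = assemble lower
        where
        open LowerFace a~b long (λ c~d c<d small → tree c~d c<d (smaller small))
        assemble : (∃ λ k → Descent b apex k × Chain a apex k) → Tree a b
        assemble (k , descent , chain) = node a~b a<apex apex<b apex-unjumped chain
          (tree (E-sym b~apex) apex<b (smaller (ℕᵖ.∸-monoʳ-< a<apex (<⇒≤ apex<b))))
          (λ even → odd-faces _ (faceOf-isFace {a , b} a~b) finite-face (subst Even (sym (face-length descent)) (e2+ even)))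

      -- The outer edge joining `final` to `first` serves as top edge, so one tree describes all of
      -- `G`.
      whole : pos first < pos final → Tree first final
      whole lt = tree E-first-final lt (<-wellFounded _)

    -- Counting edges, chords and cycles

    first<final : pos first < pos final
    first<final = ℕᵖ.≤∧≢⇒< (subst (_≤ pos final) (sym pos-first) z≤n) (E⇒≢ E-first-final ∘ pos-injective)

    Rising : Dart n → Set
    Rising (u , v) = E u v × pos u < pos v

    -- `edgeCount` directs edges by vertex number, the trees by `pos`; `orient` is a bijection
    -- between the two choices.
    rising-count : HasCount Rising (edgeCount G)
    rising-count = subst (HasCount Rising) (hasCount-unique oriented (hasCount-countB₂ (λ u v → adj G u v ∧ (toℕ u <ᵇ toℕ v)))) rising
      where
      filtered : ∃ λ e → HasCount (λ d → (⊤ × ⊤) × Rising d) e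
      filtered = hasCount-filter (hasCount-× (hasCount-Fin n) (hasCount-Fin n)) (λ (u , v) → (adj G u v ≟ᵇ true) ×-dec (pos u <? pos v))
      rising : HasCount Rising (proj₁ filtered)
      rising = hasCount-⇔ (proj₂ filtered) proj₂ ((tt , tt) ,_)
      orient-rising : ∀ {d e} → Rising d → Rising e → orient d ≡ orient e → d ≡ e
      orient-rising {d} {e} (_ , lt) (_ , lt′) eq with orient-≡ d e eq
      ... | inj₁ refl = refl
      ... | inj₂ refl = contradiction lt (ℕᵖ.<-asym lt′)
      orient-id : ∀ {u v} → Oriented (u , v) → orient (u , v) ≡ (u , v) × orient (v , u) ≡ (u , v)
      orient-id {u} {v} o with adj G u v | toℕ u <ᵇ toℕ v in lt | toℕ v <ᵇ toℕ u in gt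
      ... | true | true | false = refl , refl
      ... | true | true | true = contradiction (ℕᵖ.<ᵇ⇒< (toℕ u) (toℕ v) (Equivalence.from T-≡ lt))
          (ℕᵖ.<-asym (ℕᵖ.<ᵇ⇒< (toℕ v) (toℕ u) (Equivalence.from T-≡ gt)))
      oriented⇒E : ∀ {u v} → Oriented (u , v) → E u v
      oriented⇒E {u} {v} o with adj G u v
      ... | true = refl
      oriented : HasCount Oriented (proj₁ filtered)
      oriented = hasCount-⇔ (hasCount-map orient rising orient-rising) (λ { (d , (e , _) , refl) → orient-oriented {d} e }) preimage
        where
        preimage : ∀ {d} → Oriented d → ∃ λ e → Rising e × orient e ≡ d
        preimage {u , v} o with <-cmp (pos u) (pos v)
        ... | tri< lt _ _ = (u , v) , (oriented⇒E o , lt) , proj₁ (orient-id o)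
        ... | tri≈ _ eq _ = contradiction (pos-injective eq) (E⇒≢ (oriented⇒E o))
        ... | tri> _ _ gt = (v , u) , (E-sym (oriented⇒E o) , gt) , proj₂ (orient-id o)

    -- The n - 1 edges v (succ v) with v ≠ final are exactly the rising edges that are not chords.
    chord-count : ∀ {N} → HasCount {Dart n} (λ (c , d) → Within first final c d × Chord c d) N → f ≡ suc N
    chord-count {N} chords = ℕᵖ.+-cancelˡ-≡ n f (suc N) (begin
        n + f ≡⟨ euler ⟩
        2 + edgeCount G ≡⟨ cong (2 +_) (hasCount-unique rising-count split-rising) ⟩
        2 + (U + N) ≡⟨ cong suc (+-suc U N) ⟨
        suc U + suc N ≡⟨ cong (_+ suc N) n≡ ⟨
        n + suc N ∎)
      where
      open ≡-Reasoning
      filtered : ∃ λ U → HasCount (λ v → ⊤ × v ≢ final) U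
      filtered = hasCount-filter (hasCount-Fin n) (λ v → ¬? (v Finᵖ.≟ final))
      U = proj₁ filtered
      n≡ : n ≡ suc U
      n≡ = hasCount-unique (hasCount-Fin n) (hasCount-⇔ (hasCount-⊎ (hasCount-singleton final) (proj₂ filtered) λ eq (_ , ne) → ne eq)
        (λ _ → tt) (λ {v} _ → either (v Finᵖ.≟ final)))
        where
        either : ∀ {v} → Dec (v ≡ final) → v ≡ final ⊎ (⊤ × v ≢ final)
        either (yes eq) = inj₁ eq
        either (no ne) = inj₂ (tt , ne)
      pos-succ′ : ∀ {v} → v ≢ final → pos (succ v) ≡ suc (pos v)
      pos-succ′ {v} v≢ = pos-succ v λ eq → v≢ (succ-injective (trans eq (sym succ-final)))
      Unit : Dart n → Set
      Unit d = ∃ λ v → (⊤ × v ≢ final) × (v , succ v) ≡ d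
      unit⇒consecutive : ∀ {u v} → Unit (u , v) → pos v ≡ suc (pos u)
      unit⇒consecutive (_ , (_ , v≢) , refl) = pos-succ′ v≢
      split-rising : HasCount Rising (U + N)
      split-rising = hasCount-⇔ (hasCount-⊎ (hasCount-map (λ v → v , succ v) (proj₂ filtered) (λ _ _ → cong proj₁)) chords
          λ unit (_ , _ , lt) → ℕᵖ.<⇒≢ lt (sym (unit⇒consecutive unit)))
        (λ { (inj₁ (v , (_ , v≢) , refl)) → E-succ v , ≤-reflexive (sym (pos-succ′ v≢)) ; (inj₂ (_ , e , lt)) → e , <-trans ≤-refl lt })
        (λ (e , lt) → classify e lt)
        where
        classify : ∀ {u v} → E u v → pos u < pos v → Unit (u , v) ⊎ (Within first final u v × Chord u v)
        classify {u} {v} e lt with ℕᵖ.m≤n⇒m<n∨m≡n lt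
        ... | inj₁ long = inj₂ ((subst (_≤ pos u) (sym pos-first) z≤n , pos-≤-final v) , e , long)
        ... | inj₂ eq = inj₁ (u , (tt , λ { refl → contradiction lt (ℕᵖ.≤⇒≯ (pos-≤-final v)) }) , cong (u ,_) (sym (consecutive⇒succ (sym eq))))

    -- A cycle determines its extremes and its path, and every path closes to a cycle. `P` speaks of
    -- the path and `Q` of the cycle, which is one longer.
    cycle-count : ∀ {P Q : ℕ → Set} {k} → (∀ {l} → P l → Q (suc l)) → (∀ {l} → Q (suc l) → P l) →
      HasCount {Triple} (λ (c , d , l) → Within first final c d × CyclePath c d l × P (length l)) k →
      HasCount (λ S → IsCycle G S × Q (cycleLength S)) k
    cycle-count {P} {Q} f⇒ f⇐ paths = hasCount-⇔ (hasCount-map cycleOf paths injective) sound complete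
      where
      Indexed : Triple → Set
      Indexed (c , d , l) = Within first final c d × CyclePath c d l × P (length l)
      cycleOf : Triple → Rel n
      cycleOf (c , _ , l) = cycleOn (c ∷ l)
      same-triple : ∀ {c d l c′ d′ l′} → CyclePath c d l → CyclePath c′ d′ l′ → c ∷ l ≡ c′ ∷ l′ → (c , d , l) ≡ (c′ , d′ , l′)
      same-triple {c} {l = l} (_ , p , _) (_ , p′ , _) refl = cong (λ x → c , x , l) (path-end-unique p p′)
      injective : ∀ {t t′} → Indexed t → Indexed t′ → cycleOf t ≡ cycleOf t′ → t ≡ t′
      injective (_ , cyc , _) (_ , cyc′ , _) eq = same-triple cyc cyc′ (cycleOn-injective cyc cyc′ eq)
      sound : ∀ {S} → (∃ λ t → Indexed t × cycleOf t ≡ S) → IsCycle G S × Q (cycleLength S)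
      sound (_ , (_ , cyc , p) , refl) = Cycle.isCycle cyc , subst Q (sym (Cycle.cycleLength-vs cyc)) (f⇒ p)
      complete : ∀ {S} → IsCycle G S × Q (cycleLength S) → ∃ λ t → Indexed t × cycleOf t ≡ S
      complete (cycle , q) = index q (CycleOrder.cycle⇒path noncrossing pos-≤-final cycle)
        where
        index : ∀ {S} → Q (cycleLength S) → (∃ λ a → ∃ λ b → ∃ λ l → CyclePath a b l × cycleOn (a ∷ l) ≡ S) → ∃ λ t → Indexed t × cycleOf t ≡ S
        index q (a , b , l , cyc , refl) = (a , b , l) , ((subst (_≤ pos a) (sym pos-first) z≤n , pos-≤-final b) , cyc ,
          f⇐ (subst Q (Cycle.cycleLength-vs cyc) q)) , refl

    -- With `co = ce + s` and `N = f - 1`, everything reduces to `N ≤ 2 * s`, `s < N` and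
    -- `N ≤ suc ce`.
    bounds : (∀ D → IsFace G σ D → D ≢ Fout → Odd (faceLength D)) → 3 ≤ f →
      ∀ co ce → HasCount (OddCycle G) co → HasCount (EvenCycle G) ce →
      (0 < ce) × ((f ∸ 1) + 2 * ce ≤ 2 * co) × (co ≤ (f ∸ 2) + ce) × (ce ≤ co) × (co ≤ 2 * ce)
    bounds odd-faces f≥3 co ce odds evens = conclude (treeBlock (whole odd-faces first<final))
      where
      even⇒odd : ∀ {l} → Even l → Odd (suc l)
      even⇒odd = even-suc-⊥
      odd⇒even : ∀ {l} → Odd (suc l) → Even l
      odd⇒even {l} o = [ id , (λ e → contradiction e o) ]′ (even? l)
      arithmetic : ∀ N s → f ≡ suc N → co ≡ ce + s → N ≤ 2 * s → N ≤ 1 ⊎ s < N → N ≤ suc ce →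
        (0 < ce) × ((f ∸ 1) + 2 * ce ≤ 2 * co) × (co ≤ (f ∸ 2) + ce) × (ce ≤ co) × (co ≤ 2 * ce)
      -- From here `N` is one less than the number of finite faces, that is `f ∸ 2`; `3 ≤ f` makes
      -- it positive, which excludes the single-face alternative in `fin`.
      arithmetic (suc N) s refl refl N≤2s fin N≤ce = ce>0 ,
          ≤-trans (ℕᵖ.+-monoˡ-≤ (2 * ce) N≤2s) (≤-reflexive (solveℕ 2 (λ p q → conℕ 2 ⊗ p ⊕ conℕ 2 ⊗ q ⊜ conℕ 2 ⊗ (q ⊕ p)) refl s ce)) ,
          ≤-trans (≤-reflexive (+-comm ce s)) (ℕᵖ.+-monoˡ-≤ ce s≤N) ,
          ℕᵖ.m≤m+n ce s ,
          ℕᵖ.+-monoʳ-≤ ce (≤-trans s≤N (≤-trans (s≤s⁻¹ N≤ce) (≤-reflexive (sym (ℕᵖ.+-identityʳ ce)))))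
        where
        N≥1 : 1 ≤ N
        N≥1 = s≤s⁻¹ (s≤s⁻¹ f≥3)
        ce>0 : 0 < ce
        ce>0 = ≤-trans N≥1 (s≤s⁻¹ N≤ce)
        s≤N : s ≤ N
        s≤N = [ (λ le → contradiction N≥1 (ℕᵖ.≤⇒≯ (s≤s⁻¹ le))) , s≤s⁻¹ ]′ fin
      arithmetic zero s refl = contradiction f≥3 λ { (s≤s ()) }
      conclude : TreeBlock first final →
        (0 < ce) × ((f ∸ 1) + 2 * ce ≤ 2 * co) × (co ≤ (f ∸ 2) + ce) × (ce ≤ co) × (co ≤ 2 * ce)
      conclude (B , fin , N≤ce) = arithmetic N s (chord-count chords)
          (trans (hasCount-unique odds (cycle-count {Even} {Odd} even⇒odd odd⇒even odd-cycles)) (trans excess (cong (_+ s) (sym ce≡))))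
          (N≤2s status) fin (subst (λ c → N ≤ suc c) (sym ce≡) N≤ce)
        where
        open Block B using (X; Y; N; s; chords; odd-cycles; even-cycles; excess; status)
        ce≡ : ce ≡ Block.ce B
        ce≡ = hasCount-unique evens (cycle-count {Even ∘ suc} {Even} id id even-cycles)
        N≤2s : Status X Y N s → N ≤ 2 * s
        N≤2s (inj₁ (_ , le , _)) = le
        N≤2s (inj₂ (_ , lt , _)) = <⇒≤ lt

theorem3p1 : ∀ {n : ℕ} (G : Graph n) (σ : Fin n → Fin n → Fin n) →
    TwoConnected G →
    IsRotationSystem G σ →
    ∀ (f : ℕ) → HasCount (IsFace G σ) f →
    n + f ≡ 2 + edgeCount G →
    ∀ (Fout : Rel n) → IsFace G σ Fout → AllVerticesOn Fout →
    (∀ (D : Rel n) → IsFace G σ D → D ≢ Fout → Odd (faceLength D)) →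
    3 ≤ f →
    ∀ (co ce : ℕ) → HasCount (OddCycle G) co → HasCount (EvenCycle G) ce →
    (0 < ce) ×
    ((f ∸ 1) + 2 * ce ≤ 2 * co) ×
    (co ≤ (f ∸ 2) + ce) ×
    (ce ≤ co) × (co ≤ 2 * ce)
theorem3p1 G σ 2conn rotation f faces euler Fout isFace spanning =
  PlaneMap.OuterFace.bounds G σ rotation (proj₁ (proj₂ 2conn)) faces euler 2conn Fout isFace spanning
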